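{- \begin{align*} \xi_1^{\equiv4(32)}&=3\cdot2^{ -2s}(\xi_5-2^{ -4s}\xi_1),\\ (\xi_1^\vee)^{\cong-20(32)}&=3\cdot2^{ -2s}(\xi_4^\vee-2^{ -4s}\xi_1^\vee),\\ \xi_1^{\equiv20(32)}&=(\xi_4-\xi_2-\xi_5+2^{1-4s}\xi_1)+2^{ -4s}(\xi_1-\xi_4-2\xi_3+4\xi_5)\\ &\qquad-2^{ -2s}(\xi_1-\xi_3-2\xi_2+5\cdot2^{ -4s}\xi_1),\\ (\xi_1^\vee)^{\cong-4(32)}&=(\xi_5^\vee-\xi_3^\vee-\xi_4^\vee+2^{1-4s}\xi_1^\vee)+2^{ -4s}(\xi_1^\vee-\xi_5^\vee-2\xi_2^\vee+4\xi_4^\vee)\\ &\qquad-2^{ -2s}(\xi_1^\vee-\xi_2^\vee-2\xi_3^\vee+5\cdot2^{ -4s}\xi_1^\vee). \end{align*}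
   Context: Binary cubic forms $au^3+bu^2v+cuv^2+dv^3$ are identified with $(a,b,c,d)\in\mathbb{Q}^4$, with discriminant $P(x)=b^2c^2+18abcd-4ac^3-4b^3d-27a^2d^2$, and $\Gamma(1)=\mathrm{SL}_2(\mathbb{Z})$ acts by linear change of variables. Lattices: $L_1=\mathbb{Z}^4$, $L_2=\{a+b+d,\ a+c+d\in 2\mathbb{Z}\}$, $L_3=\{a+b+c,\ b+c+d\in 2\mathbb{Z}\}$, $L_4=\{b+c\in2\mathbb{Z}\}$, $L_5=\{a,d,b+c\in 2\mathbb{Z}\}$ (inside $L_1$); $L_1^\vee=\{a,d\in\mathbb{Z},\ b,c\in3\mathbb{Z}\}$, $L_2^\vee=L_1^\vee\cap L_3$, $L_3^\vee=L_1^\vee\cap L_2$, $L_4^\vee=L_1^\vee\cap L_5$, $L_5^\vee=L_1^\vee\cap L_4$. All zeta functions are 2-vectors indexed by $j=1,2$ (sign of discriminant $(-1)^{j-1}P(x)>0$), with $s$ suppressed: $\xi_i$ has $j$-th entry $\sum_{x\in\Gamma(1)\backslash L_i,\ (-1)^{j-1}P(x)>0}|\mathrm{Stab}(x)|^{ -1}|P(x)|^{ -s}$, and $\xi_i^\vee$ has $j$-th entry $\sum_{x\in\Gamma(1)\backslash L_i^\vee,\ (-1)^{j-1}P(x)>0}|\mathrm{Stab}(x)|^{ -1}|P(x)/27|^{ -s}$, $\mathrm{Stab}(x)$ the stabilizer in $\mathrm{SL}_2(\mathbb{Z})$. For $l,N\in\mathbb{Z}$, $L_1^{\equiv l(N)}=\{x\in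 L_1\mid P(x)\equiv l\bmod N\}$, $(L_1^\vee)^{\cong l(N)}=\{x\in L_1^\vee\mid P(x)/27\equiv l\bmod N\}$; $\xi_1^{\equiv l(N)}$ is defined like $\xi_1$ but summing over $\Gamma(1)\backslash L_1^{\equiv l(N)}$, and $(\xi_1^\vee)^{\cong l(N)}$ is the partial zeta function of $(L_1^\vee)^{\cong l(N)}$ under $\Gamma(1)$. -}

module Defs where

open import Data.Nat as ℕ using (ℕ; zero; suc)
open import Data.Integer as ℤ using (ℤ; +_; _-_; -_)
open import Data.Integer.Divisibility as ℤ∣ using ()
open import Data.Integer.DivMod using (_/ℕ_; _%ℕ_)
open import Data.Rational as ℚ using (ℚ; 0ℚ)
open import Data.Fin using (Fin; zero; suc)
open import Data.List using (List; []; _∷_; length; lookup)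
open import Data.List.Relation.Unary.All using (All)
open import Data.List.Relation.Unary.Any using (Any)
open import Data.List.Relation.Unary.Unique.Propositional using (Unique)
open import Data.List.Membership.Propositional using (_∈_)
open import Data.Product using (_×_; Σ; ∃)
open import Data.Unit using (⊤)
open import Data.Bool using (if_then_else_)
open import Function.Bundles using (_⇔_)
open import Relation.Binary.PropositionalEquality using (_≡_)

-- Integral binary cubic forms  a u³ + b u² v + c u v² + d v³

record Form : Set where
  constructor form
  field
    a b c d : ℤ
open Form public

-- discriminant P(x) = b²c² + 18abcd − 4ac³ − 4b³d − 27a²d²
P : Form → ℤ
P (form a b c d) =
  b ℤ.* b ℤ.* c ℤ.* c ℤ.+ + 18 ℤ.* a ℤ.* b ℤ.* c ℤ.* d
  - + 4 ℤ.* a ℤ.* c ℤ.* c ℤ.* c - + 4 ℤ.* b ℤ.* b ℤ.* b ℤ.* d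
  - + 27 ℤ.* a ℤ.* a ℤ.* d ℤ.* d

record Mat : Set where
  constructor mat
  field
    p q r s : ℤ

det : Mat → ℤ
det (mat p q r s) = p ℤ.* s - q ℤ.* r

-- action by linear change of variables:
-- (γ·F)(u,v) = F(p u + q v, r u + s v)
act : Mat → Form → Form
act (mat p q r s) (form a b c d) = form a' b' c' d'
  where
  a' = a ℤ.* p ℤ.* p ℤ.* p ℤ.+ b ℤ.* p ℤ.* p ℤ.* r ℤ.+ c ℤ.* p ℤ.* r ℤ.* r ℤ.+ d ℤ.* r ℤ.* r ℤ.* r
  d' = a ℤ.* q ℤ.* q ℤ.* q ℤ.+ b ℤ.* q ℤ.* q ℤ.* s ℤ.+ c ℤ.* q ℤ.* s ℤ.* s ℤ.+ d ℤ.* s ℤ.* s ℤ.* s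
  b' = + 3 ℤ.* a ℤ.* p ℤ.* p ℤ.* q
       ℤ.+ b ℤ.* (p ℤ.* p ℤ.* s ℤ.+ + 2 ℤ.* p ℤ.* q ℤ.* r)
       ℤ.+ c ℤ.* (q ℤ.* r ℤ.* r ℤ.+ + 2 ℤ.* p ℤ.* r ℤ.* s)
       ℤ.+ + 3 ℤ.* d ℤ.* r ℤ.* r ℤ.* s
  c' = + 3 ℤ.* a ℤ.* p ℤ.* q ℤ.* q
       ℤ.+ b ℤ.* (+ 2 ℤ.* p ℤ.* q ℤ.* s ℤ.+ q ℤ.* q ℤ.* r)
       ℤ.+ c ℤ.* (p ℤ.* s ℤ.* s ℤ.+ + 2 ℤ.* q ℤ.* r ℤ.* s)
       ℤ.+ + 3 ℤ.* d ℤ.* r ℤ.* s ℤ.* s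

_∼_ : Form → Form → Set
x ∼ y = Σ Mat (λ γ → det γ ≡ + 1 × act γ x ≡ y)

Even : ℤ → Set
Even z = + 2 ℤ∣.∣ z

data Idx : Set where
  i1 i2 i3 i4 i5 : Idx

L : Idx → Form → Set
L i1 x = ⊤
L i2 (form a b c d) = Even (a ℤ.+ b ℤ.+ d) × Even (a ℤ.+ c ℤ.+ d)
L i3 (form a b c d) = Even (a ℤ.+ b ℤ.+ c) × Even (b ℤ.+ c ℤ.+ d)
L i4 (form a b c d) = Even (b ℤ.+ c)
L i5 (form a b c d) = Even a × Even d × Even (b ℤ.+ c)

L1∨ : Form → Set
L1∨ (form a b c d) = (+ 3 ℤ∣.∣ b) × (+ 3 ℤ∣.∣ c)

L∨ : Idx → Form → Set
L∨ i1 x = L1∨ x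
L∨ i2 x = L1∨ x × L i3 x
L∨ i3 x = L1∨ x × L i2 x
L∨ i4 x = L1∨ x × L i5 x
L∨ i5 x = L1∨ x × L i4 x

Lcong : ℤ → ℕ → Form → Set
Lcong l N x = + N ℤ∣.∣ (P x - l)

L∨cong : ℤ → ℕ → Form → Set
L∨cong l N x = L1∨ x × Σ ℤ (λ k → P x ≡ + 27 ℤ.* k × + N ℤ∣.∣ (k - l))

weight : List Mat → ℚ
weight [] = 0ℚ
weight (_ ∷ xs) = (+ 1) ℚ./ suc (length xs)

sumFin : (n : ℕ) → (Fin n → ℚ) → ℚ
sumFin zero f = 0ℚ
sumFin (suc n) f = f zero ℚ.+ sumFin n (λ i → f (suc i))

-- `Mass S D m` : m is the sum, over a complete irredundant set of
-- representatives of the Γ(1)-orbits in {x ∈ S | P(x) = D}, of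
-- 1/|Stab(x)|, where Stab(x) is listed exactly (without repetition).
record Mass (S : Form → Set) (D : ℤ) (m : ℚ) : Set where
  field
    reps     : List Form
    repsIn   : All S reps
    repsDisc : All (λ x → P x ≡ D) reps
    cover    : ∀ x → S x → P x ≡ D → Any (λ r → x ∼ r) reps
    distinct : ∀ i j → lookup reps i ∼ lookup reps j → i ≡ j
    stab     : Fin (length reps) → List Mat
    stabUniq : ∀ i → Unique (stab i)
    stabSpec : ∀ i γ → (γ ∈ stab i) ⇔ (det γ ≡ + 1 × act γ (lookup reps i) ≡ lookup reps i)
    massEq   : m ≡ sumFin (length reps) (λ i → weight (stab i))

-- Dirichlet coefficient of 2^{-ks}·ξ : shift by d = 2^k.
-- (sh d f) D = f (D/d) if d ∣ D, and 0 otherwise.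

sh : (d : ℕ) → .{{_ : ℕ.NonZero d}} → (ℤ → ℚ) → ℤ → ℚ
sh d f D = if (D %ℕ d) ℕ.≡ᵇ 0 then f (D /ℕ d) else 0ℚ

module Submission where

-- A mass is a groupoid cardinality. Given two orbit sets and a relation between them by
-- matrices h of fixed determinant, summing |Arrows(x, y)| / (|Stab x| |Stab y|) over pairs of
-- representatives in both orders shows that the masses weighted by the number of arrows
-- modulo SL₂(ℤ) agree on the two sides. For determinant 1 this turns every mass into a sum
-- over the representatives of the ambient lattice and relates F to 2 F. For determinant 2,
--     (a, b, c, d) with d even   ↔   (4 a, 2 b, c, d / 2)
-- pairs forms of discriminant E with a marked root modulo 2 and forms of discriminant 4 E
-- with a marked double root (4 ∣ a, 2 ∣ b). Restricting the factorisation type modulo 2 on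
-- either side gives four correspondences, after which every claimed relation is an identity
-- between weights that depend only on the coefficients modulo 8, since P is a square plus 4 W
-- and its residue 4 or 20 modulo 32 is visible there.

open import Data.Bool using (Bool; true; false; _∧_; _∨_; _xor_; not; if_then_else_; T)
open import Data.Empty using (⊥; ⊥-elim)
open import Data.Fin using (Fin; zero; suc)
import Data.Fin.Properties as Fin
open import Data.Integer as ℤ using (ℤ)
open import Data.Integer.DivMod using (_/ℕ_; _%ℕ_; a≡a%ℕn+[a/ℕn]*n; n%ℕd<d)
import Data.Integer.Divisibility as ℤ∣
import Data.Integer.Divisibility.Signed as ℤ∣ˢ
import Data.Integer.Properties as ℤ
open import Data.Integer.Tactic.RingSolver using (solve-∀)
open import Data.List using (List; []; _∷_; _++_; length; lookup; map)
open import Data.List.Membership.Propositional using (_∈_)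
open import Data.List.Membership.Propositional.Properties using (∈-map⁺; ∈-map⁻; ∈-++⁺ˡ; ∈-++⁺ʳ; ∈-++⁻; ∈-lookup)
open import Data.List.Membership.Propositional.Properties.WithK using (unique∧set⇒bag)
open import Data.List.Properties using (length-map; length-++)
open import Data.List.Relation.Binary.BagAndSetEquality using (∼bag⇒↭)
open import Data.List.Relation.Binary.Permutation.Propositional.Properties using (↭-length)
open import Data.List.Relation.Binary.Pointwise using (Pointwise; []; _∷_)
open import Data.List.Relation.Unary.All as All using (All; []; _∷_)
open import Data.List.Relation.Unary.AllPairs using (AllPairs; []; _∷_)
open import Data.List.Relation.Unary.Any as Any using (Any; here; there)
open import Data.List.Relation.Unary.Any.Properties using (lookup-index)
open import Data.List.Relation.Unary.Unique.Propositional using (Unique)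
import Data.List.Relation.Unary.Unique.Propositional.Properties as Unique
open import Data.Nat as ℕ using (ℕ; zero; suc; z≤n; s≤s)
import Data.Nat.DivMod as ℕ
import Data.Nat.Properties as ℕ
open import Data.Product using (Σ; ∃; ∃₂; _×_; _,_; proj₁; proj₂)
import Data.Rational as ℚ
open import Data.Rational using (ℚ; 0ℚ; 1ℚ)
import Data.Rational.Properties as ℚ
open import Data.Rational.Solver using (module +-*-Solver)
import Data.Rational.Unnormalised as ℚᵘ
import Data.Rational.Unnormalised.Properties as ℚᵘ
open import Data.Sum using (_⊎_; inj₁; inj₂)
open import Data.Unit using (⊤; tt)
open import Data.Vec as Vec using (Vec; []; _∷_)
open import Defs
open import Function using (_∘_)
open import Function.Bundles using (_⇔_; mk⇔; Equivalence)
open import Relation.Binary.PropositionalEquality using (_≡_; _≢_; refl; sym; trans; cong; cong₂; subst; module ≡-Reasoning)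
open import Relation.Nullary using (¬_; yes; no)

-- The coefficients come from the behaviour at 2. A form of odd discriminant with a root modulo 2
-- has discriminant 1 modulo 8 if it is split and 5 if it is mixed, so dividing at a marked double
-- root turns the residue 4 of `P` into the split type and the residue 20 into the mixed one. The
-- residue 20 has a second source: cubes modulo 2 whose triple root does not lift to a root modulo
-- 4. Subtracting the cubes whose root does lift leads to double roots at level D/4, and those that
-- lift there need a second Hecke step; this is why the formula for 20 involves D, D/4 and D/16. The
-- lattices enter because each of them is a union of factorisation types modulo 2.
--
-- The dual relations need no argument of their own. Every condition used concerns the prime 2, 27
-- is a unit modulo 32, and each dual lattice is `L1∨` cut by the parity conditions of another `L`.
-- So everything is proved for discriminants K D with K = 1 or K = 27. Masses are given only for D ≠
-- 0, and dividing D by 4 or 16 preserves this.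

module _ where
  open import Data.Integer using (+_; -_; _+_; _*_; _-_)

  -- Integral matrices and their action on cubic forms.

  infixl 7 _⊗_
  opaque
    _⊗_ : Mat → Mat → Mat
    mat p q r s ⊗ mat p′ q′ r′ s′ =
      mat (p * p′ + q * r′) (p * q′ + q * s′) (r * p′ + s * r′) (r * q′ + s * s′)

  adj : Mat → Mat
  adj (mat p q r s) = mat s (- q) (- r) p

  scalar : ℤ → Mat
  scalar n = mat n (+ 0) (+ 0) n

  scale : ℤ → Form → Form
  scale k (form a b c d) = form (k * a) (k * b) (k * c) (k * d)

  mat-cong : ∀ {p q r s p′ q′ r′ s′} → p ≡ p′ → q ≡ q′ → r ≡ r′ → s ≡ s′ →
    mat p q r s ≡ mat p′ q′ r′ s′
  mat-cong refl refl refl refl = refl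

  form-cong : ∀ {a b c d a′ b′ c′ d′} → a ≡ a′ → b ≡ b′ → c ≡ c′ → d ≡ d′ →
    form a b c d ≡ form a′ b′ c′ d′
  form-cong refl refl refl refl = refl

  opaque
    unfolding _⊗_
    det-⊗ : ∀ g h → det (g ⊗ h) ≡ det g * det h
    det-⊗ (mat p q r s) (mat p′ q′ r′ s′) = eq p q r s p′ q′ r′ s′
      where
      eq : ∀ p q r s p′ q′ r′ s′ →
        (p * p′ + q * r′) * (r * q′ + s * s′) - (p * q′ + q * s′) * (r * p′ + s * r′) ≡
        (p * s - q * r) * (p′ * s′ - q′ * r′)
      eq = solve-∀

  det-adj : ∀ g → det (adj g) ≡ det g
  det-adj (mat p q r s) = eq p q r s
    where
    eq : ∀ p q r s → s * p - (- q) * (- r) ≡ p * s - q * r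
    eq = solve-∀

  adj-involutive : ∀ g → adj (adj g) ≡ g
  adj-involutive (mat p q r s) = mat-cong refl (ℤ.neg-involutive q) (ℤ.neg-involutive r) refl

  opaque
    unfolding _⊗_
    adj-⊗ˡ : ∀ g → adj g ⊗ g ≡ scalar (det g)
    adj-⊗ˡ (mat p q r s) = mat-cong (eq₁ p q r s) (eq₂ q s) (eq₃ p r) (eq₄ p q r s)
      where
      eq₁ : ∀ p q r s → s * p + (- q) * r ≡ p * s - q * r
      eq₁ = solve-∀
      eq₂ : ∀ q s → s * q + (- q) * s ≡ + 0
      eq₂ = solve-∀
      eq₃ : ∀ p r → (- r) * p + p * r ≡ + 0
      eq₃ = solve-∀
      eq₄ : ∀ p q r s → (- r) * q + p * s ≡ p * s - q * r
      eq₄ = solve-∀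

  adj-⊗ʳ : ∀ g → g ⊗ adj g ≡ scalar (det g)
  adj-⊗ʳ g = begin
    g ⊗ adj g              ≡⟨ cong (_⊗ adj g) (adj-involutive g) ⟨
    adj (adj g) ⊗ adj g    ≡⟨ adj-⊗ˡ (adj g) ⟩
    scalar (det (adj g))   ≡⟨ cong scalar (det-adj g) ⟩
    scalar (det g)         ∎
    where open ≡-Reasoning

  opaque
    unfolding _⊗_
    ⊗-assoc : ∀ f g h → (f ⊗ g) ⊗ h ≡ f ⊗ (g ⊗ h)
    ⊗-assoc (mat p q r s) (mat p′ q′ r′ s′) (mat p″ q″ r″ s″) =
      mat-cong (eq p q p′ q′ r′ s′ p″ r″) (eq p q p′ q′ r′ s′ q″ s″)
               (eq r s p′ q′ r′ s′ p″ r″) (eq r s p′ q′ r′ s′ q″ s″)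
      where
      eq : ∀ p q p′ q′ r′ s′ x y →
        (p * p′ + q * r′) * x + (p * q′ + q * s′) * y ≡ p * (p′ * x + q′ * y) + q * (r′ * x + s′ * y)
      eq = solve-∀

  opaque
    unfolding _⊗_
    scalar-⊗ : ∀ n p q r s → scalar n ⊗ mat p q r s ≡ mat (n * p) (n * q) (n * r) (n * s)
    scalar-⊗ n p q r s = mat-cong (eq₁ n p r) (eq₁ n q s) (eq₂ n p r) (eq₂ n q s)
      where
      eq₁ : ∀ n p r → n * p + + 0 * r ≡ n * p
      eq₁ = solve-∀
      eq₂ : ∀ n p r → + 0 * p + n * r ≡ n * r
      eq₂ = solve-∀

  one-⊗ : ∀ g → scalar (+ 1) ⊗ g ≡ g
  one-⊗ (mat p q r s) = trans (scalar-⊗ (+ 1) p q r s)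
    (mat-cong (ℤ.*-identityˡ p) (ℤ.*-identityˡ q) (ℤ.*-identityˡ r) (ℤ.*-identityˡ s))

  opaque
    unfolding _⊗_
    ⊗-one : ∀ g → g ⊗ scalar (+ 1) ≡ g
    ⊗-one (mat p q r s) = mat-cong (eq₁ p q) (eq₂ p q) (eq₁ r s) (eq₂ r s)
      where
      eq₁ : ∀ p q → p * + 1 + q * + 0 ≡ p
      eq₁ = solve-∀
      eq₂ : ∀ p q → p * + 0 + q * + 1 ≡ q
      eq₂ = solve-∀

  *-cancelˡ : ∀ {n x y} → n ≢ + 0 → n * x ≡ n * y → x ≡ y
  *-cancelˡ {n} {x} {y} n≢0 = ℤ.*-cancelˡ-≡ n x y {{ℤ.≢-nonZero n≢0}}

  -- The adjugate turns `h` into the scalar `det h`, so the cancellation happens entry by entry in ℤ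
  -- and no rational inverse is needed.
  ⊗-cancelˡ : ∀ h {g g′} → det h ≢ + 0 → h ⊗ g ≡ h ⊗ g′ → g ≡ g′
  ⊗-cancelˡ h {mat p q r s} {mat p′ q′ r′ s′} n≢0 e =
    mat-cong (*-cancelˡ n≢0 (cong Mat.p e′)) (*-cancelˡ n≢0 (cong Mat.q e′))
             (*-cancelˡ n≢0 (cong Mat.r e′)) (*-cancelˡ n≢0 (cong Mat.s e′))
    where
    n : ℤ
    n = det h
    absorb : ∀ g → adj h ⊗ (h ⊗ g) ≡ scalar n ⊗ g
    absorb g = trans (sym (⊗-assoc (adj h) h g)) (cong (_⊗ g) (adj-⊗ˡ h))
    e′ : mat (n * p) (n * q) (n * r) (n * s) ≡ mat (n * p′) (n * q′) (n * r′) (n * s′)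
    e′ = begin
      mat (n * p) (n * q) (n * r) (n * s)        ≡⟨ scalar-⊗ n p q r s ⟨
      scalar n ⊗ mat p q r s                     ≡⟨ absorb (mat p q r s) ⟨
      adj h ⊗ (h ⊗ mat p q r s)                  ≡⟨ cong (adj h ⊗_) e ⟩
      adj h ⊗ (h ⊗ mat p′ q′ r′ s′)              ≡⟨ absorb (mat p′ q′ r′ s′) ⟩
      scalar n ⊗ mat p′ q′ r′ s′                 ≡⟨ scalar-⊗ n p′ q′ r′ s′ ⟩
      mat (n * p′) (n * q′) (n * r′) (n * s′)    ∎
      where open ≡-Reasoning

  scale-injective : ∀ {k F G} → k ≢ + 0 → scale k F ≡ scale k G → F ≡ G
  scale-injective k≢0 e =
    form-cong (*-cancelˡ k≢0 (cong a e)) (*-cancelˡ k≢0 (cong b e))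
              (*-cancelˡ k≢0 (cong c e)) (*-cancelˡ k≢0 (cong d e))

  scale-scale : ∀ j k F → scale j (scale k F) ≡ scale (j * k) F
  scale-scale j k (form a b c d) = form-cong (eq a) (eq b) (eq c) (eq d)
    where
    eq : ∀ x → j * (k * x) ≡ j * k * x
    eq x = sym (ℤ.*-assoc j k x)

  -- Opaque, so that the action is not expanded into its coefficients during unification.
  infixl 7 _▹_
  opaque
    _▹_ : Form → Mat → Form
    F ▹ g = act g F

    act⇒▹ : ∀ {g F G} → act g F ≡ G → F ▹ g ≡ G
    act⇒▹ e = e

    ▹⇒act : ∀ {g F G} → F ▹ g ≡ G → act g F ≡ G
    ▹⇒act e = e

  opaque
    unfolding _▹_
    -- Cubic forms have degree 3. This cube is the factor by which an arrow followed by its adjugate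
    -- misses the identity.
    ▹-scalar : ∀ n F → F ▹ scalar n ≡ scale (n * n * n) F
    ▹-scalar n (form a b c d) = form-cong (eqᵃ n a b c d) (eqᵇ n a b c d) (eqᶜ n a b c d) (eqᵈ n a b c d)
      where
      eqᵃ : ∀ n a b c d →
        a * n * n * n + b * n * n * + 0 + c * n * + 0 * + 0 + d * + 0 * + 0 * + 0 ≡ n * n * n * a
      eqᵃ = solve-∀
      eqᵇ : ∀ n a b c d → + 3 * a * n * n * + 0
          + b * (n * n * n + + 2 * n * + 0 * + 0)
          + c * (+ 0 * + 0 * + 0 + + 2 * n * + 0 * n)
          + + 3 * d * + 0 * + 0 * n ≡ n * n * n * b
      eqᵇ = solve-∀
      eqᶜ : ∀ n a b c d → + 3 * a * n * + 0 * + 0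
          + b * (+ 2 * n * + 0 * n + + 0 * + 0 * + 0)
          + c * (n * n * n + + 2 * + 0 * + 0 * n)
          + + 3 * d * + 0 * n * n ≡ n * n * n * c
      eqᶜ = solve-∀
      eqᵈ : ∀ n a b c d →
        a * + 0 * + 0 * + 0 + b * + 0 * + 0 * n + c * + 0 * n * n + d * n * n * n ≡ n * n * n * d
      eqᵈ = solve-∀

  opaque
    unfolding _▹_
    ▹-scale : ∀ k g F → scale k F ▹ g ≡ scale k (F ▹ g)
    ▹-scale k (mat p q r s) (form a b c d) =
      form-cong (eqᵃ k a b c d p r) (eqᵇ k a b c d p q r s) (eqᶜ k a b c d p q r s) (eqᵃ k a b c d q s)
      where
      eqᵃ : ∀ k a b c d p r →
        k * a * p * p * p + k * b * p * p * r + k * c * p * r * r + k * d * r * r * r ≡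
        k * (a * p * p * p + b * p * p * r + c * p * r * r + d * r * r * r)
      eqᵃ = solve-∀
      eqᵇ : ∀ k a b c d p q r s → + 3 * (k * a) * p * p * q
          + k * b * (p * p * s + + 2 * p * q * r)
          + k * c * (q * r * r + + 2 * p * r * s)
          + + 3 * (k * d) * r * r * s ≡
        k * (+ 3 * a * p * p * q + b * (p * p * s + + 2 * p * q * r)
          + c * (q * r * r + + 2 * p * r * s) + + 3 * d * r * r * s)
      eqᵇ = solve-∀
      eqᶜ : ∀ k a b c d p q r s → + 3 * (k * a) * p * q * q
          + k * b * (+ 2 * p * q * s + q * q * r)
          + k * c * (p * s * s + + 2 * q * r * s)
          + + 3 * (k * d) * r * s * s ≡
        k * (+ 3 * a * p * q * q + b * (+ 2 * p * q * s + q * q * r)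
          + c * (p * s * s + + 2 * q * r * s) + + 3 * d * r * s * s)
      eqᶜ = solve-∀

  opaque
    unfolding _⊗_ _▹_
    -- This is a right action, so changing the target of an arrow `h` within its orbit replaces `h`
    -- by another element of the coset h SL₂(ℤ).
    ▹-⊗ : ∀ g h F → F ▹ (g ⊗ h) ≡ F ▹ g ▹ h
    ▹-⊗ (mat p q r s) (mat p′ q′ r′ s′) (form a b c d) =
      form-cong (eqᵃ a b c d p q r s p′ r′) (eqᵇ a b c d p q r s p′ q′ r′ s′)
                (eqᶜ a b c d p q r s p′ q′ r′ s′) (eqᵃ a b c d p q r s q′ s′)
      where
      eqᵃ : ∀ a b c d p q r s x y →
        a * (p * x + q * y) * (p * x + q * y) * (p * x + q * y)
          + b * (p * x + q * y) * (p * x + q * y) * (r * x + s * y)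
          + c * (p * x + q * y) * (r * x + s * y) * (r * x + s * y)
          + d * (r * x + s * y) * (r * x + s * y) * (r * x + s * y) ≡
        (a * p * p * p + b * p * p * r + c * p * r * r + d * r * r * r) * x * x * x
          + (+ 3 * a * p * p * q + b * (p * p * s + + 2 * p * q * r)
              + c * (q * r * r + + 2 * p * r * s) + + 3 * d * r * r * s) * x * x * y
          + (+ 3 * a * p * q * q + b * (+ 2 * p * q * s + q * q * r)
              + c * (p * s * s + + 2 * q * r * s) + + 3 * d * r * s * s) * x * y * y
          + (a * q * q * q + b * q * q * s + c * q * s * s + d * s * s * s) * y * y * y
      eqᵃ = solve-∀
      eqᵇ : ∀ a b c d p q r s p′ q′ r′ s′ →
        + 3 * a * (p * p′ + q * r′) * (p * p′ + q * r′) * (p * q′ + q * s′)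
          + b * ((p * p′ + q * r′) * (p * p′ + q * r′) * (r * q′ + s * s′)
              + + 2 * (p * p′ + q * r′) * (p * q′ + q * s′) * (r * p′ + s * r′))
          + c * ((p * q′ + q * s′) * (r * p′ + s * r′) * (r * p′ + s * r′)
              + + 2 * (p * p′ + q * r′) * (r * p′ + s * r′) * (r * q′ + s * s′))
          + + 3 * d * (r * p′ + s * r′) * (r * p′ + s * r′) * (r * q′ + s * s′) ≡
        + 3 * (a * p * p * p + b * p * p * r + c * p * r * r + d * r * r * r) * p′ * p′ * q′
          + (+ 3 * a * p * p * q + b * (p * p * s + + 2 * p * q * r)
              + c * (q * r * r + + 2 * p * r * s) + + 3 * d * r * r * s)
            * (p′ * p′ * s′ + + 2 * p′ * q′ * r′)
          + (+ 3 * a * p * q * q + b * (+ 2 * p * q * s + q * q * r)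
              + c * (p * s * s + + 2 * q * r * s) + + 3 * d * r * s * s)
            * (q′ * r′ * r′ + + 2 * p′ * r′ * s′)
          + + 3 * (a * q * q * q + b * q * q * s + c * q * s * s + d * s * s * s) * r′ * r′ * s′
      eqᵇ = solve-∀
      eqᶜ : ∀ a b c d p q r s p′ q′ r′ s′ →
        + 3 * a * (p * p′ + q * r′) * (p * q′ + q * s′) * (p * q′ + q * s′)
          + b * (+ 2 * (p * p′ + q * r′) * (p * q′ + q * s′) * (r * q′ + s * s′)
              + (p * q′ + q * s′) * (p * q′ + q * s′) * (r * p′ + s * r′))
          + c * ((p * p′ + q * r′) * (r * q′ + s * s′) * (r * q′ + s * s′)
              + + 2 * (p * q′ + q * s′) * (r * p′ + s * r′) * (r * q′ + s * s′))
          + + 3 * d * (r * p′ + s * r′) * (r * q′ + s * s′) * (r * q′ + s * s′) ≡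
        + 3 * (a * p * p * p + b * p * p * r + c * p * r * r + d * r * r * r) * p′ * q′ * q′
          + (+ 3 * a * p * p * q + b * (p * p * s + + 2 * p * q * r)
              + c * (q * r * r + + 2 * p * r * s) + + 3 * d * r * r * s)
            * (+ 2 * p′ * q′ * s′ + q′ * q′ * r′)
          + (+ 3 * a * p * q * q + b * (+ 2 * p * q * s + q * q * r)
              + c * (p * s * s + + 2 * q * r * s) + + 3 * d * r * s * s)
            * (p′ * s′ * s′ + + 2 * q′ * r′ * s′)
          + + 3 * (a * q * q * q + b * q * q * s + c * q * s * s + d * s * s * s) * r′ * s′ * s′
      eqᶜ = solve-∀

-- Finite sums of rationals and stabiliser weights.

module _ where
  open import Data.Rational using (_+_; _*_)

  ι : ℕ → ℚ
  ι zero    = 0ℚ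
  ι (suc n) = 1ℚ + ι n

  ι-+ : ∀ m n → ι (m ℕ.+ n) ≡ ι m + ι n
  ι-+ zero    n = sym (ℚ.+-identityˡ (ι n))
  ι-+ (suc m) n = trans (cong (1ℚ +_) (ι-+ m n)) (sym (ℚ.+-assoc 1ℚ (ι m) (ι n)))

  ι-fraction : ∀ n → ι n ≡ ℤ.+ n ℚ./ 1
  ι-fraction zero    = refl
  ι-fraction (suc n) = trans (cong (1ℚ +_) (ι-fraction n)) (ℚ.toℚᵘ-injective (begin
    ℚ.toℚᵘ (1ℚ + ℤ.+ n ℚ./ 1)                 ≈⟨ ℚ.toℚᵘ-homo-+ 1ℚ (ℤ.+ n ℚ./ 1) ⟩
    ℚ.toℚᵘ 1ℚ ℚᵘ.+ ℚ.toℚᵘ (ℤ.+ n ℚ./ 1)       ≈⟨ ℚᵘ.+-congʳ (ℚ.toℚᵘ 1ℚ) (ℚ.toℚᵘ-fromℚᵘ (ℤ.+ n ℚᵘ./ 1)) ⟩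
    ℚ.toℚᵘ 1ℚ ℚᵘ.+ (ℤ.+ n ℚᵘ./ 1)             ≡⟨ cong (λ t → (ℤ.+ 1 ℤ.+ t) ℚᵘ./ 1) (ℤ.*-identityʳ (ℤ.+ n)) ⟩
    ℤ.+ suc n ℚᵘ./ 1                          ≈⟨ ℚ.toℚᵘ-fromℚᵘ (ℤ.+ suc n ℚᵘ./ 1) ⟨
    ℚ.toℚᵘ (ℤ.+ suc n ℚ./ 1)                  ∎))
    where open ℚᵘ.≃-Reasoning

  -- A member is demanded because `weight []` is 0; for stabilisers the identity matrix serves.
  length*weight : ∀ {x : Mat} {xs} → x ∈ xs → ι (length xs) * weight xs ≡ 1ℚ
  length*weight {xs = xs@(_ ∷ ys)} _ = begin
    ι (suc n) * (ℤ.+ 1 ℚ./ suc n)              ≡⟨ cong (_* (ℤ.+ 1 ℚ./ suc n)) (ι-fraction (suc n)) ⟩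
    (ℤ.+ suc n ℚ./ 1) * (ℤ.+ 1 ℚ./ suc n)        ≡⟨ ℚ.toℚᵘ-injective product ⟩
    1ℚ                                       ∎
    where
    n : ℕ
    n = length ys
    product : ℚ.toℚᵘ ((ℤ.+ suc n ℚ./ 1) * (ℤ.+ 1 ℚ./ suc n)) ℚᵘ.≃ ℚ.toℚᵘ 1ℚ
    product = ℚᵘ.≃-trans (ℚ.toℚᵘ-homo-* (ℤ.+ suc n ℚ./ 1) (ℤ.+ 1 ℚ./ suc n))
      (ℚᵘ.≃-trans
        (ℚᵘ.*-cong (ℚ.toℚᵘ-fromℚᵘ (ℤ.+ suc n ℚᵘ./ 1)) (ℚ.toℚᵘ-fromℚᵘ (ℤ.+ 1 ℚᵘ./ suc n)))
        (ℚᵘ.*≡* (trans (ℤ.*-identityʳ _) (trans (ℤ.*-identityʳ (ℤ.+ suc n))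
          (trans (cong ℤ.+_ (sym (ℕ.*-identityˡ (suc n)))) (sym (ℤ.*-identityˡ _)))))))
    open ≡-Reasoning

  sumFin-cong : ∀ n {f g : Fin n → ℚ} → (∀ i → f i ≡ g i) → sumFin n f ≡ sumFin n g
  sumFin-cong zero    e = refl
  sumFin-cong (suc n) e = cong₂ _+_ (e zero) (sumFin-cong n (e ∘ suc))

  sumFin-0 : ∀ n → sumFin n (λ _ → 0ℚ) ≡ 0ℚ
  sumFin-0 zero    = refl
  sumFin-0 (suc n) = trans (ℚ.+-identityˡ _) (sumFin-0 n)

  +-interchange : ∀ p q r s → (p + q) + (r + s) ≡ (p + r) + (q + s)
  +-interchange p q r s = begin
    (p + q) + (r + s)   ≡⟨ ℚ.+-assoc p q (r + s) ⟩
    p + (q + (r + s))   ≡⟨ cong (p +_) (ℚ.+-assoc q r s) ⟨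
    p + ((q + r) + s)   ≡⟨ cong (λ t → p + (t + s)) (ℚ.+-comm q r) ⟩
    p + ((r + q) + s)   ≡⟨ cong (p +_) (ℚ.+-assoc r q s) ⟩
    p + (r + (q + s))   ≡⟨ ℚ.+-assoc p r (q + s) ⟨
    (p + r) + (q + s)   ∎
    where open ≡-Reasoning

  sumFin-+ : ∀ n (f g : Fin n → ℚ) → sumFin n (λ i → f i + g i) ≡ sumFin n f + sumFin n g
  sumFin-+ zero    f g = refl
  sumFin-+ (suc n) f g = trans (cong ((f zero + g zero) +_) (sumFin-+ n (f ∘ suc) (g ∘ suc)))
    (+-interchange (f zero) (g zero) _ _)

  sumFin-* : ∀ n (f : Fin n → ℚ) q → sumFin n (λ i → f i * q) ≡ sumFin n f * q
  sumFin-* zero    f q = sym (ℚ.*-zeroˡ q)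
  sumFin-* (suc n) f q = trans (cong (f zero * q +_) (sumFin-* n (f ∘ suc) q))
    (sym (ℚ.*-distribʳ-+ q (f zero) _))

  sumFin-swap : ∀ m n (f : Fin m → Fin n → ℚ) →
    sumFin m (λ i → sumFin n (f i)) ≡ sumFin n (λ j → sumFin m (λ i → f i j))
  sumFin-swap zero    n f = sym (sumFin-0 n)
  sumFin-swap (suc m) n f = trans (cong (sumFin n (f zero) +_) (sumFin-swap m n (f ∘ suc)))
    (sym (sumFin-+ n (f zero) _))

  sumFin-single : ∀ n (i : Fin n) (f : Fin n → ℚ) → (∀ j → i ≢ j → f j ≡ 0ℚ) → sumFin n f ≡ f i
  sumFin-single (suc n) zero    f e =
    trans (cong (f zero +_) (trans (sumFin-cong n (λ j → e (suc j) (λ ()))) (sumFin-0 n)))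
          (ℚ.+-identityʳ (f zero))
  sumFin-single (suc n) (suc i) f e =
    trans (cong₂ _+_ (e zero (λ ())) (sumFin-single n i (f ∘ suc) (λ j i≢j → e (suc j) (i≢j ∘ Fin.suc-injective))))
          (ℚ.+-identityˡ (f (suc i)))

  -- Counting arrows by cosets of stabilisers.

  Separate : Mat → Mat → Set
  Separate k k′ = ∀ σ σ′ → det σ ≡ ℤ.+ 1 → det σ′ ≡ ℤ.+ 1 → k ⊗ σ ≢ k′ ⊗ σ′

  module _ {n : ℕ} (T : Fin n → List Mat) where

    spoke : Fin n × Mat → Fin n → List Mat
    spoke (i , k) j with i Fin.≟ j
    ... | yes _ = map (k ⊗_) (T j)
    ... | no _  = []

    -- The arrows from a fixed form to the representative `j` are a disjoint union of cosets k
    -- Stab(j). An entry (i , k) is one base arrow `k` landing on the representative `i`, and `T` is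
    -- the family of stabilisers.
    fan : List (Fin n × Mat) → Fin n → List Mat
    fan []       j = []
    fan (b ∷ bs) j = spoke b j ++ fan bs j

    ∈-spoke⁻ : ∀ {h} b j → h ∈ spoke b j → proj₁ b ≡ j × ∃ λ σ → σ ∈ T j × h ≡ proj₂ b ⊗ σ
    ∈-spoke⁻ (i , k) j h∈ with i Fin.≟ j
    ... | yes i≡j = i≡j , ∈-map⁻ (k ⊗_) h∈
    ... | no _    with () ← h∈

    ∈-spoke⁺ : ∀ {σ} j k → σ ∈ T j → k ⊗ σ ∈ spoke (j , k) j
    ∈-spoke⁺ j k σ∈ with j Fin.≟ j
    ... | yes _  = ∈-map⁺ (k ⊗_) σ∈
    ... | no j≢j = ⊥-elim (j≢j refl)

    ∈-fan⁻ : ∀ {h} bs j → h ∈ fan bs j → ∃₂ λ k σ → (j , k) ∈ bs × σ ∈ T j × h ≡ k ⊗ σ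
    ∈-fan⁻ (b@(i , k) ∷ bs) j h∈ with ∈-++⁻ (spoke b j) h∈
    ... | inj₁ h∈ˡ with refl , σ , σ∈ , h≡ ← ∈-spoke⁻ b j h∈ˡ = k , σ , here refl , σ∈ , h≡
    ... | inj₂ h∈ʳ with k′ , σ , k∈ , σ∈ , h≡ ← ∈-fan⁻ bs j h∈ʳ = k′ , σ , there k∈ , σ∈ , h≡

    ∈-fan⁺ : ∀ {k σ j} bs → (j , k) ∈ bs → σ ∈ T j → k ⊗ σ ∈ fan bs j
    ∈-fan⁺ {k} {j = j} (_ ∷ bs) (here refl) σ∈ = ∈-++⁺ˡ (∈-spoke⁺ j k σ∈)
    ∈-fan⁺ {j = j} (b ∷ bs) (there k∈)  σ∈ = ∈-++⁺ʳ (spoke b j) (∈-fan⁺ bs k∈ σ∈)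

    spoke-unique : ∀ b j → det (proj₂ b) ≢ ℤ.+ 0 → Unique (T j) → Unique (spoke b j)
    spoke-unique (i , k) j k≢0 uniq with i Fin.≟ j
    ... | yes _ = Unique.map⁺ (λ {σ} {σ′} → ⊗-cancelˡ k {σ} {σ′} k≢0) uniq
    ... | no _  = []

    fan-unique : ∀ bs j → Unique (T j) → All (λ σ → det σ ≡ ℤ.+ 1) (T j) →
      All (λ b → det (proj₂ b) ≢ ℤ.+ 0) bs → AllPairs (λ b b′ → Separate (proj₂ b) (proj₂ b′)) bs →
      Unique (fan bs j)
    fan-unique []       j uniq dets _             _            = []
    fan-unique (b ∷ bs) j uniq dets (b≢0 ∷ bs≢0) (sep ∷ seps) =
      Unique.++⁺ (spoke-unique b j b≢0 uniq) (fan-unique bs j uniq dets bs≢0 seps) disjoint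
      where
      disjoint : ∀ {h} → ¬ (h ∈ spoke b j × h ∈ fan bs j)
      disjoint (h∈ , h∈′)
        with _ , σ , σ∈ , h≡ ← ∈-spoke⁻ b j h∈
           | k , τ , k∈ , τ∈ , h≡′ ← ∈-fan⁻ bs j h∈′
        = All.lookup sep k∈ σ τ (All.lookup dets σ∈) (All.lookup dets τ∈) (trans (sym h≡) h≡′)

    spoke-count : ∀ b → (∀ j → ∃ (_∈ T j)) → sumFin n (λ j → ι (length (spoke b j)) * weight (T j)) ≡ 1ℚ
    spoke-count b@(i , k) inhabited = trans (sumFin-single n i _ off) on
      where
      off : ∀ j → i ≢ j → ι (length (spoke b j)) * weight (T j) ≡ 0ℚ
      off j i≢j with i Fin.≟ j
      ... | yes i≡j = ⊥-elim (i≢j i≡j)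
      ... | no _    = ℚ.*-zeroˡ (weight (T j))
      on : ι (length (spoke b i)) * weight (T i) ≡ 1ℚ
      on with i Fin.≟ i
      ... | yes _  = trans (cong (λ l → ι l * weight (T i)) (length-map (k ⊗_) (T i)))
                           (length*weight (proj₂ (inhabited i)))
      ... | no i≢i = ⊥-elim (i≢i refl)

    -- Each base arrow lands on a single representative, where its coset has as many elements as the
    -- stabiliser; the weight brings this to 1.
    fan-count : ∀ bs → (∀ j → ∃ (_∈ T j)) →
      sumFin n (λ j → ι (length (fan bs j)) * weight (T j)) ≡ ι (length bs)
    fan-count []       _         = trans (sumFin-cong n (λ j → ℚ.*-zeroˡ (weight (T j)))) (sumFin-0 n)
    fan-count (b ∷ bs) inhabited = begin
      sumFin n (λ j → ι (length (spoke b j ++ fan bs j)) * weight (T j))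
        ≡⟨ sumFin-cong n split ⟩
      sumFin n (λ j → ι (length (spoke b j)) * weight (T j) + ι (length (fan bs j)) * weight (T j))
        ≡⟨ sumFin-+ n _ _ ⟩
      sumFin n (λ j → ι (length (spoke b j)) * weight (T j)) +
        sumFin n (λ j → ι (length (fan bs j)) * weight (T j))
        ≡⟨ cong₂ _+_ (spoke-count b inhabited) (fan-count bs inhabited) ⟩
      1ℚ + ι (length bs) ∎
      where
      open ≡-Reasoning
      split : ∀ j → ι (length (spoke b j ++ fan bs j)) * weight (T j) ≡
        ι (length (spoke b j)) * weight (T j) + ι (length (fan bs j)) * weight (T j)
      split j = begin
        ι (length (spoke b j ++ fan bs j)) * weight (T j)
          ≡⟨ cong (λ l → ι l * weight (T j)) (length-++ (spoke b j)) ⟩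
        ι (length (spoke b j) ℕ.+ length (fan bs j)) * weight (T j)
          ≡⟨ cong (_* weight (T j)) (ι-+ (length (spoke b j)) _) ⟩
        (ι (length (spoke b j)) + ι (length (fan bs j))) * weight (T j)
          ≡⟨ ℚ.*-distribʳ-+ (weight (T j)) (ι (length (spoke b j))) _ ⟩
        ι (length (spoke b j)) * weight (T j) + ι (length (fan bs j)) * weight (T j) ∎

-- Arrows between forms and the double count.

module _ where
  open import Data.Integer using (+_; -_; -[1+_]; _+_; _*_; _-_)
  open +-*-Solver using (solve; con; _:+_; _:*_; _:-_; _:=_)

  one : Mat
  one = scalar (+ 1)

  ▹-one : ∀ F → F ▹ one ≡ F
  ▹-one F@(form a b c d) = trans (▹-scalar (+ 1) F)
    (form-cong (ℤ.*-identityˡ a) (ℤ.*-identityˡ b) (ℤ.*-identityˡ c) (ℤ.*-identityˡ d))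

  ▹-adjʳ : ∀ γ F → det γ ≡ + 1 → F ▹ γ ▹ adj γ ≡ F
  ▹-adjʳ γ F e = begin
    F ▹ γ ▹ adj γ        ≡⟨ ▹-⊗ γ (adj γ) F ⟨
    F ▹ (γ ⊗ adj γ)      ≡⟨ cong (F ▹_) (adj-⊗ʳ γ) ⟩
    F ▹ scalar (det γ)   ≡⟨ cong (λ n → F ▹ scalar n) e ⟩
    F ▹ one              ≡⟨ ▹-one F ⟩
    F                    ∎
    where open ≡-Reasoning

  ▹-adjˡ : ∀ γ F → det γ ≡ + 1 → F ▹ adj γ ▹ γ ≡ F
  ▹-adjˡ γ F e = begin
    F ▹ adj γ ▹ γ        ≡⟨ ▹-⊗ (adj γ) γ F ⟨
    F ▹ (adj γ ⊗ γ)      ≡⟨ cong (F ▹_) (adj-⊗ˡ γ) ⟩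
    F ▹ scalar (det γ)   ≡⟨ cong (λ n → F ▹ scalar n) e ⟩
    F ▹ one              ≡⟨ ▹-one F ⟩
    F                    ∎
    where open ≡-Reasoning

  det-⊗-1 : ∀ g {h n} → det g ≡ n → det h ≡ + 1 → det (g ⊗ h) ≡ n
  det-⊗-1 g {h} {n} e e′ = trans (det-⊗ g h) (trans (cong₂ _*_ e e′) (ℤ.*-identityʳ n))

  ⊗-adj-cancel : ∀ γ g → det γ ≡ + 1 → γ ⊗ (adj γ ⊗ g) ≡ g
  ⊗-adj-cancel γ g e = begin
    γ ⊗ (adj γ ⊗ g)        ≡⟨ ⊗-assoc γ (adj γ) g ⟨
    γ ⊗ adj γ ⊗ g          ≡⟨ cong (_⊗ g) (adj-⊗ʳ γ) ⟩
    scalar (det γ) ⊗ g     ≡⟨ cong (λ n → scalar n ⊗ g) e ⟩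
    one ⊗ g                ≡⟨ one-⊗ g ⟩
    g                      ∎
    where open ≡-Reasoning

  -- G = (c / c′) (F ▹ h), with the denominator cleared.
  record Arrow (n c c′ : ℤ) (u v : Form → Bool) (F G : Form) (h : Mat) : Set where
    field
      det≡   : det h ≡ n
      maps   : scale c (F ▹ h) ≡ scale c′ G
      source : u F ≡ true
      target : v G ≡ true

  Invariant : (Form → Bool) → Set
  Invariant v = ∀ γ F → det γ ≡ + 1 → v (F ▹ γ) ≡ v F

  arrow-⊗ : ∀ {n c c′ u v F G h} γ → Invariant v → det γ ≡ + 1 →
    Arrow n c c′ u v F G h → Arrow n c c′ u v F (G ▹ γ) (h ⊗ γ)
  arrow-⊗ {c = c} {c′} {F = F} {G} {h} γ inv e A = record
    { det≡   = det-⊗-1 h {γ} (Arrow.det≡ A) e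
    ; maps   = begin
        scale c (F ▹ (h ⊗ γ))    ≡⟨ cong (scale c) (▹-⊗ h γ F) ⟩
        scale c (F ▹ h ▹ γ)      ≡⟨ ▹-scale c γ (F ▹ h) ⟨
        scale c (F ▹ h) ▹ γ      ≡⟨ cong (_▹ γ) (Arrow.maps A) ⟩
        scale c′ G ▹ γ           ≡⟨ ▹-scale c′ γ G ⟩
        scale c′ (G ▹ γ)         ∎
    ; source = Arrow.source A
    ; target = trans (inv γ G e) (Arrow.target A)
    }
    where open ≡-Reasoning

  arrow-target-unique : ∀ {n c c′ u v F G G′ h} → c′ ≢ + 0 →
    Arrow n c c′ u v F G h → Arrow n c c′ u v F G′ h → G ≡ G′
  arrow-target-unique c′≢0 A A′ = scale-injective c′≢0 (trans (sym (Arrow.maps A)) (Arrow.maps A′))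

  ⊗-adj-assoc : ∀ h γ → det γ ≡ + 1 → (h ⊗ γ) ⊗ adj γ ≡ h
  ⊗-adj-assoc h γ e = begin
    h ⊗ γ ⊗ adj γ           ≡⟨ ⊗-assoc h γ (adj γ) ⟩
    h ⊗ (γ ⊗ adj γ)         ≡⟨ cong (h ⊗_) (adj-⊗ʳ γ) ⟩
    h ⊗ scalar (det γ)      ≡⟨ cong (λ n → h ⊗ scalar n) e ⟩
    h ⊗ one                 ≡⟨ ⊗-one h ⟩
    h                       ∎
    where open ≡-Reasoning

  -- The composite of `h` and `adj h` is the scalar n, which acts as n³. The reversed ratio is
  -- therefore c′ / (c n³) and not c′ / c, and this fixes the constants of the opposite marking.
  arrow-adj : ∀ {n c c′ u v F G h} → Arrow n c c′ u v F G h →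
    Arrow n c′ (c * (n * n * n)) v u G F (adj h)
  arrow-adj {n} {c} {c′} {F = F} {G} {h} A = record
    { det≡   = trans (det-adj h) (Arrow.det≡ A)
    ; maps   = begin
        scale c′ (G ▹ adj h)           ≡⟨ ▹-scale c′ (adj h) G ⟨
        scale c′ G ▹ adj h             ≡⟨ cong (_▹ adj h) (Arrow.maps A) ⟨
        scale c (F ▹ h) ▹ adj h        ≡⟨ ▹-scale c (adj h) (F ▹ h) ⟩
        scale c (F ▹ h ▹ adj h)        ≡⟨ cong (scale c) (▹-⊗ h (adj h) F) ⟨
        scale c (F ▹ (h ⊗ adj h))      ≡⟨ cong (λ g → scale c (F ▹ g)) (adj-⊗ʳ h) ⟩
        scale c (F ▹ scalar (det h))   ≡⟨ cong (λ m → scale c (F ▹ scalar m)) (Arrow.det≡ A) ⟩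
        scale c (F ▹ scalar n)         ≡⟨ cong (scale c) (▹-scalar n F) ⟩
        scale c (scale (n * n * n) F)  ≡⟨ scale-scale c (n * n * n) F ⟩
        scale (c * (n * n * n)) F      ∎
    ; source = Arrow.target A
    ; target = Arrow.source A
    }
    where open ≡-Reasoning

  arrow-adj⁻ : ∀ {n c c′ u v F G h} → n * n * n ≢ + 0 →
    Arrow n c′ (c * (n * n * n)) v u G F (adj h) → Arrow n c c′ u v F G h
  arrow-adj⁻ {n} {c} {c′} {u} {v} {F} {G} {h} n³≢0 A = record
    { det≡   = Arrow.det≡ B
    ; maps   = scale-injective n³≢0 (begin
        scale (n * n * n) (scale c (F ▹ h))   ≡⟨ scale-scale (n * n * n) c (F ▹ h) ⟩
        scale (n * n * n * c) (F ▹ h)         ≡⟨ cong (λ k → scale k (F ▹ h)) (ℤ.*-comm (n * n * n) c) ⟩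
        scale (c * (n * n * n)) (F ▹ h)       ≡⟨ Arrow.maps B ⟩
        scale (c′ * (n * n * n)) G              ≡⟨ cong (λ k → scale k G) (ℤ.*-comm c′ (n * n * n)) ⟩
        scale (n * n * n * c′) G                ≡⟨ scale-scale (n * n * n) c′ G ⟨
        scale (n * n * n) (scale c′ G)          ∎)
    ; source = Arrow.source B
    ; target = Arrow.target B
    }
    where
    open ≡-Reasoning
    B : Arrow n (c * (n * n * n)) (c′ * (n * n * n)) u v F G h
    B = subst (Arrow n _ _ u v F G) (adj-involutive h) (arrow-adj A)

  record Transversal (n : ℤ) (hs : List Mat) : Set where
    field
      dets     : All (λ h → det h ≡ n) hs
      covers   : ∀ g → det g ≡ n → ∃₂ λ h γ → h ∈ hs × det γ ≡ + 1 × g ≡ h ⊗ γ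
      separate : AllPairs Separate hs

  bit : Bool → ℕ
  bit true  = 1
  bit false = 0

  count : (Mat → Form → Bool) → List Mat → Form → ℕ
  count κ []       F = 0
  count κ (h ∷ hs) F = bit (κ h F) ℕ.+ count κ hs F

  -- κ h F decides whether h is an arrow out of F.
  record Marking (n c c′ : ℤ) (u v : Form → Bool) (S : Form → Set) (D : ℤ) (S′ : Form → Set) (D′ : ℤ)
                 (hs : List Mat) (κ : Mat → Form → Bool) : Set where
    field
      sound    : ∀ F → S F → P F ≡ D →
        All (λ h → κ h F ≡ true → ∃ λ G → S′ G × P G ≡ D′ × Arrow n c c′ u v F G h) hs
      complete : ∀ {h F G} → h ∈ hs → Arrow n c c′ u v F G h → κ h F ≡ true

  total : ∀ {S D m} → Mass S D m → (Form → ℕ) → ℚ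
  total M w = sumFin (length reps) (λ i → ι (w (lookup reps i)) ℚ.* weight (stab i))
    where open Mass M

  module Arrows {n c c′ u v S D S′ D′ m′ hs κ} (n≢0 : n ≢ + 0) (c′≢0 : c′ ≢ + 0) (v-inv : Invariant v)
                (M′ : Mass S′ D′ m′) (tr : Transversal n hs) (mk : Marking n c c′ u v S D S′ D′ hs κ)
                (F : Form) (F∈S : S F) (PF : P F ≡ D) where

    open Mass M′
    open Transversal tr
    open Marking mk

    Arr : Form → Mat → Set
    Arr = Arrow n c c′ u v F

    rep : Fin (length reps) → Form
    rep = lookup reps

    Landing : Mat → Set
    Landing h = ∃₂ λ j γ → det γ ≡ + 1 × Arr (rep j) (h ⊗ γ)

    -- A target found for `h` need not be a listed representative. Moving it there by γ changes `h`
    -- only within its coset h SL₂(ℤ).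
    land : ∀ {h} → (∃ λ G → S′ G × P G ≡ D′ × Arr G h) → Landing h
    land {h} (G , G∈ , PG , A) with cover G G∈ PG
    ... | r with γ , γ≡1 , e ← lookup-index r =
      Any.index r , γ , γ≡1 , subst (λ G′ → Arr G′ (h ⊗ γ)) (act⇒▹ e) (arrow-⊗ γ v-inv γ≡1 A)

    Landings : List Mat → Set
    Landings = All (λ h → κ h F ≡ true → Landing h)

    landings : Landings hs
    landings = All.map (land ∘_) (sound F F∈S PF)

    -- The Boolean is a separate argument so that it can be matched on while `l` still receives the
    -- proof that it is `true`.
    keep : ∀ {h} b → (b ≡ true → Landing h) → List (Fin (length reps) × Mat) → List (Fin (length reps) × Mat)
    keep     false l bs = bs
    keep {h} true  l bs with j , γ , _ ← l refl = (j , h ⊗ γ) ∷ bs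

    bases : ∀ {hs} → Landings hs → List (Fin (length reps) × Mat)
    bases {[]}     []       = []
    bases {h ∷ hs} (l ∷ ls) = keep (κ h F) l (bases ls)

    length-keep : ∀ {h} b (l : b ≡ true → Landing h) bs → length (keep b l bs) ≡ bit b ℕ.+ length bs
    length-keep false l bs = refl
    length-keep true  l bs with j , γ , _ ← l refl = refl

    length-bases : ∀ {hs} (ls : Landings hs) → length (bases ls) ≡ count κ hs F
    length-bases {[]}     []       = refl
    length-bases {h ∷ hs} (l ∷ ls) =
      trans (length-keep (κ h F) l (bases ls)) (cong (bit (κ h F) ℕ.+_) (length-bases ls))

    keep-all : ∀ {ℓ} {Q : Fin (length reps) × Mat → Set ℓ} {h} b (l : b ≡ true → Landing h) {bs} →
      (∀ {j γ} → det γ ≡ + 1 → Arr (rep j) (h ⊗ γ) → Q (j , h ⊗ γ)) → All Q bs → All Q (keep b l bs)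
    keep-all false l q qs = qs
    keep-all true  l q qs with j , γ , γ≡1 , A ← l refl = q γ≡1 A ∷ qs

    bases-arrows : ∀ {hs} (ls : Landings hs) → All (λ b → Arr (rep (proj₁ b)) (proj₂ b)) (bases ls)
    bases-arrows {[]}     []       = []
    bases-arrows {h ∷ hs} (l ∷ ls) = keep-all (κ h F) l (λ _ A → A) (bases-arrows ls)

    separate-⊗ : ∀ g h {γ} → det γ ≡ + 1 → Separate g h → Separate g (h ⊗ γ)
    separate-⊗ g h {γ} γ≡1 sep σ τ σ≡1 τ≡1 e =
      sep σ (γ ⊗ τ) σ≡1 (det-⊗-1 γ {τ} γ≡1 τ≡1) (trans e (⊗-assoc h γ τ))

    separate-sym : ∀ g h → Separate g h → Separate h g
    separate-sym g h sep σ τ σ≡1 τ≡1 e = sep τ σ τ≡1 σ≡1 (sym e)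

    bases-separateˡ : ∀ g {hs} (ls : Landings hs) → All (Separate g) hs →
      All (Separate g ∘ proj₂) (bases ls)
    bases-separateˡ g {[]}     []       []       = []
    bases-separateˡ g {h ∷ hs} (l ∷ ls) (s ∷ ss) =
      keep-all (κ h F) l (λ {j} {γ} γ≡1 _ → separate-⊗ g h {γ} γ≡1 s) (bases-separateˡ g ls ss)

    bases-separate : ∀ {hs} (ls : Landings hs) → AllPairs Separate hs →
      AllPairs (λ b b′ → Separate (proj₂ b) (proj₂ b′)) (bases ls)
    bases-separate {[]}     []       []       = []
    bases-separate {h ∷ hs} (l ∷ ls) (s ∷ ss) with κ h F
    ... | false = bases-separate ls ss
    ... | true with j , γ , γ≡1 , _ ← l refl =
      All.map (λ {b} sep → separate-sym (proj₂ b) (h ⊗ γ) (separate-⊗ (proj₂ b) h {γ} γ≡1 (separate-sym h (proj₂ b) sep)))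
        (bases-separateˡ h ls s) ∷ bases-separate ls ss

    bases-complete : ∀ {h hs} (ls : Landings hs) → h ∈ hs → κ h F ≡ true →
      ∃₂ λ j γ → (j , h ⊗ γ) ∈ bases ls × det γ ≡ + 1 × Arr (rep j) (h ⊗ γ)
    bases-complete {hs = h ∷ _} (l ∷ ls) (here refl) e with κ h F
    ... | true with j , γ , γ≡1 , A ← l refl = j , γ , here refl , γ≡1 , A
    bases-complete {hs = h ∷ _} (l ∷ ls) (there h∈) e
      with j , γ , b∈ , γ≡1 , A ← bases-complete ls h∈ e | κ h F
    ... | false = j , γ , b∈ , γ≡1 , A
    ... | true with _ , _ , _ ← l refl = j , γ , there b∈ , γ≡1 , A

    arrows : Fin (length reps) → List Mat
    arrows = fan stab (bases landings)

    one∈stab : ∀ j → one ∈ stab j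
    one∈stab j = Equivalence.from (stabSpec j one) (refl , ▹⇒act (▹-one (rep j)))

    stab-det : ∀ j → All (λ σ → det σ ≡ + 1) (stab j)
    stab-det j = All.tabulate (λ {σ} σ∈ → proj₁ (Equivalence.to (stabSpec j σ) σ∈))

    arrows-unique : ∀ j → Unique (arrows j)
    arrows-unique j = fan-unique stab (bases landings) j (stabUniq j) (stab-det j)
      (All.map (λ A e → n≢0 (trans (sym (Arrow.det≡ A)) e)) (bases-arrows landings))
      (bases-separate landings separate)

    arrows-count : sumFin (length reps) (λ j → ι (length (arrows j)) ℚ.* weight (stab j)) ≡ ι (count κ hs F)
    arrows-count = trans (fan-count stab (bases landings) (λ j → one , one∈stab j))
      (cong ι (length-bases landings))

    ∈-arrows⁻ : ∀ {h} j → h ∈ arrows j → Arr (rep j) h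
    ∈-arrows⁻ {h} j h∈ = go (∈-fan⁻ stab (bases landings) j h∈)
      where
      go : (∃₂ λ k σ → (j , k) ∈ bases landings × σ ∈ stab j × h ≡ k ⊗ σ) → Arr (rep j) h
      go (k , σ , k∈ , σ∈ , refl) = subst (λ G → Arr G (k ⊗ σ)) (act⇒▹ (proj₂ fixes))
        (arrow-⊗ σ v-inv (proj₁ fixes) (All.lookup (bases-arrows landings) k∈))
        where
        fixes : det σ ≡ + 1 × act σ (rep j) ≡ rep j
        fixes = Equivalence.to (stabSpec j σ) σ∈

    -- The base arrow recorded for the coset of `h` may use another γ′ and another index j′. Since
    -- `h` determines its target, γ′⁻¹ γ carries the representative j′ to j; irredundancy gives j′ =
    -- j, and the quotient is then a stabiliser element.
    ∈-arrows-⊗ : ∀ {h} γ j → h ∈ hs → det γ ≡ + 1 → Arr (rep j) (h ⊗ γ) → h ⊗ γ ∈ arrows j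
    ∈-arrows-⊗ {h} γ j h∈ γ≡1 A = go (bases-complete landings h∈ (complete h∈ B))
      where
      B : Arr (rep j ▹ adj γ) h
      B = subst (Arr (rep j ▹ adj γ)) (⊗-adj-assoc h γ γ≡1)
        (arrow-⊗ (adj γ) v-inv (trans (det-adj γ) γ≡1) A)
      go : (∃₂ λ j′ γ′ → (j′ , h ⊗ γ′) ∈ bases landings × det γ′ ≡ + 1 × Arr (rep j′) (h ⊗ γ′)) →
        h ⊗ γ ∈ arrows j
      go (j′ , γ′ , b∈ , γ′≡1 , A′) = conclude (distinct j′ j (σ , σ≡1 , ▹⇒act σ-maps)) (σ≡1 , ▹⇒act σ-maps) b∈
        where
        open ≡-Reasoning
        σ : Mat
        σ = adj γ′ ⊗ γ
        σ≡1 : det σ ≡ + 1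
        σ≡1 = det-⊗-1 (adj γ′) {γ} (trans (det-adj γ′) γ′≡1) γ≡1
        σ-maps : rep j′ ▹ σ ≡ rep j
        σ-maps = begin
          rep j′ ▹ (adj γ′ ⊗ γ)                 ≡⟨ ▹-⊗ (adj γ′) γ (rep j′) ⟩
          rep j′ ▹ adj γ′ ▹ γ                   ≡⟨ cong (λ G → G ▹ adj γ′ ▹ γ) (arrow-target-unique c′≢0 A′ (arrow-⊗ γ′ v-inv γ′≡1 B)) ⟩
          rep j ▹ adj γ ▹ γ′ ▹ adj γ′ ▹ γ       ≡⟨ cong (_▹ γ) (▹-adjʳ γ′ (rep j ▹ adj γ) γ′≡1) ⟩
          rep j ▹ adj γ ▹ γ                     ≡⟨ ▹-adjˡ γ (rep j) γ≡1 ⟩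
          rep j                                 ∎
        shift : (h ⊗ γ′) ⊗ σ ≡ h ⊗ γ
        shift = trans (⊗-assoc h γ′ σ) (cong (h ⊗_) (⊗-adj-cancel γ′ γ γ′≡1))
        conclude : ∀ {i} → i ≡ j → det σ ≡ + 1 × act σ (rep i) ≡ rep j → (i , h ⊗ γ′) ∈ bases landings →
          h ⊗ γ ∈ arrows j
        conclude refl fixes b∈ = subst (_∈ arrows j) shift
          (∈-fan⁺ stab (bases landings) b∈ (Equivalence.from (stabSpec j σ) fixes))

    ∈-arrows⁺ : ∀ {g} j → Arr (rep j) g → g ∈ arrows j
    ∈-arrows⁺ {g} j A = go (covers g (Arrow.det≡ A))
      where
      go : (∃₂ λ h γ → h ∈ hs × det γ ≡ + 1 × g ≡ h ⊗ γ) → g ∈ arrows j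
      go (h , γ , h∈ , γ≡1 , refl) = ∈-arrows-⊗ γ j h∈ γ≡1 A

  -- Both sides sum |Arrows(x, y)| / (|Stab x| |Stab y|) over pairs of representatives.
  double-count : ∀ {n c c′ u v S D m S′ D′ m′ hs κ κ′} →
    n ≢ + 0 → c′ ≢ + 0 → c * (n * n * n) ≢ + 0 → n * n * n ≢ + 0 → Invariant u → Invariant v →
    Transversal n hs →
    (M : Mass S D m) (M′ : Mass S′ D′ m′) →
    Marking n c c′ u v S D S′ D′ hs κ →
    Marking n c′ (c * (n * n * n)) v u S′ D′ S D hs κ′ →
    total M (count κ hs) ≡ total M′ (count κ′ hs)
  double-count {n} {c} {c′} {u} {v} {S} {D} {S′ = S′} {D′} {hs = hs} {κ} {κ′} n≢0 c′≢0 cn³≢0 n³≢0 u-inv v-inv tr M M′ mk mk′ = begin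
    sumFin k (λ i → ι (count κ hs (x i)) ℚ.* weight (stabˣ i))
      ≡⟨ sumFin-cong k (λ i → cong (ℚ._* weight (stabˣ i)) (sym (Out.arrows-count i))) ⟩
    sumFin k (λ i → sumFin l (λ j → ι (length (Out.arrows i j)) ℚ.* weight (stabʸ j)) ℚ.* weight (stabˣ i))
      ≡⟨ sumFin-cong k (λ i → sym (sumFin-* l _ (weight (stabˣ i)))) ⟩
    sumFin k (λ i → sumFin l (λ j → ι (length (Out.arrows i j)) ℚ.* weight (stabʸ j) ℚ.* weight (stabˣ i)))
      ≡⟨ sumFin-swap k l _ ⟩
    sumFin l (λ j → sumFin k (λ i → ι (length (Out.arrows i j)) ℚ.* weight (stabʸ j) ℚ.* weight (stabˣ i)))
      ≡⟨ sumFin-cong l (λ j → sumFin-cong k (λ i → exchange i j)) ⟩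
    sumFin l (λ j → sumFin k (λ i → ι (length (In.arrows j i)) ℚ.* weight (stabˣ i) ℚ.* weight (stabʸ j)))
      ≡⟨ sumFin-cong l (λ j → sumFin-* k _ (weight (stabʸ j))) ⟩
    sumFin l (λ j → sumFin k (λ i → ι (length (In.arrows j i)) ℚ.* weight (stabˣ i)) ℚ.* weight (stabʸ j))
      ≡⟨ sumFin-cong l (λ j → cong (ℚ._* weight (stabʸ j)) (In.arrows-count j)) ⟩
    sumFin l (λ j → ι (count κ′ hs (y j)) ℚ.* weight (stabʸ j)) ∎
    where
    open ≡-Reasoning
    open Mass M using () renaming (reps to xs; stab to stabˣ; repsIn to xsIn; repsDisc to xsDisc)
    open Mass M′ using () renaming (reps to ys; stab to stabʸ; repsIn to ysIn; repsDisc to ysDisc)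
    k l : ℕ
    k = length xs
    l = length ys
    x : Fin k → Form
    x = lookup xs
    y : Fin l → Form
    y = lookup ys
    module Out (i : Fin k) = Arrows n≢0 c′≢0 v-inv M′ tr mk (x i)
      (All.lookup xsIn (∈-lookup i)) (All.lookup xsDisc (∈-lookup i))
    module In (j : Fin l) = Arrows n≢0 cn³≢0 u-inv M tr mk′ (y j)
      (All.lookup ysIn (∈-lookup j)) (All.lookup ysDisc (∈-lookup j))
    adj-injective : ∀ {g h} → adj g ≡ adj h → g ≡ h
    adj-injective {g} {h} e = trans (sym (adj-involutive g)) (trans (cong adj e) (adj-involutive h))
    -- The adjugate is a bijection between arrows x → y and arrows y → x. Both lists are free of
    -- repetitions, so having the same members gives the same length.
    same-length : ∀ i j → length (Out.arrows i j) ≡ length (In.arrows j i)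
    same-length i j = begin
      length (Out.arrows i j)           ≡⟨ length-map adj (Out.arrows i j) ⟨
      length (map adj (Out.arrows i j)) ≡⟨ ↭-length (∼bag⇒↭ (unique∧set⇒bag
        (Unique.map⁺ (λ {g} {h} → adj-injective {g} {h}) (Out.arrows-unique i j)) (In.arrows-unique j i) (mk⇔ to from))) ⟩
      length (In.arrows j i)            ∎
      where
      to : ∀ {h} → h ∈ map adj (Out.arrows i j) → h ∈ In.arrows j i
      to h∈ with g , g∈ , refl ← ∈-map⁻ adj h∈ = In.∈-arrows⁺ j i (arrow-adj (Out.∈-arrows⁻ i j g∈))
      from : ∀ {h} → h ∈ In.arrows j i → h ∈ map adj (Out.arrows i j)
      from {h} h∈ = subst (_∈ map adj (Out.arrows i j)) (adj-involutive h)
        (∈-map⁺ adj (Out.∈-arrows⁺ i j (arrow-adj⁻ n³≢0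
          (subst (Arrow n c′ _ v u (y j) (x i)) (sym (adj-involutive h)) (In.∈-arrows⁻ j i h∈)))))
    exchange : ∀ i j → ι (length (Out.arrows i j)) ℚ.* weight (stabʸ j) ℚ.* weight (stabˣ i) ≡
      ι (length (In.arrows j i)) ℚ.* weight (stabˣ i) ℚ.* weight (stabʸ j)
    exchange i j = begin
      ι (length (Out.arrows i j)) ℚ.* weight (stabʸ j) ℚ.* weight (stabˣ i)
        ≡⟨ cong (λ r → ι r ℚ.* weight (stabʸ j) ℚ.* weight (stabˣ i)) (same-length i j) ⟩
      ι (length (In.arrows j i)) ℚ.* weight (stabʸ j) ℚ.* weight (stabˣ i)
        ≡⟨ ℚ.*-assoc (ι (length (In.arrows j i))) _ _ ⟩
      ι (length (In.arrows j i)) ℚ.* (weight (stabʸ j) ℚ.* weight (stabˣ i))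
        ≡⟨ cong (ι (length (In.arrows j i)) ℚ.*_) (ℚ.*-comm (weight (stabʸ j)) _) ⟩
      ι (length (In.arrows j i)) ℚ.* (weight (stabˣ i) ℚ.* weight (stabʸ j))
        ≡⟨ ℚ.*-assoc (ι (length (In.arrows j i))) _ _ ⟨
      ι (length (In.arrows j i)) ℚ.* weight (stabˣ i) ℚ.* weight (stabʸ j) ∎

  -- Residues of polynomials

  residue-unique : ∀ {N r r′} t → r ℕ.< N → r′ ℕ.< N → + r ≡ + r′ + t * + N → r ≡ r′
  residue-unique (+ zero)    r<N r′<N e = ℤ.+-injective (trans e (ℤ.+-identityʳ _))
  residue-unique {N} {r} {r′} (+ (suc t)) r<N r′<N e =
    ⊥-elim (ℕ.<⇒≱ r<N (ℕ.≤-trans (ℕ.m≤m+n N (t ℕ.* N)) (ℕ.≤-trans (ℕ.m≤n+m (suc t ℕ.* N) r′) (ℕ.≤-reflexive (sym r≡)))))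
    where
    r≡ : r ≡ r′ ℕ.+ suc t ℕ.* N
    r≡ = ℤ.+-injective (trans e (cong (λ s → + r′ + s) (sym (ℤ.pos-* (suc t) N))))
  residue-unique {N} {r} {r′} -[1+ t ] r<N r′<N e =
    ⊥-elim (ℕ.<⇒≱ r′<N (ℕ.≤-trans (ℕ.m≤m+n N (t ℕ.* N)) (ℕ.≤-trans (ℕ.m≤n+m (suc t ℕ.* N) r) (ℕ.≤-reflexive (sym r′≡)))))
    where
    move : ∀ x y t → x ≡ y + (- t) → y ≡ x + t
    move x y t e = trans (eq y t) (cong (_+ t) (sym e))
      where
      eq : ∀ y t → y ≡ (y + (- t)) + t
      eq = solve-∀
    r′≡ : r′ ≡ r ℕ.+ suc t ℕ.* N
    r′≡ = ℤ.+-injective (trans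
      (move (+ r) (+ r′) (+ suc t * + N) (trans e (cong (λ s → + r′ + s) (sym (ℤ.neg-distribˡ-* (+ suc t) (+ N))))))
      (cong (λ s → + r + s) (sym (ℤ.pos-* (suc t) N))))

  %ℕ-unique : ∀ {N} .{{_ : ℕ.NonZero N}} {x r} q → r ℕ.< N → x ≡ + r + q * + N → x %ℕ N ≡ r
  %ℕ-unique {N} {x} {r} q r<N e = residue-unique (q - x /ℕ N) (n%ℕd<d x N) r<N (begin
    + (x %ℕ N)                                      ≡⟨ move (+ (x %ℕ N)) (x /ℕ N * + N) ⟩
    (+ (x %ℕ N) + x /ℕ N * + N) - x /ℕ N * + N      ≡⟨ cong (_- x /ℕ N * + N) (a≡a%ℕn+[a/ℕn]*n x N) ⟨
    x - x /ℕ N * + N                                ≡⟨ cong (_- x /ℕ N * + N) e ⟩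
    (+ r + q * + N) - x /ℕ N * + N                  ≡⟨ collect (+ r) q (x /ℕ N) (+ N) ⟩
    + r + (q - x /ℕ N) * + N                        ∎)
    where
    open ≡-Reasoning
    move : ∀ x y → x ≡ (x + y) - y
    move = solve-∀
    collect : ∀ r q q′ n → (r + q * n) - q′ * n ≡ r + (q - q′) * n
    collect = solve-∀

  %ℕ-cong : ∀ {N} .{{_ : ℕ.NonZero N}} {x} y q → x ≡ y + q * + N → x %ℕ N ≡ y %ℕ N
  %ℕ-cong {N} {x} y q e = %ℕ-unique (y /ℕ N + q) (n%ℕd<d y N) (begin
    x                                        ≡⟨ e ⟩
    y + q * + N                              ≡⟨ cong (_+ q * + N) (a≡a%ℕn+[a/ℕn]*n y N) ⟩
    (+ (y %ℕ N) + y /ℕ N * + N) + q * + N    ≡⟨ collect (+ (y %ℕ N)) (y /ℕ N) q (+ N) ⟩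
    + (y %ℕ N) + (y /ℕ N + q) * + N          ∎)
    where
    open ≡-Reasoning
    collect : ∀ r q q′ n → (r + q * n) + q′ * n ≡ r + (q + q′) * n
    collect = solve-∀

  infixl 6 _⊕_
  infixl 7 _⊛_
  data Poly (n : ℕ) : Set where
    var     : Fin n → Poly n
    con     : ℤ → Poly n
    _⊕_ _⊛_ : Poly n → Poly n → Poly n
    neg     : Poly n → Poly n

  eval : ∀ {n} → Poly n → Vec ℤ n → ℤ
  eval (var i) ρ = Vec.lookup ρ i
  eval (con k) ρ = k
  eval (p ⊕ q) ρ = eval p ρ + eval q ρ
  eval (p ⊛ q) ρ = eval p ρ * eval q ρ
  eval (neg p) ρ = - eval p ρ

  evalMod : ∀ {n} N .{{_ : ℕ.NonZero N}} → Poly n → Vec ℕ n → ℕ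
  evalMod N (var i) ρ = Vec.lookup ρ i
  evalMod N (con k) ρ = k %ℕ N
  evalMod N (p ⊕ q) ρ = (evalMod N p ρ ℕ.+ evalMod N q ρ) ℕ.% N
  evalMod N (p ⊛ q) ρ = (evalMod N p ρ ℕ.* evalMod N q ρ) ℕ.% N
  evalMod N (neg p) ρ = (N ℕ.∸ evalMod N p ρ) ℕ.% N

  residues : ∀ {n} N .{{_ : ℕ.NonZero N}} → Vec ℤ n → Vec ℕ n
  residues N = Vec.map (_%ℕ N)

  module _ {N} .{{_ : ℕ.NonZero N}} where

    %ℕ-+ : ∀ x y → (x + y) %ℕ N ≡ (x %ℕ N ℕ.+ y %ℕ N) ℕ.% N
    %ℕ-+ x y = %ℕ-cong (+ (x %ℕ N ℕ.+ y %ℕ N)) (x /ℕ N + y /ℕ N)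
      (trans (cong₂ _+_ (a≡a%ℕn+[a/ℕn]*n x N) (a≡a%ℕn+[a/ℕn]*n y N)) (eq (+ (x %ℕ N)) (+ (y %ℕ N)) (x /ℕ N) (y /ℕ N) (+ N)))
      where
      eq : ∀ r s q t n → (r + q * n) + (s + t * n) ≡ (r + s) + (q + t) * n
      eq = solve-∀

    %ℕ-* : ∀ x y → (x * y) %ℕ N ≡ ((x %ℕ N) ℕ.* (y %ℕ N)) ℕ.% N
    %ℕ-* x y = %ℕ-cong (+ (r ℕ.* s)) q
      (trans (cong₂ _*_ (a≡a%ℕn+[a/ℕn]*n x N) (a≡a%ℕn+[a/ℕn]*n y N))
        (trans (eq (+ r) (+ s) (x /ℕ N) (y /ℕ N) (+ N)) (cong (_+ q * + N) (sym (ℤ.pos-* r s)))))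
      where
      r s : ℕ
      r = x %ℕ N
      s = y %ℕ N
      q : ℤ
      q = x /ℕ N * + s + y /ℕ N * + r + x /ℕ N * (y /ℕ N) * + N
      eq : ∀ r s q t n → (r + q * n) * (s + t * n) ≡ r * s + (q * s + t * r + q * t * n) * n
      eq = solve-∀

    %ℕ-neg : ∀ x → (- x) %ℕ N ≡ (N ℕ.∸ x %ℕ N) ℕ.% N
    -- The identity is -(r + q N) = (N - r) + (-q - 1) N. For r = 0 its residue part is N itself,
    -- which the outer remainder brings back to 0.
    %ℕ-neg x = %ℕ-cong (+ (N ℕ.∸ r)) (- (x /ℕ N) - + 1) (begin
      - x                                                 ≡⟨ cong (-_) (a≡a%ℕn+[a/ℕn]*n x N) ⟩
      - (+ r + x /ℕ N * + N)                              ≡⟨ eq (+ r) (x /ℕ N) (+ N) ⟩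
      (+ N - + r) + (- (x /ℕ N) - + 1) * + N              ≡⟨ cong (_+ (- (x /ℕ N) - + 1) * + N) (ℤ.[+m]-[+n]≡m⊖n N r) ⟩
      N ℤ.⊖ r + (- (x /ℕ N) - + 1) * + N                  ≡⟨ cong (_+ (- (x /ℕ N) - + 1) * + N) (ℤ.⊖-≥ (ℕ.<⇒≤ (n%ℕd<d x N))) ⟩
      + (N ℕ.∸ r) + (- (x /ℕ N) - + 1) * + N              ∎)
      where
      open ≡-Reasoning
      r : ℕ
      r = x %ℕ N
      eq : ∀ r q n → - (r + q * n) ≡ (n - r) + (- q - + 1) * n
      eq = solve-∀

    lookup-residues : ∀ {n} (ρ : Vec ℤ n) i → Vec.lookup ρ i %ℕ N ≡ Vec.lookup (residues N ρ) i
    lookup-residues (_ ∷ ρ) zero    = refl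
    lookup-residues (_ ∷ ρ) (suc i) = lookup-residues ρ i

    eval-mod : ∀ {n} (p : Poly n) ρ → eval p ρ %ℕ N ≡ evalMod N p (residues N ρ)
    eval-mod (var i) ρ = lookup-residues ρ i
    eval-mod (con k) ρ = refl
    eval-mod (p ⊕ q) ρ = trans (%ℕ-+ (eval p ρ) (eval q ρ))
      (cong₂ (λ r s → (r ℕ.+ s) ℕ.% N) (eval-mod p ρ) (eval-mod q ρ))
    eval-mod (p ⊛ q) ρ = trans (%ℕ-* (eval p ρ) (eval q ρ))
      (cong₂ (λ r s → (r ℕ.* s) ℕ.% N) (eval-mod p ρ) (eval-mod q ρ))
    eval-mod (neg p) ρ = trans (%ℕ-neg (eval p ρ)) (cong (λ r → (N ℕ.∸ r) ℕ.% N) (eval-mod p ρ))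

  allBelow : ℕ → (ℕ → Bool) → Bool
  allBelow zero    f = true
  allBelow (suc n) f = f n ∧ allBelow n f

  allVec : ∀ {n} → ℕ → (Vec ℕ n → Bool) → Bool
  allVec {zero}  N f = f []
  allVec {suc n} N f = allBelow N (λ r → allVec N (λ rs → f (r ∷ rs)))

  ∧-true : ∀ b b′ → b ∧ b′ ≡ true → b ≡ true × b′ ≡ true
  ∧-true true true refl = refl , refl

  allBelow-sound : ∀ {N f r} → allBelow N f ≡ true → r ℕ.< N → f r ≡ true
  allBelow-sound {suc N} {f} {r} e (s≤s r≤N) with ℕ.m≤n⇒m<n∨m≡n r≤N
  ... | inj₁ r<N  = allBelow-sound (proj₂ (∧-true (f N) _ e)) r<N
  ... | inj₂ refl = proj₁ (∧-true (f N) _ e)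

  -- Proof by reflection: a claim about residues becomes one closed evaluation, accepted by `refl`,
  -- and is then transported to all integer vectors.
  allVec-sound : ∀ {n N} .{{_ : ℕ.NonZero N}} (f : Vec ℕ n → Bool) → allVec N f ≡ true →
    ∀ ρ → f (residues N ρ) ≡ true
  allVec-sound         f e []      = e
  allVec-sound {N = N} f e (x ∷ ρ) =
    allVec-sound (λ rs → f (x %ℕ N ∷ rs)) (allBelow-sound {N} {r = x %ℕ N} e (n%ℕd<d x N)) ρ

  -- Hecke operators at 2

  coefficients : Form → Vec ℤ 4
  coefficients F = a F ∷ b F ∷ c F ∷ d F ∷ []

  divides? : ∀ {n} k .{{_ : ℕ.NonZero k}} → Vec ℕ n → Bool
  divides? k []       = true
  divides? k (r ∷ rs) = (r ℕ.% k ℕ.≡ᵇ 0) ∧ divides? k rs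

  quotient-parity : ∀ {n} k .{{_ : ℕ.NonZero k}} → Vec ℕ n → Vec ℕ n
  quotient-parity k = Vec.map (λ r → (r ℕ./ k) ℕ.% 2)

  ≡ᵇ⇒≡ : ∀ {m n} → (m ℕ.≡ᵇ n) ≡ true → m ≡ n
  ≡ᵇ⇒≡ {m} {n} e = ℕ.≡ᵇ⇒≡ m n (subst T (sym e) tt)

  -- For k ∣ 4 the parity of x can be read off from k x modulo 8.
  record Divisor (k : ℕ) .{{_ : ℕ.NonZero k}} : Set where
    field
      cofactor : ℕ
      splits   : k ℕ.* cofactor ≡ 8
      visible  : allBelow 8 (λ r → ((k ℕ.* r) ℕ.% 8 ℕ.% k ℕ.≡ᵇ 0) ∧
                                   ((k ℕ.* r) ℕ.% 8 ℕ./ k ℕ.% 2 ℕ.≡ᵇ r ℕ.% 2)) ≡ true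

  divisor-2 : Divisor 2
  divisor-2 = record { cofactor = 4 ; splits = refl ; visible = refl }

  divisor-4 : Divisor 4
  divisor-4 = record { cofactor = 2 ; splits = refl ; visible = refl }

  quotient : ∀ {N} .{{_ : ℕ.NonZero N}} k e .{{_ : ℕ.NonZero k}} → k ℕ.* e ≡ N →
    ∀ x → (x %ℕ N) ℕ.% k ≡ 0 → ∃ λ y → x ≡ + k * y
  quotient {N} k e refl x r≡0 = + (r ℕ./ k) + x /ℕ N * + e , (begin
    x                                          ≡⟨ a≡a%ℕn+[a/ℕn]*n x N ⟩
    + r + x /ℕ N * + (k ℕ.* e)                 ≡⟨ cong₂ _+_ (cong +_ (sym r≡)) (cong (x /ℕ N *_) (ℤ.pos-* k e)) ⟩
    + (r ℕ./ k ℕ.* k) + x /ℕ N * (+ k * + e)   ≡⟨ cong (_+ x /ℕ N * (+ k * + e)) (ℤ.pos-* (r ℕ./ k) k) ⟩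
    + (r ℕ./ k) * + k + x /ℕ N * (+ k * + e)   ≡⟨ eq (+ (r ℕ./ k)) (+ k) (x /ℕ N) (+ e) ⟩
    + k * (+ (r ℕ./ k) + x /ℕ N * + e)         ∎)
    where
    open ≡-Reasoning
    r : ℕ
    r = x %ℕ N
    r≡ : r ℕ./ k ℕ.* k ≡ r
    r≡ = sym (trans (ℕ.m≡m%n+[m/n]*n r k) (cong (ℕ._+ r ℕ./ k ℕ.* k) r≡0))
    eq : ∀ s k q e → s * k + q * (k * e) ≡ k * (s + q * e)
    eq = solve-∀

  %ℕ-% : ∀ N M .{{_ : ℕ.NonZero N}} .{{_ : ℕ.NonZero M}} t x → + N ≡ t * + M → (x %ℕ N) ℕ.% M ≡ x %ℕ M
  %ℕ-% N M t x N≡ = sym (%ℕ-cong (+ (x %ℕ N)) (x /ℕ N * t) (trans (a≡a%ℕn+[a/ℕn]*n x N)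
    (cong (λ q → + (x %ℕ N) + q) (trans (cong (x /ℕ N *_) N≡) (sym (ℤ.*-assoc (x /ℕ N) t (+ M)))))))

  module _ {k} .{{_ : ℕ.NonZero k}} (k∣8 : Divisor k) where
    open Divisor k∣8

    multiple-residue : ∀ y → ((+ k * y) %ℕ 8 ℕ.% k) ≡ 0 × (+ k * y) %ℕ 8 ℕ./ k ℕ.% 2 ≡ y %ℕ 2
    multiple-residue y = subst (λ r → r ℕ.% k ≡ 0 × r ℕ./ k ℕ.% 2 ≡ y %ℕ 2) (sym r≡)
      (≡ᵇ⇒≡ (proj₁ both) , trans (≡ᵇ⇒≡ (proj₂ both)) (%ℕ-% 8 2 (+ 4) y refl))
      where
      r≡ : (+ k * y) %ℕ 8 ≡ (k ℕ.* (y %ℕ 8)) ℕ.% 8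
      r≡ = %ℕ-cong (+ (k ℕ.* (y %ℕ 8))) (+ k * (y /ℕ 8))
        (trans (cong (+ k *_) (a≡a%ℕn+[a/ℕn]*n y 8)) (trans (eq (+ k) (+ (y %ℕ 8)) (y /ℕ 8))
          (cong (_+ + k * (y /ℕ 8) * + 8) (sym (ℤ.pos-* k (y %ℕ 8))))))
        where
        eq : ∀ k r q → k * (r + q * + 8) ≡ k * r + k * q * + 8
        eq = solve-∀
      both : ((k ℕ.* (y %ℕ 8)) ℕ.% 8 ℕ.% k ℕ.≡ᵇ 0) ≡ true ×
        ((k ℕ.* (y %ℕ 8)) ℕ.% 8 ℕ./ k ℕ.% 2 ℕ.≡ᵇ (y %ℕ 8) ℕ.% 2) ≡ true
      both = ∧-true _ _ (allBelow-sound {8} {λ r → ((k ℕ.* r) ℕ.% 8 ℕ.% k ℕ.≡ᵇ 0) ∧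
        ((k ℕ.* r) ℕ.% 8 ℕ./ k ℕ.% 2 ℕ.≡ᵇ r ℕ.% 2)} {y %ℕ 8} visible (n%ℕd<d y 8))

    divides?-sound : ∀ F → divides? k (residues 8 (coefficients F)) ≡ true → ∃ λ G → F ≡ scale (+ k) G
    divides?-sound F@(form a b c d) e =
      form (proj₁ a′) (proj₁ b′) (proj₁ c′) (proj₁ d′) , form-cong (proj₂ a′) (proj₂ b′) (proj₂ c′) (proj₂ d′)
      where
      e₁ = ∧-true (a %ℕ 8 ℕ.% k ℕ.≡ᵇ 0) _ e
      e₂ = ∧-true (b %ℕ 8 ℕ.% k ℕ.≡ᵇ 0) _ (proj₂ e₁)
      e₃ = ∧-true (c %ℕ 8 ℕ.% k ℕ.≡ᵇ 0) _ (proj₂ e₂)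
      e₄ = ∧-true (d %ℕ 8 ℕ.% k ℕ.≡ᵇ 0) _ (proj₂ e₃)
      q : ∀ x → (x %ℕ 8 ℕ.% k ℕ.≡ᵇ 0) ≡ true → ∃ λ y → x ≡ + k * y
      q x e = quotient k cofactor splits x (≡ᵇ⇒≡ e)
      a′ = q a (proj₁ e₁)
      b′ = q b (proj₁ e₂)
      c′ = q c (proj₁ e₃)
      d′ = q d (proj₁ e₄)

    divides?-complete : ∀ G → divides? k (residues 8 (coefficients (scale (+ k) G))) ≡ true
    divides?-complete (form a b c d) = ∧-refl (zero-residue a) (∧-refl (zero-residue b)
      (∧-refl (zero-residue c) (∧-refl (zero-residue d) refl)))
      where
      ∧-refl : ∀ {x y} → x ≡ true → y ≡ true → x ∧ y ≡ true
      ∧-refl refl refl = refl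
      zero-residue : ∀ y → ((+ k * y) %ℕ 8 ℕ.% k ℕ.≡ᵇ 0) ≡ true
      zero-residue y = cong (ℕ._≡ᵇ 0) (proj₁ (multiple-residue y))

    quotient-parity-scale : ∀ G →
      quotient-parity k (residues 8 (coefficients (scale (+ k) G))) ≡ residues 2 (coefficients G)
    quotient-parity-scale (form a b c d) = cong₂ _∷_ (proj₂ (multiple-residue a))
      (cong₂ _∷_ (proj₂ (multiple-residue b)) (cong₂ _∷_ (proj₂ (multiple-residue c))
        (cong₂ _∷_ (proj₂ (multiple-residue d)) refl)))

  parity : Form → Vec ℕ 4
  parity F = residues 2 (coefficients F)

  -- This decides whether `F` has type `u` and (F ▹ h) / k is integral of type `v`. Divisibility and
  -- the parity of the quotient are both read modulo 8, so that all weights can be compared on the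
  -- same residues.
  cut : (u v : Vec ℕ 4 → Bool) (k : ℕ) .{{_ : ℕ.NonZero k}} → Mat → Form → Bool
  cut u v k h F = u (parity F) ∧
    (divides? k (residues 8 (coefficients (F ▹ h))) ∧ v (quotient-parity k (residues 8 (coefficients (F ▹ h)))))

  -- Representatives of the classes h SL₂(ℤ) of matrices of determinant 2, one for each point
  -- of the projective line over the field of two elements.
  h₀ h₁ h₂ : Mat
  h₀ = mat (+ 2) (+ 0) (+ 0) (+ 1)
  h₁ = mat (+ 0) (- + 1) (+ 2) (+ 0)
  h₂ = mat (+ 2) (- + 1) (+ 0) (+ 1)

  hecke : List Mat
  hecke = h₀ ∷ h₁ ∷ h₂ ∷ []

  opaque
    unfolding _⊗_

    h₀-⊗ : ∀ p q r s → h₀ ⊗ mat p q r s ≡ mat (+ 2 * p) (+ 2 * q) r s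
    h₀-⊗ p q r s = mat-cong (eq₁ p r) (eq₁ q s) (eq₂ p r) (eq₂ q s)
      where
      eq₁ : ∀ p r → + 2 * p + + 0 * r ≡ + 2 * p
      eq₁ = solve-∀
      eq₂ : ∀ p r → + 0 * p + + 1 * r ≡ r
      eq₂ = solve-∀

    h₁-⊗ : ∀ p q r s → h₁ ⊗ mat p q r s ≡ mat (- r) (- s) (+ 2 * p) (+ 2 * q)
    h₁-⊗ p q r s = mat-cong (eq₁ p r) (eq₁ q s) (eq₂ p r) (eq₂ q s)
      where
      eq₁ : ∀ p r → + 0 * p + (- + 1) * r ≡ - r
      eq₁ = solve-∀
      eq₂ : ∀ p r → + 2 * p + + 0 * r ≡ + 2 * p
      eq₂ = solve-∀

    h₂-⊗ : ∀ p q r s → h₂ ⊗ mat p q r s ≡ mat (+ 2 * p - r) (+ 2 * q - s) r s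
    h₂-⊗ p q r s = mat-cong (eq₁ p r) (eq₁ q s) (eq₂ p r) (eq₂ q s)
      where
      eq₁ : ∀ p r → + 2 * p + (- + 1) * r ≡ + 2 * p - r
      eq₁ = solve-∀
      eq₂ : ∀ p r → + 0 * p + + 1 * r ≡ r
      eq₂ = solve-∀

  det-poly : Poly 4
  det-poly = (var zero ⊛ var (suc (suc (suc zero)))) ⊕ neg (var (suc zero) ⊛ var (suc (suc zero)))

  even-sum : ℕ → ℕ → Bool
  even-sum r s = (r ℕ.+ s) ℕ.% 4 ℕ.% 2 ℕ.≡ᵇ 0

  -- Modulo 2 a matrix of determinant 2 has rank one, so its rows have exactly one linear relation.
  row-relation : Vec ℕ 4 → Bool
  row-relation ρ@(p ∷ q ∷ r ∷ s ∷ []) = not (evalMod 4 det-poly ρ ℕ.≡ᵇ 2) ∨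
    (((p ℕ.% 2 ℕ.≡ᵇ 0) ∧ (q ℕ.% 2 ℕ.≡ᵇ 0)) ∨
    (((r ℕ.% 2 ℕ.≡ᵇ 0) ∧ (s ℕ.% 2 ℕ.≡ᵇ 0)) ∨
     (even-sum p r ∧ even-sum q s)))

  ∨-true : ∀ b b′ → b ∨ b′ ≡ true → b ≡ true ⊎ b′ ≡ true
  ∨-true true  b′ e = inj₁ refl
  ∨-true false b′ e = inj₂ e

  half : ∀ x → (x %ℕ 4 ℕ.% 2 ℕ.≡ᵇ 0) ≡ true → ∃ λ y → x ≡ + 2 * y
  half x e = quotient {4} 2 2 refl x (≡ᵇ⇒≡ e)

  half-sum : ∀ x y → even-sum (x %ℕ 4) (y %ℕ 4) ≡ true → ∃ λ z → x + y ≡ + 2 * z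
  half-sum x y e = half (x + y) (subst (λ r → (r ℕ.% 2 ℕ.≡ᵇ 0) ≡ true) (sym (%ℕ-+ x y)) e)

  2≢0 : + 2 ≢ + 0
  2≢0 ()

  Factors : Mat → Set
  Factors g = ∃₂ λ h γ → h ∈ hecke × det γ ≡ + 1 × g ≡ h ⊗ γ

  hecke-covers : ∀ g → det g ≡ + 2 → Factors g
  hecke-covers g@(mat p q r s) e = cases (∨-true _ _ (subst (λ t → not (t ℕ.≡ᵇ 2) ∨ rest ≡ true) det≡ checked))
    where
    ρ : Vec ℤ 4
    ρ = p ∷ q ∷ r ∷ s ∷ []
    checked : row-relation (residues 4 ρ) ≡ true
    checked = allVec-sound row-relation refl ρ
    rest : Bool
    rest = ((p %ℕ 4 ℕ.% 2 ℕ.≡ᵇ 0) ∧ (q %ℕ 4 ℕ.% 2 ℕ.≡ᵇ 0)) ∨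
      (((r %ℕ 4 ℕ.% 2 ℕ.≡ᵇ 0) ∧ (s %ℕ 4 ℕ.% 2 ℕ.≡ᵇ 0)) ∨
       (even-sum (p %ℕ 4) (r %ℕ 4) ∧ even-sum (q %ℕ 4) (s %ℕ 4)))
    det≡ : evalMod 4 det-poly (residues 4 ρ) ≡ 2
    det≡ = trans (sym (eval-mod det-poly ρ)) (cong (_%ℕ 4) e)
    upper : (∃ λ y → p ≡ + 2 * y) → (∃ λ y → q ≡ + 2 * y) → Factors g
    upper (p′ , refl) (q′ , refl) = h₀ , mat p′ q′ r s , here refl ,
      *-cancelˡ 2≢0 (trans (eq p′ q′ r s) e) , sym (h₀-⊗ p′ q′ r s)
      where
      eq : ∀ p q r s → + 2 * (p * s - q * r) ≡ + 2 * p * s - + 2 * q * r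
      eq = solve-∀
    lower : (∃ λ y → r ≡ + 2 * y) → (∃ λ y → s ≡ + 2 * y) → Factors g
    lower (r′ , refl) (s′ , refl) = h₁ , mat r′ s′ (- p) (- q) , there (here refl) ,
      *-cancelˡ 2≢0 (trans (eq p q r′ s′) e) ,
      sym (trans (h₁-⊗ r′ s′ (- p) (- q)) (mat-cong (ℤ.neg-involutive p) (ℤ.neg-involutive q) refl refl))
      where
      eq : ∀ p q r s → + 2 * (r * (- q) - s * (- p)) ≡ p * (+ 2 * s) - q * (+ 2 * r)
      eq = solve-∀
    diagonal : (∃ λ y → p + r ≡ + 2 * y) → (∃ λ y → q + s ≡ + 2 * y) → Factors g
    diagonal (x , ex) (y , ey) = h₂ , mat x y r s , there (there (here refl)) ,
      *-cancelˡ 2≢0 (begin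
        + 2 * (x * s - y * r)               ≡⟨ eq x y r s ⟩
        (+ 2 * x) * s - (+ 2 * y) * r       ≡⟨ cong₂ (λ m n → m * s - n * r) ex ey ⟨
        (p + r) * s - (q + s) * r           ≡⟨ eq′ p q r s ⟩
        p * s - q * r                       ≡⟨ e ⟩
        + 2                                 ∎) ,
      sym (trans (h₂-⊗ x y r s) (mat-cong (back p r ex) (back q s ey) refl refl))
      where
      open ≡-Reasoning
      eq : ∀ x y r s → + 2 * (x * s - y * r) ≡ (+ 2 * x) * s - (+ 2 * y) * r
      eq = solve-∀
      eq′ : ∀ p q r s → (p + r) * s - (q + s) * r ≡ p * s - q * r
      eq′ = solve-∀
      drop : ∀ p r → (p + r) - r ≡ p
      drop = solve-∀
      back : ∀ p r {x} → p + r ≡ + 2 * x → + 2 * x - r ≡ p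
      back p r ex = trans (cong (_- r) (sym ex)) (drop p r)
    cases : false ≡ true ⊎ rest ≡ true → Factors g
    cases (inj₂ e) with ∨-true _ _ e
    ... | inj₁ e₀ = upper (half p (proj₁ (∧-true _ _ e₀))) (half q (proj₂ (∧-true _ _ e₀)))
    ... | inj₂ e′ with ∨-true _ _ e′
    ... | inj₁ e₁ = lower (half r (proj₁ (∧-true _ _ e₁))) (half s (proj₂ (∧-true _ _ e₁)))
    ... | inj₂ e₂ = diagonal (half-sum p r (proj₁ (∧-true _ _ e₂))) (half-sum q s (proj₂ (∧-true _ _ e₂)))

  -- If two of the listed classes met, one of the two matrices of determinant 1 would have an even
  -- bottom row. This is the contradiction behind all three separations.
  even-row : ∀ σ x y → Mat.r σ ≡ + 2 * x → Mat.s σ ≡ + 2 * y → det σ ≢ + 1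
  even-row (mat p q _ _) x y refl refl e =
    ℕ.0≢1+n (trans (sym (%ℕ-cong {2} (+ 0) (p * y - q * x) (eq p q x y))) (cong (_%ℕ 2) e))
    where
    eq : ∀ p q x y → p * (+ 2 * y) - q * (+ 2 * x) ≡ + 0 + (p * y - q * x) * + 2
    eq = solve-∀

  hecke-transversal : Transversal (+ 2) hecke
  hecke-transversal = record
    { dets     = refl ∷ refl ∷ refl ∷ []
    ; covers   = hecke-covers
    ; separate = (sep₀₁ ∷ sep₀₂ ∷ []) ∷ (sep₁₂ ∷ []) ∷ [] ∷ []
    }
    where
    negate : ∀ {x} y → y ≡ - x → - y ≡ x
    negate {x} y e = trans (cong -_ e) (ℤ.neg-involutive x)
    flip : ∀ x y → + 2 * x ≡ - y → y ≡ + 2 * - x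
    flip x y e = trans (sym (negate (+ 2 * x) e)) (ℤ.neg-distribʳ-* (+ 2) x)
    solve-r : ∀ x p r → + 2 * x ≡ + 2 * p - r → r ≡ + 2 * (p - x)
    solve-r x p r e = trans (eq p r) (trans (cong (λ t → + 2 * p - t) (sym e)) (eq′ p x))
      where
      eq : ∀ p r → r ≡ + 2 * p - (+ 2 * p - r)
      eq = solve-∀
      eq′ : ∀ p x → + 2 * p - + 2 * x ≡ + 2 * (p - x)
      eq′ = solve-∀
    sep₀₁ : Separate h₀ h₁
    sep₀₁ (mat p q r s) (mat p′ q′ r′ s′) _ τ≡1 e = even-row (mat p′ q′ r′ s′) (- p) (- q)
      (flip p r′ (cong Mat.p e′)) (flip q s′ (cong Mat.q e′)) τ≡1
      where
      e′ : mat (+ 2 * p) (+ 2 * q) r s ≡ mat (- r′) (- s′) (+ 2 * p′) (+ 2 * q′)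
      e′ = trans (sym (h₀-⊗ p q r s)) (trans e (h₁-⊗ p′ q′ r′ s′))
    sep₀₂ : Separate h₀ h₂
    sep₀₂ (mat p q r s) (mat p′ q′ r′ s′) _ τ≡1 e = even-row (mat p′ q′ r′ s′) (p′ - p) (q′ - q)
      (solve-r p p′ r′ (cong Mat.p e′)) (solve-r q q′ s′ (cong Mat.q e′)) τ≡1
      where
      e′ : mat (+ 2 * p) (+ 2 * q) r s ≡ mat (+ 2 * p′ - r′) (+ 2 * q′ - s′) r′ s′
      e′ = trans (sym (h₀-⊗ p q r s)) (trans e (h₂-⊗ p′ q′ r′ s′))
    sep₁₂ : Separate h₁ h₂
    sep₁₂ (mat p q r s) (mat p′ q′ r′ s′) _ τ≡1 e = even-row (mat p′ q′ r′ s′) p q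
      (sym (cong Mat.r e′)) (sym (cong Mat.s e′)) τ≡1
      where
      e′ : mat (- r) (- s) (+ 2 * p) (+ 2 * q) ≡ mat (+ 2 * p′ - r′) (+ 2 * q′ - s′) r′ s′
      e′ = trans (sym (h₁-⊗ p q r s)) (trans e (h₂-⊗ p′ q′ r′ s′))

  one-transversal : Transversal (+ 1) (one ∷ [])
  one-transversal = record
    { dets     = refl ∷ []
    ; covers   = λ g g≡1 → one , g , here refl , g≡1 , sym (one-⊗ g)
    ; separate = [] ∷ []
    }

  opaque
    unfolding _▹_

    ▹-h₀ : ∀ a b c d → form a b c d ▹ h₀ ≡ form (+ 8 * a) (+ 4 * b) (+ 2 * c) d
    ▹-h₀ a b c d = form-cong (eqᵃ a b c d) (eqᵇ a b c d) (eqᶜ a b c d) (eqᵈ a b c d)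
      where
      eqᵃ : ∀ a b c d → a * + 2 * + 2 * + 2 + b * + 2 * + 2 * + 0 + c * + 2 * + 0 * + 0 + d * + 0 * + 0 * + 0 ≡ + 8 * a
      eqᵃ = solve-∀
      eqᵇ : ∀ a b c d → + 3 * a * + 2 * + 2 * + 0 + b * + 4 + c * + 0 + + 3 * d * + 0 * + 0 * + 1 ≡ + 4 * b
      eqᵇ = solve-∀
      eqᶜ : ∀ a b c d → + 3 * a * + 2 * + 0 * + 0 + b * + 0 + c * + 2 + + 3 * d * + 0 * + 1 * + 1 ≡ + 2 * c
      eqᶜ = solve-∀
      eqᵈ : ∀ a b c d → a * + 0 * + 0 * + 0 + b * + 0 * + 0 * + 1 + c * + 0 * + 1 * + 1 + d * + 1 * + 1 * + 1 ≡ d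
      eqᵈ = solve-∀

    ▹-h₁ : ∀ a b c d → form a b c d ▹ h₁ ≡ form (+ 8 * d) (- (+ 4 * c)) (+ 2 * b) (- a)
    ▹-h₁ a b c d = form-cong (eqᵃ a b c d) (eqᵇ a b c d) (eqᶜ a b c d) (eqᵈ a b c d)
      where
      eqᵃ : ∀ a b c d → a * + 0 * + 0 * + 0 + b * + 0 * + 0 * + 2 + c * + 0 * + 2 * + 2 + d * + 2 * + 2 * + 2 ≡ + 8 * d
      eqᵃ = solve-∀
      eqᵇ : ∀ a b c d → + 3 * a * + 0 * + 0 * (- + 1) + b * + 0 + c * (- + 4) + + 3 * d * + 2 * + 2 * + 0 ≡ - (+ 4 * c)
      eqᵇ = solve-∀
      eqᶜ : ∀ a b c d → + 3 * a * + 0 * (- + 1) * (- + 1) + b * + 2 + c * + 0 + + 3 * d * + 2 * + 0 * + 0 ≡ + 2 * b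
      eqᶜ = solve-∀
      eqᵈ : ∀ a b c d → a * (- + 1) * (- + 1) * (- + 1) + b * (- + 1) * (- + 1) * + 0 + c * (- + 1) * + 0 * + 0 + d * + 0 * + 0 * + 0 ≡ - a
      eqᵈ = solve-∀

    ▹-h₂ : ∀ a b c d → form a b c d ▹ h₂ ≡
      form (+ 8 * a) (+ 4 * (b - + 3 * a)) (+ 2 * (+ 3 * a - + 2 * b + c)) (d - c + b - a)
    ▹-h₂ a b c d = form-cong (eqᵃ a b c d) (eqᵇ a b c d) (eqᶜ a b c d) (eqᵈ a b c d)
      where
      eqᵃ : ∀ a b c d → a * + 2 * + 2 * + 2 + b * + 2 * + 2 * + 0 + c * + 2 * + 0 * + 0 + d * + 0 * + 0 * + 0 ≡ + 8 * a
      eqᵃ = solve-∀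
      eqᵇ : ∀ a b c d → + 3 * a * + 2 * + 2 * (- + 1) + b * + 4 + c * + 0 + + 3 * d * + 0 * + 0 * + 1 ≡ + 4 * (b - + 3 * a)
      eqᵇ = solve-∀
      eqᶜ : ∀ a b c d → + 3 * a * + 2 * (- + 1) * (- + 1) + b * (- + 4) + c * + 2 + + 3 * d * + 0 * + 1 * + 1 ≡
        + 2 * (+ 3 * a - + 2 * b + c)
      eqᶜ = solve-∀
      eqᵈ : ∀ a b c d → a * (- + 1) * (- + 1) * (- + 1) + b * (- + 1) * (- + 1) * + 1 + c * (- + 1) * + 1 * + 1 + d * + 1 * + 1 * + 1 ≡
        d - c + b - a
      eqᵈ = solve-∀

  -- The discriminant is an invariant of weight 6, and 64 = 2⁶.
  P-hecke : ∀ F → All (λ h → P (F ▹ h) ≡ + 64 * P F) hecke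
  P-hecke (form a b c d) =
    trans (cong P (▹-h₀ a b c d)) (eq₀ a b c d) ∷
    trans (cong P (▹-h₁ a b c d)) (eq₁ a b c d) ∷
    trans (cong P (▹-h₂ a b c d)) (eq₂ a b c d) ∷ []
    where
    eq₀ : ∀ a b c d → let a′ = + 8 * a; b′ = + 4 * b; c′ = + 2 * c in
      b′ * b′ * c′ * c′ + + 18 * a′ * b′ * c′ * d - + 4 * a′ * c′ * c′ * c′ - + 4 * b′ * b′ * b′ * d - + 27 * a′ * a′ * d * d ≡
      + 64 * (b * b * c * c + + 18 * a * b * c * d - + 4 * a * c * c * c - + 4 * b * b * b * d - + 27 * a * a * d * d)
    eq₀ = solve-∀
    eq₁ : ∀ a b c d → let a′ = + 8 * d; b′ = - (+ 4 * c); c′ = + 2 * b; d′ = - a in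
      b′ * b′ * c′ * c′ + + 18 * a′ * b′ * c′ * d′ - + 4 * a′ * c′ * c′ * c′ - + 4 * b′ * b′ * b′ * d′ - + 27 * a′ * a′ * d′ * d′ ≡
      + 64 * (b * b * c * c + + 18 * a * b * c * d - + 4 * a * c * c * c - + 4 * b * b * b * d - + 27 * a * a * d * d)
    eq₁ = solve-∀
    eq₂ : ∀ a b c d →
      let a′ = + 8 * a; b′ = + 4 * (b - + 3 * a); c′ = + 2 * (+ 3 * a - + 2 * b + c); d′ = d - c + b - a in
      b′ * b′ * c′ * c′ + + 18 * a′ * b′ * c′ * d′ - + 4 * a′ * c′ * c′ * c′ - + 4 * b′ * b′ * b′ * d′ - + 27 * a′ * a′ * d′ * d′ ≡
      + 64 * (b * b * c * c + + 18 * a * b * c * d - + 4 * a * c * c * c - + 4 * b * b * b * d - + 27 * a * a * d * d)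
    eq₂ = solve-∀

  -- Hecke, scaling and inclusion correspondences between masses.

  P-scale : ∀ k F → P (scale k F) ≡ k * k * k * k * P F
  P-scale k (form a b c d) = eq k a b c d
    where
    eq : ∀ k a b c d →
      k * b * (k * b) * (k * c) * (k * c) + + 18 * (k * a) * (k * b) * (k * c) * (k * d)
        - + 4 * (k * a) * (k * c) * (k * c) * (k * c) - + 4 * (k * b) * (k * b) * (k * b) * (k * d)
        - + 27 * (k * a) * (k * a) * (k * d) * (k * d) ≡
      k * k * k * k * (b * b * c * c + + 18 * a * b * c * d - + 4 * a * c * c * c - + 4 * b * b * b * d - + 27 * a * a * d * d)
    eq = solve-∀

  scale-one : ∀ F → scale (+ 1) F ≡ F
  scale-one (form a b c d) =
    form-cong (ℤ.*-identityˡ a) (ℤ.*-identityˡ b) (ℤ.*-identityˡ c) (ℤ.*-identityˡ d)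

  -- Closure is required under every integral matrix because matrices of determinant 2 act as well.
  -- The Bezout identity makes K a unit modulo 32, so a power of 2 up to 32 that divides K D already
  -- divides D.
  record Lattice (Λ : Form → Set) (K : ℤ) : Set where
    field
      ▹-closed : ∀ h F → Λ F → Λ (F ▹ h)
      double   : ∀ F → Λ F → Λ (scale (+ 2) F)
      halve    : ∀ F → Λ (scale (+ 2) F) → Λ F
      α β      : ℤ
      coprime  : α * K + β * + 32 ≡ + 1

  -- Both directions are instances: c = 1, k = 2 upwards and c = 2, k = 4 downwards. The second pair
  -- of constants, 2 and 8, is the one that `arrow-adj` prescribes for reversing the first, 1 and 2.
  hecke-marking : ∀ {Λ K D S′ D′ u v} c k .{{_ : ℕ.NonZero k}} → c ≢ + 0 → Divisor k → Lattice Λ K →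
    (∀ G → Λ (scale (+ k) G) → + 64 * D ≡ + k * + k * + k * + k * P G → S′ G × P G ≡ D′) →
    Marking (+ 2) c (c * + k) (u ∘ parity) (v ∘ parity) Λ D S′ D′ hecke (cut u v k)
  hecke-marking {Λ} {K} {D} {S′} {D′} {u} {v} c k c≢0 k∣8 lat land = record
    { sound = λ F F∈Λ PF → All.zipWith (λ {h} (det≡ , P≡) → start F F∈Λ PF h det≡ P≡)
        (Transversal.dets hecke-transversal , P-hecke F)
    ; complete = λ {h} {F} {G} _ A → finish h F G A (divides (Arrow.maps A))
    }
    where
    divides : ∀ {F G} → scale c F ≡ scale (c * + k) G → F ≡ scale (+ k) G
    divides {F} {G} e = scale-injective c≢0 (trans e (sym (scale-scale c (+ k) G)))
    start : ∀ F → Λ F → P F ≡ D → ∀ h → det h ≡ + 2 → P (F ▹ h) ≡ + 64 * P F → cut u v k h F ≡ true →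
      ∃ λ G → S′ G × P G ≡ D′ × Arrow (+ 2) c (c * + k) (u ∘ parity) (v ∘ parity) F G h
    start F F∈Λ PF h det≡ P≡ e = G , proj₁ landing , proj₂ landing , record
      { det≡   = det≡
      ; maps   = trans (cong (scale c) G≡) (scale-scale c (+ k) G)
      ; source = proj₁ e₁
      ; target = trans (cong v (sym (quotient-parity-scale k∣8 G)))
          (trans (cong (λ F → v (quotient-parity k (residues 8 (coefficients F)))) (sym G≡)) (proj₂ e₂))
      }
      where
      e₁ = ∧-true (u (parity F)) _ e
      e₂ = ∧-true (divides? k (residues 8 (coefficients (F ▹ h)))) _ (proj₂ e₁)
      G : Form
      G = proj₁ (divides?-sound k∣8 (F ▹ h) (proj₁ e₂))
      G≡ : F ▹ h ≡ scale (+ k) G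
      G≡ = proj₂ (divides?-sound k∣8 (F ▹ h) (proj₁ e₂))
      PG : + 64 * D ≡ + k * + k * + k * + k * P G
      PG = begin
        + 64 * D                                ≡⟨ cong (λ t → + 64 * t) PF ⟨
        + 64 * P F                              ≡⟨ P≡ ⟨
        P (F ▹ h)                               ≡⟨ cong P G≡ ⟩
        P (scale (+ k) G)                       ≡⟨ P-scale (+ k) G ⟩
        + k * + k * + k * + k * P G             ∎
        where open ≡-Reasoning
      landing : S′ G × P G ≡ D′
      landing = land G (subst Λ G≡ (Lattice.▹-closed lat h F F∈Λ)) PG
    finish : ∀ h F G → Arrow (+ 2) c (c * + k) (u ∘ parity) (v ∘ parity) F G h → F ▹ h ≡ scale (+ k) G →
      cut u v k h F ≡ true
    finish h F G A G≡ = begin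
      u (parity F) ∧ test (F ▹ h)                  ≡⟨ cong₂ (λ x F → x ∧ test F) (Arrow.source A) G≡ ⟩
      test (scale (+ k) G)                         ≡⟨ cong₂ _∧_ (divides?-complete k∣8 G) (cong v (quotient-parity-scale k∣8 G)) ⟩
      v (parity G)                                 ≡⟨ Arrow.target A ⟩
      true                                         ∎
      where
      open ≡-Reasoning
      test : Form → Bool
      test F = divides? k (residues 8 (coefficients F)) ∧ v (quotient-parity k (residues 8 (coefficients F)))

  -- A matrix of determinant 2 multiplies `P` by 64 and division by k divides it by k⁴. Hence k = 2
  -- gives the factor 4, and k = 4 gives its inverse.
  hecke-correspondence : ∀ {Λ K E m m′ u v} → Lattice Λ K → Invariant (u ∘ parity) → Invariant (v ∘ parity) →
    (M : Mass Λ (K * E) m) (M′ : Mass Λ (K * (E * + 4)) m′) →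
    total M (count (cut u v 2) hecke) ≡ total M′ (count (cut v u 4) hecke)
  hecke-correspondence {Λ} {K} {E} {u = u} {v} lat u-inv v-inv M M′ =
    double-count {u = u ∘ parity} {v ∘ parity} {hs = hecke} {cut u v 2} {cut v u 4}
      (λ ()) (λ ()) (λ ()) (λ ()) u-inv v-inv hecke-transversal M M′
      (hecke-marking {u = u} {v} (+ 1) 2 (λ ()) divisor-2 lat
        (λ G G∈ e → halve G G∈ , *-cancelˡ {+ 16} (λ ()) (trans (sym e) (eq₁ K E))))
      (hecke-marking {u = v} {u} (+ 2) 4 (λ ()) divisor-4 lat
        (λ G G∈ e → halve G (halve (scale (+ 2) G) (subst Λ (sym (scale-scale (+ 2) (+ 2) G)) G∈)) ,
          *-cancelˡ {+ 256} (λ ()) (trans (sym e) (eq₂ K E))))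
    where
    open Lattice lat
    eq₁ : ∀ K E → + 64 * (K * E) ≡ + 16 * (K * (E * + 4))
    eq₁ = solve-∀
    eq₂ : ∀ K E → + 64 * (K * (E * + 4)) ≡ + 256 * (K * E)
    eq₂ = solve-∀

  multiple-of : ∀ {Λ K} → Lattice Λ K → ∀ {D} n e x → n * e ≡ + 32 → K * D ≡ n * x → ∃ λ E → D ≡ E * n
  multiple-of {K = K} lat {D} n e x ne≡32 KD≡ = α * x + β * e * D , (begin
    D                                     ≡⟨ ℤ.*-identityˡ D ⟨
    + 1 * D                               ≡⟨ cong (_* D) coprime ⟨
    (α * K + β * + 32) * D                ≡⟨ cong (λ t → (α * K + β * t) * D) ne≡32 ⟨
    (α * K + β * (n * e)) * D             ≡⟨ eq₁ α β K n e D ⟩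
    α * (K * D) + β * (n * e) * D         ≡⟨ cong (λ t → α * t + β * (n * e) * D) KD≡ ⟩
    α * (n * x) + β * (n * e) * D         ≡⟨ eq₂ α β n x e D ⟩
    (α * x + β * e * D) * n               ∎)
    where
    open Lattice lat
    open ≡-Reasoning
    eq₁ : ∀ α β K n e D → (α * K + β * (n * e)) * D ≡ α * (K * D) + β * (n * e) * D
    eq₁ = solve-∀
    eq₂ : ∀ α β n x e D → α * (n * x) + β * (n * e) * D ≡ (α * x + β * e * D) * n
    eq₂ = solve-∀

  -- A successful cut would produce an integral quotient of discriminant K D / 4, and K is odd.
  -- Taking the empty class as target turns the soundness of a marking into this contradiction.
  hecke-vanishing : ∀ {Λ K D u v} → Lattice Λ K → (∀ E → D ≢ E * + 4) →
    ∀ F → Λ F → P F ≡ K * D → count (cut v u 4) hecke F ≡ 0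
  hecke-vanishing {Λ} {K} {D} {u} {v} lat D≢ F F∈Λ PF = none (Marking.sound marking F F∈Λ PF)
    where
    impossible : ¬ (∃ λ E → D ≡ E * + 4)
    impossible (E , D≡) = D≢ E D≡
    marking : Marking (+ 2) (+ 1) (+ 1 * + 4) (v ∘ parity) (u ∘ parity) Λ (K * D) (λ _ → ⊥) (+ 0) hecke (cut v u 4)
    marking = hecke-marking {u = v} {u} (+ 1) 4 (λ ()) divisor-4 lat λ G _ e →
      ⊥-elim (impossible (multiple-of lat (+ 4) (+ 8) (P G) refl
        (*-cancelˡ {+ 64} (λ ()) (trans e (ℤ.*-assoc (+ 64) (+ 4) (P G))))))
    none : ∀ {hs} {Q : Mat → Form → Set} → All (λ h → cut v u 4 h F ≡ true → ∃ λ G → ⊥ × Q h G) hs →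
      count (cut v u 4) hs F ≡ 0
    none [] = refl
    none {h ∷ _} (¬κ ∷ rest) with cut v u 4 h F
    ... | false = none rest
    ... | true with () ← proj₁ (proj₂ (¬κ refl))

  even? : Form → Bool
  even? F = divides? 2 (residues 8 (coefficients F))

  -- The arrow is the identity matrix with constants 1 and 2, that is F = 2 G. The discriminant is
  -- quartic, hence the factor 16.
  scaling-correspondence : ∀ {Λ K E m m′} → Lattice Λ K →
    (M : Mass Λ (K * (E * + 16)) m) (M′ : Mass Λ (K * E) m′) →
    total M (count (λ _ → even?) (one ∷ [])) ≡ total M′ (count (λ _ _ → true) (one ∷ []))
  scaling-correspondence {Λ} {K} {E} lat M M′ =
    double-count {u = λ _ → true} {λ _ → true} {κ = λ _ → even?} {κ′ = λ _ _ → true} (λ ()) (λ ()) (λ ()) (λ ()) (λ _ _ _ → refl) (λ _ _ _ → refl)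
      one-transversal M M′
      (record { sound = λ F F∈Λ PF → shrink F F∈Λ PF ∷ []
              ; complete = λ { {F = F} {G} (here refl) A → subst (λ F → even? F ≡ true)
                  (sym (trans (sym (scale-one F)) (trans (cong (scale (+ 1)) (sym (▹-one F))) (Arrow.maps A))))
                  (divides?-complete divisor-2 G) } })
      (record { sound = λ F F∈Λ PF → (λ _ → scale (+ 2) F , double F F∈Λ , grow F PF , record
                  { det≡ = refl
                  ; maps = trans (cong (scale (+ 2)) (▹-one F)) (sym (scale-one (scale (+ 2) F)))
                  ; source = refl
                  ; target = refl
                  }) ∷ []
              ; complete = λ _ _ → refl })
    where
    open Lattice lat
    eq : ∀ K E → + 16 * (K * E) ≡ K * (E * + 16)
    eq = solve-∀
    grow : ∀ F → P F ≡ K * E → P (scale (+ 2) F) ≡ K * (E * + 16)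
    grow F PF = trans (P-scale (+ 2) F) (trans (cong (λ t → + 16 * t) PF) (eq K E))
    shrink : ∀ F → Λ F → P F ≡ K * (E * + 16) → even? F ≡ true →
      ∃ λ G → Λ G × P G ≡ K * E × Arrow (+ 1) (+ 1) (+ 2) (λ _ → true) (λ _ → true) F G one
    shrink F F∈Λ PF e = G , halve G (subst Λ F≡ F∈Λ) ,
      *-cancelˡ {+ 16} (λ ()) (trans (sym (P-scale (+ 2) G)) (trans (cong P (sym F≡)) (trans PF (sym (eq K E))))) , record
      { det≡   = refl
      ; maps   = trans (scale-one (F ▹ one)) (trans (▹-one F) F≡)
      ; source = refl
      ; target = refl
      }
      where
      G : Form
      G = proj₁ (divides?-sound divisor-2 F e)
      F≡ : F ≡ scale (+ 2) G
      F≡ = proj₂ (divides?-sound divisor-2 F e)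

  scaling-vanishing : ∀ {Λ K D} → Lattice Λ K → (∀ E → D ≢ E * + 16) →
    ∀ F → P F ≡ K * D → even? F ≡ false
  scaling-vanishing {K = K} {D} lat D≢ F PF = go (even? F) refl
    where
    go : ∀ b → even? F ≡ b → even? F ≡ false
    go false e = e
    go true  e = ⊥-elim (impossible (multiple-of lat (+ 16) (+ 2) (P (proj₁ G)) refl
      (trans (sym PF) (trans (cong P (proj₂ G)) (P-scale (+ 2) (proj₁ G))))))
      where
      impossible : ¬ (∃ λ E → D ≡ E * + 16)
      impossible (E , D≡) = D≢ E D≡
      G : ∃ λ G → F ≡ scale (+ 2) G
      G = divides?-sound divisor-2 F e

  -- The orbits in `S` and in `Λ` are listed by unrelated representatives, so even a subset is
  -- compared through the double count, along the identity arrows F → F.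
  inclusion : ∀ {Λ S D m m′ ℓ} → Invariant ℓ → (∀ F → P F ≡ D → S F ⇔ (Λ F × ℓ F ≡ true)) →
    (N : Mass S D m′) (M : Mass Λ D m) →
    total N (count (λ _ _ → true) (one ∷ [])) ≡ total M (count (λ _ → ℓ) (one ∷ []))
  inclusion {Λ} {S} {D} {ℓ = ℓ} inv S⇔ N M =
    double-count {u = λ _ → true} {ℓ} {κ = λ _ _ → true} {κ′ = λ _ → ℓ} (λ ()) (λ ()) (λ ()) (λ ()) (λ _ _ _ → refl) inv one-transversal N M
      (record { sound = λ F F∈S PF → (λ _ → F , proj₁ (Equivalence.to (S⇔ F PF) F∈S) , PF ,
                  arrow F refl (proj₂ (Equivalence.to (S⇔ F PF) F∈S))) ∷ []
              ; complete = λ _ _ → refl })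
      (record { sound = λ F F∈Λ PF → (λ e → F , Equivalence.from (S⇔ F PF) (F∈Λ , e) , PF , arrow F e refl) ∷ []
              ; complete = λ _ A → Arrow.source A })
    where
    arrow : ∀ {u v} F → u F ≡ true → v F ≡ true → Arrow (+ 1) (+ 1) (+ 1) u v F F one
    arrow F e e′ = record { det≡ = refl ; maps = cong (scale (+ 1)) (▹-one F) ; source = e ; target = e′ }

  -- Types of forms modulo 2

  Parities : Set
  Parities = Vec ℕ 4 → Bool

  code : Vec ℕ 4 → ℕ
  code (a ∷ b ∷ c ∷ d ∷ []) = 8 ℕ.* a ℕ.+ 4 ℕ.* b ℕ.+ 2 ℕ.* c ℕ.+ d

  -- Factorisation types over the field of two elements, listed by the binary code of the
  -- coefficients: the cube of a linear form, three distinct linear factors, and a linear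
  -- times an irreducible quadratic factor.
  anything cube split mixed : Parities
  anything ρ = true
  cube     ρ = (code ρ ℕ.≡ᵇ 8) ∨ (code ρ ℕ.≡ᵇ 1) ∨ (code ρ ℕ.≡ᵇ 15)
  split    ρ = code ρ ℕ.≡ᵇ 6
  mixed    ρ = (code ρ ℕ.≡ᵇ 9) ∨ (code ρ ℕ.≡ᵇ 14) ∨ (code ρ ℕ.≡ᵇ 7)

  A B C D : Poly 4
  A = var zero
  B = var (suc zero)
  C = var (suc (suc zero))
  D = var (suc (suc (suc zero)))

  vanishes : Poly 4 → Parities
  vanishes p ρ = evalMod 2 p ρ ℕ.≡ᵇ 0

  member : Idx → Parities
  member i1 ρ = true
  member i2 ρ = vanishes (A ⊕ B ⊕ D) ρ ∧ vanishes (A ⊕ C ⊕ D) ρ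
  member i3 ρ = vanishes (A ⊕ B ⊕ C) ρ ∧ vanishes (B ⊕ C ⊕ D) ρ
  member i4 ρ = vanishes (B ⊕ C) ρ
  member i5 ρ = vanishes A ρ ∧ (vanishes D ρ ∧ vanishes (B ⊕ C) ρ)

  -- Weights on coefficients modulo 8 and the identities between them.

  Weight : Set
  Weight = Vec ℕ 4 → ℕ

  reduce : Vec ℕ 4 → Vec ℕ 4
  reduce = Vec.map (ℕ._% 2)

  lattice : Idx → Weight
  lattice i ρ = bit (member i (reduce ρ))

  doubled : Weight
  doubled ρ = bit (divides? 2 ρ)

  hecke-polys : List (Vec (Poly 4) 4)
  hecke-polys =
    (con (+ 8) ⊛ A ∷ con (+ 4) ⊛ B ∷ con (+ 2) ⊛ C ∷ D ∷ []) ∷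
    (con (+ 8) ⊛ D ∷ neg (con (+ 4) ⊛ C) ∷ con (+ 2) ⊛ B ∷ neg A ∷ []) ∷
    (con (+ 8) ⊛ A ∷ con (+ 4) ⊛ (B ⊕ neg (con (+ 3) ⊛ A)) ∷
      con (+ 2) ⊛ (con (+ 3) ⊛ A ⊕ neg (con (+ 2) ⊛ B) ⊕ C) ∷ D ⊕ neg C ⊕ B ⊕ neg A ∷ []) ∷ []

  test : Parities → (k : ℕ) .{{_ : ℕ.NonZero k}} → Vec ℕ 4 → Bool
  test v k ρ = divides? k ρ ∧ v (quotient-parity k ρ)

  cuts : Parities → Parities → (k : ℕ) .{{_ : ℕ.NonZero k}} → List (Vec (Poly 4) 4) → Weight
  cuts u v k []         ρ = 0
  cuts u v k (ps ∷ pss) ρ = bit (u (reduce ρ) ∧ test v k (Vec.map (λ p → evalMod 8 p ρ) ps)) ℕ.+ cuts u v k pss ρ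

  cutting : Parities → Parities → (k : ℕ) .{{_ : ℕ.NonZero k}} → Weight
  cutting u v k = cuts u v k hecke-polys

  U W : Poly 4
  U = B ⊛ C ⊕ A ⊛ D
  W = con (+ 4) ⊛ A ⊛ B ⊛ C ⊛ D ⊕ neg (A ⊛ C ⊛ C ⊛ C) ⊕ neg (B ⊛ B ⊛ B ⊛ D) ⊕ neg (con (+ 7) ⊛ A ⊛ A ⊛ D ⊛ D)

  -- P = U² + 4 W. If U is odd then so is P, and if U is even then U² modulo 32 depends only
  -- on U modulo 8.
  square-plus : ℕ → ℕ → ℕ → Bool
  square-plus l u w = (u ℕ.% 2 ℕ.≡ᵇ 0) ∧ ((u ℕ.* u ℕ.+ 4 ℕ.* w) ℕ.% 32 ℕ.≡ᵇ l)

  discriminant : ℕ → Weight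
  discriminant l ρ = bit (square-plus l (evalMod 8 U ρ) (evalMod 8 W ρ))

  sumOf : List Weight → Weight
  sumOf []       ρ = 0
  sumOf (w ∷ ws) ρ = w ρ ℕ.+ sumOf ws ρ

  -- The record carries the two lists in its type, from which they can be recovered; its field is a
  -- single evaluation over the 8⁴ residue vectors.
  record Balanced (ws vs : List Weight) : Set where
    constructor by-residues
    field
      checked : allVec 8 (λ ρ → sumOf ws ρ ℕ.≡ᵇ sumOf vs ρ) ≡ true

  -- If P ≡ 4 modulo 32, there is exactly one double root modulo 2. Moved to the place where c and d
  -- are even, it has 4 | d, and the quotient (2 a, b, c / 2, d / 4) has discriminant 1 modulo 8 and
  -- a root modulo 2, hence is split. Conversely a split quotient has discriminant 1 modulo 8 and
  -- forces b to be odd, so the double root is unique.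
  balance-4 : Balanced (discriminant 4 ∷ []) (cutting anything split 4 ∷ [])
  balance-4 = by-residues refl

  -- A split form has three roots, and `L i5` consists of the forms that are split or zero modulo 2.
  balance-4′ : Balanced (cutting split anything 2 ∷ doubled ∷ doubled ∷ doubled ∷ [])
                        (lattice i5 ∷ lattice i5 ∷ lattice i5 ∷ [])
  balance-4′ = by-residues refl

  -- P ≡ 20 modulo 32 arises in two disjoint ways: from a mixed quotient, of discriminant 5 modulo
  -- 8, or from a cube modulo 2 whose triple root, moved to even c and d, has d ≡ 2 modulo 4, where
  -- P ≡ -108. The second kind is all cubes minus `cutting cube anything 4`. Modulo 2 the lattice
  -- `i4` comprises the zero, split, mixed and cube types, `i2` zero and mixed, `i5` zero and split,
  -- so the cubes are `i4` - `i2` - `i5` + `doubled`.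
  balance-20 : Balanced (discriminant 20 ∷ cutting cube anything 4 ∷ lattice i2 ∷ lattice i5 ∷ [])
                        (lattice i4 ∷ doubled ∷ cutting anything mixed 4 ∷ [])
  balance-20 = by-residues refl

  -- At a double root with c and d even, either 4 | d, or d ≡ 2 modulo 4, and the latter means that
  -- the quotient by 2 is a cube. So the first two weights together count double roots: 3 for zero,
  -- 1 for a cube or a square times another factor, 0 otherwise. The last weight is the indicator of
  -- the mixed type, which has one root. The rest is a comparison type by type, `i3` being zero,
  -- split and irreducible.
  balance-20′ : Balanced
    (cutting anything anything 4 ∷ cutting anything cube 2 ∷ lattice i3 ∷ lattice i2 ∷ lattice i2 ∷ [])
    (lattice i1 ∷ doubled ∷ doubled ∷ doubled ∷ doubled ∷ doubled ∷ cutting mixed anything 2 ∷ [])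
  balance-20′ = by-residues refl

  -- The first weight is the number of roots modulo 2: 3 for zero and split, 2 for a square times
  -- another linear factor, 1 for mixed and cube, 0 for irreducible.
  balance-20″ : Balanced (cutting anything anything 2 ∷ lattice i4 ∷ lattice i3 ∷ lattice i3 ∷ [])
    (lattice i1 ∷ lattice i1 ∷ lattice i5 ∷ lattice i5 ∷ lattice i5 ∷ lattice i5 ∷ [])
  balance-20″ = by-residues refl

  -- Invariance of the types under SL₂(ℤ).

  act-polys : Vec (Poly 8) 4
  act-polys =
    α ⊛ p ⊛ p ⊛ p ⊕ β ⊛ p ⊛ p ⊛ r ⊕ γ ⊛ p ⊛ r ⊛ r ⊕ δ ⊛ r ⊛ r ⊛ r ∷
    con (+ 3) ⊛ α ⊛ p ⊛ p ⊛ q ⊕ β ⊛ (p ⊛ p ⊛ s ⊕ con (+ 2) ⊛ p ⊛ q ⊛ r)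
      ⊕ γ ⊛ (q ⊛ r ⊛ r ⊕ con (+ 2) ⊛ p ⊛ r ⊛ s) ⊕ con (+ 3) ⊛ δ ⊛ r ⊛ r ⊛ s ∷
    con (+ 3) ⊛ α ⊛ p ⊛ q ⊛ q ⊕ β ⊛ (con (+ 2) ⊛ p ⊛ q ⊛ s ⊕ q ⊛ q ⊛ r)
      ⊕ γ ⊛ (p ⊛ s ⊛ s ⊕ con (+ 2) ⊛ q ⊛ r ⊛ s) ⊕ con (+ 3) ⊛ δ ⊛ r ⊛ s ⊛ s ∷
    α ⊛ q ⊛ q ⊛ q ⊕ β ⊛ q ⊛ q ⊛ s ⊕ γ ⊛ q ⊛ s ⊛ s ⊕ δ ⊛ s ⊛ s ⊛ s ∷ []
    where
    p q r s α β γ δ : Poly 8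
    p = var zero
    q = var (suc zero)
    r = var (suc (suc zero))
    s = var (suc (suc (suc zero)))
    α = var (suc (suc (suc (suc zero))))
    β = var (suc (suc (suc (suc (suc zero)))))
    γ = var (suc (suc (suc (suc (suc (suc zero))))))
    δ = var (suc (suc (suc (suc (suc (suc (suc zero)))))))

  evalMods : ∀ {m n} N .{{_ : ℕ.NonZero N}} → Vec (Poly n) m → Vec ℕ n → Vec ℕ m
  evalMods N ps ρ = Vec.map (λ p → evalMod N p ρ) ps

  evals-mod : ∀ {m n} N .{{_ : ℕ.NonZero N}} (ps : Vec (Poly n) m) ρ →
    residues N (Vec.map (λ p → eval p ρ) ps) ≡ evalMods N ps (residues N ρ)
  evals-mod N []       ρ = refl
  evals-mod N (p ∷ ps) ρ = cong₂ _∷_ (eval-mod p ρ) (evals-mod N ps ρ)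

  stable-at : Parities → Vec ℕ 8 → Bool
  stable-at v ρ@(p ∷ q ∷ r ∷ s ∷ F) =
    not (evalMod 2 det-poly (p ∷ q ∷ r ∷ s ∷ []) ℕ.≡ᵇ 1) ∨ not (v (evalMods 2 act-polys ρ) xor v F)

  stable : Parities → Bool
  stable v = allVec 2 (stable-at v)

  opaque
    unfolding _▹_

    -- The parities of F ▹ γ are polynomials in the parities of γ and F, so invariance is a check
    -- over 2⁸ vectors, restricted to odd determinant.
    stable⇒invariant : ∀ v → stable v ≡ true → Invariant (v ∘ parity)
    stable⇒invariant v e γ@(mat p q r s) F@(form a b c d) γ≡1 = begin
      v (parity (F ▹ γ))                             ≡⟨ cong v (evals-mod 2 act-polys ρ) ⟩
      v (evalMods 2 act-polys (residues 2 ρ))        ≡⟨ agree _ _ (subst (λ t → not (t ℕ.≡ᵇ 1) ∨ same ≡ true) det≡1 (allVec-sound (stable-at v) e ρ)) ⟩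
      v (parity F)                                   ∎
      where
      open ≡-Reasoning
      ρ : Vec ℤ 8
      ρ = p ∷ q ∷ r ∷ s ∷ a ∷ b ∷ c ∷ d ∷ []
      same : Bool
      same = not (v (evalMods 2 act-polys (residues 2 ρ)) xor v (parity F))
      det≡1 : evalMod 2 det-poly (residues 2 (p ∷ q ∷ r ∷ s ∷ [])) ≡ 1
      det≡1 = trans (sym (eval-mod det-poly (p ∷ q ∷ r ∷ s ∷ []))) (cong (_%ℕ 2) γ≡1)
      agree : ∀ x y → not (x xor y) ≡ true → x ≡ y
      agree true  true  _ = refl
      agree false false _ = refl

  cube-invariant : Invariant (cube ∘ parity)
  cube-invariant = stable⇒invariant cube refl

  split-invariant : Invariant (split ∘ parity)
  split-invariant = stable⇒invariant split refl

  mixed-invariant : Invariant (mixed ∘ parity)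
  mixed-invariant = stable⇒invariant mixed refl

  anything-invariant : Invariant (anything ∘ parity)
  anything-invariant _ _ _ = refl

  member-invariant : ∀ i → Invariant (member i ∘ parity)
  member-invariant i1 = stable⇒invariant (member i1) refl
  member-invariant i2 = stable⇒invariant (member i2) refl
  member-invariant i3 = stable⇒invariant (member i3) refl
  member-invariant i4 = stable⇒invariant (member i4) refl
  member-invariant i5 = stable⇒invariant (member i5) refl

  -- Lattices, cuts and discriminants read off from residues.

  %ℕ≡0⇒∣ : ∀ N .{{_ : ℕ.NonZero N}} x → x %ℕ N ≡ 0 → + N ℤ∣.∣ x
  %ℕ≡0⇒∣ N x e = ℤ∣ˢ.∣⇒∣ᵤ (ℤ∣ˢ.divides (x /ℕ N) (trans (a≡a%ℕn+[a/ℕn]*n x N)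
    (trans (cong (λ r → + r + x /ℕ N * + N) e) (ℤ.+-identityˡ _))))

  ∣⇒%ℕ≡0 : ∀ N .{{_ : ℕ.NonZero N}} x → + N ℤ∣.∣ x → x %ℕ N ≡ 0
  ∣⇒%ℕ≡0 N x N∣x with ℤ∣ˢ.divides q e ← ℤ∣ˢ.∣ᵤ⇒∣ {+ N} {x} N∣x =
    %ℕ-unique {N} q (ℕ.>-nonZero⁻¹ N) (trans e (sym (ℤ.+-identityˡ _)))

  ≡⇒≡ᵇ : ∀ {m n} → m ≡ n → (m ℕ.≡ᵇ n) ≡ true
  ≡⇒≡ᵇ {zero}  refl = refl
  ≡⇒≡ᵇ {suc m} refl = ≡⇒≡ᵇ {m} refl

  even-vanishes : ∀ p F → Even (eval p (coefficients F)) ⇔ (vanishes p (parity F) ≡ true)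
  even-vanishes p F = mk⇔
    (λ e → ≡⇒≡ᵇ (trans (sym (eval-mod p (coefficients F))) (∣⇒%ℕ≡0 2 (eval p (coefficients F)) e)))
    (λ e → %ℕ≡0⇒∣ 2 (eval p (coefficients F)) (trans (eval-mod p (coefficients F)) (≡ᵇ⇒≡ e)))

  both : ∀ {x y} {X Y : Set} → X ⇔ (x ≡ true) → Y ⇔ (y ≡ true) → (X × Y) ⇔ (x ∧ y ≡ true)
  both {x} {y} f g = mk⇔
    (λ (s , t) → cong₂ _∧_ (Equivalence.to f s) (Equivalence.to g t))
    (λ e → Equivalence.from f (proj₁ (∧-true x y e)) , Equivalence.from g (proj₂ (∧-true x y e)))

  L-member : ∀ i F → L i F ⇔ (member i (parity F) ≡ true)
  L-member i1 F = mk⇔ (λ _ → refl) (λ _ → tt)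
  L-member i2 F = both (even-vanishes (A ⊕ B ⊕ D) F) (even-vanishes (A ⊕ C ⊕ D) F)
  L-member i3 F = both (even-vanishes (A ⊕ B ⊕ C) F) (even-vanishes (B ⊕ C ⊕ D) F)
  L-member i4 F = even-vanishes (B ⊕ C) F
  L-member i5 F = both (even-vanishes A F) (both (even-vanishes D F) (even-vanishes (B ⊕ C) F))

  octal : Form → Vec ℕ 4
  octal F = residues 8 (coefficients F)

  reduce-octal : ∀ F → reduce (octal F) ≡ parity F
  reduce-octal (form a b c d) = cong₂ _∷_ (low a) (cong₂ _∷_ (low b) (cong₂ _∷_ (low c) (cong₂ _∷_ (low d) refl)))
    where
    low : ∀ x → x %ℕ 8 ℕ.% 2 ≡ x %ℕ 2
    low x = %ℕ-% 8 2 (+ 4) x refl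

  evals : ∀ {m n} → Vec (Poly n) m → Vec ℤ n → Vec ℤ m
  evals ps ρ = Vec.map (λ p → eval p ρ) ps

  count-cuts : ∀ u v k .{{_ : ℕ.NonZero k}} F {hs pss} →
    Pointwise (λ h ps → coefficients (F ▹ h) ≡ evals ps (coefficients F)) hs pss →
    count (cut u v k) hs F ≡ cuts u v k pss (octal F)
  count-cuts u v k F []       = refl
  count-cuts u v k F {h ∷ _} {ps ∷ _} (e ∷ es) = cong₂ (λ x n → bit x ℕ.+ n)
    (cong₂ (λ ρ ρ′ → u ρ ∧ test v k ρ′) (sym (reduce-octal F))
      (trans (cong (residues 8) e) (evals-mod 8 ps (coefficients F))))
    (count-cuts u v k F es)

  count-cutting : ∀ u v k .{{_ : ℕ.NonZero k}} F → count (cut u v k) hecke F ≡ cutting u v k (octal F)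
  count-cutting u v k F@(form a b c d) = count-cuts u v k F {hecke} {hecke-polys}
    (cong coefficients (▹-h₀ a b c d) ∷ cong coefficients (▹-h₁ a b c d) ∷ cong coefficients (▹-h₂ a b c d) ∷ [])

  P-square-plus : ∀ F → P F ≡ eval U (coefficients F) * eval U (coefficients F) + + 4 * eval W (coefficients F)
  P-square-plus (form a b c d) = eq a b c d
    where
    eq : ∀ a b c d →
      b * b * c * c + + 18 * a * b * c * d - + 4 * a * c * c * c - + 4 * b * b * b * d - + 27 * a * a * d * d ≡
      (b * c + a * d) * (b * c + a * d) + + 4 * (+ 4 * a * b * c * d + - (a * c * c * c) + - (b * b * b * d) + - (+ 7 * a * a * d * d))
    eq = solve-∀

  square-plus-spec : ∀ l x y → l ℕ.% 2 ≡ 0 →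
    square-plus l (x %ℕ 8) (y %ℕ 8) ≡ ((x * x + + 4 * y) %ℕ 32 ℕ.≡ᵇ l)
  square-plus-spec l x y l-even = cases (u ℕ.% 2) refl (ℕ.m%n<n u 2)
    where
    open ≡-Reasoning
    u w : ℕ
    u = x %ℕ 8
    w = y %ℕ 8
    h k j : ℤ
    h = + (u ℕ./ 2)
    k = x /ℕ 8
    j = y /ℕ 8
    x≡ : ∀ r → u ℕ.% 2 ≡ r → + u ≡ + r + h * + 2
    x≡ r e = trans (cong +_ (trans (ℕ.m≡m%n+[m/n]*n u 2) (cong (ℕ._+ u ℕ./ 2 ℕ.* 2) e)))
      (trans (ℤ.pos-+ r (u ℕ./ 2 ℕ.* 2)) (cong (λ t → + r + t) (ℤ.pos-* (u ℕ./ 2) 2)))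
    cases : ∀ r → u ℕ.% 2 ≡ r → r ℕ.< 2 → square-plus l u w ≡ ((x * x + + 4 * y) %ℕ 32 ℕ.≡ᵇ l)
    -- With u = 2 h the cross term 16 u k of (u + 8 k)² equals 32 h k, so only u² survives modulo
    -- 32.
    cases 0 e _ = trans (cong (λ r → (r ℕ.≡ᵇ 0) ∧ ((u ℕ.* u ℕ.+ 4 ℕ.* w) ℕ.% 32 ℕ.≡ᵇ l)) e)
      (cong (ℕ._≡ᵇ l) (sym (%ℕ-cong (+ (u ℕ.* u ℕ.+ 4 ℕ.* w)) (h * k + + 2 * k * k + j) (begin
        x * x + + 4 * y
          ≡⟨ cong₂ (λ s t → s * s + + 4 * t) (a≡a%ℕn+[a/ℕn]*n x 8) (a≡a%ℕn+[a/ℕn]*n y 8) ⟩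
        (+ u + k * + 8) * (+ u + k * + 8) + + 4 * (+ w + j * + 8)
          ≡⟨ cong (λ s → (s + k * + 8) * (s + k * + 8) + + 4 * (+ w + j * + 8)) (x≡ 0 e) ⟩
        (+ 0 + h * + 2 + k * + 8) * (+ 0 + h * + 2 + k * + 8) + + 4 * (+ w + j * + 8)
          ≡⟨ eq h k (+ w) j ⟩
        (+ 0 + h * + 2) * (+ 0 + h * + 2) + + 4 * + w + (h * k + + 2 * k * k + j) * + 32
          ≡⟨ cong (λ s → s * s + + 4 * + w + (h * k + + 2 * k * k + j) * + 32) (x≡ 0 e) ⟨
        + u * + u + + 4 * + w + (h * k + + 2 * k * k + j) * + 32
          ≡⟨ cong (_+ (h * k + + 2 * k * k + j) * + 32) (cong₂ _+_ (ℤ.pos-* u u) (ℤ.pos-* 4 w)) ⟨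
        + (u ℕ.* u ℕ.+ 4 ℕ.* w) + (h * k + + 2 * k * k + j) * + 32 ∎))))
      where
      eq : ∀ h k w j → (+ 0 + h * + 2 + k * + 8) * (+ 0 + h * + 2 + k * + 8) + + 4 * (w + j * + 8) ≡
        (+ 0 + h * + 2) * (+ 0 + h * + 2) + + 4 * w + (h * k + + 2 * k * k + j) * + 32
      eq = solve-∀
    -- Here x² + 4 y is odd while `l` is even, so both tests are `false`.
    cases 1 e _ = trans (cong (λ r → (r ℕ.≡ᵇ 0) ∧ ((u ℕ.* u ℕ.+ 4 ℕ.* w) ℕ.% 32 ℕ.≡ᵇ l)) e)
      (sym (odd (x * x + + 4 * y) (%ℕ-unique ((h * + 2 + h * h * + 2) + + 8 * k + + 16 * h * k + + 32 * k * k + + 2 * y) (s≤s (s≤s z≤n)) (begin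
        x * x + + 4 * y
          ≡⟨ cong (λ s → s * s + + 4 * y) (a≡a%ℕn+[a/ℕn]*n x 8) ⟩
        (+ u + k * + 8) * (+ u + k * + 8) + + 4 * y
          ≡⟨ cong (λ s → (s + k * + 8) * (s + k * + 8) + + 4 * y) (x≡ 1 e) ⟩
        (+ 1 + h * + 2 + k * + 8) * (+ 1 + h * + 2 + k * + 8) + + 4 * y
          ≡⟨ eq h k y ⟩
        + 1 + ((h * + 2 + h * h * + 2) + + 8 * k + + 16 * h * k + + 32 * k * k + + 2 * y) * + 2 ∎))))
      where
      eq : ∀ h k y → (+ 1 + h * + 2 + k * + 8) * (+ 1 + h * + 2 + k * + 8) + + 4 * y ≡
        + 1 + ((h * + 2 + h * h * + 2) + + 8 * k + + 16 * h * k + + 32 * k * k + + 2 * y) * + 2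
      eq = solve-∀
      odd : ∀ z → z %ℕ 2 ≡ 1 → (z %ℕ 32 ℕ.≡ᵇ l) ≡ false
      odd z z-odd with z %ℕ 32 ℕ.≡ᵇ l in e′
      ... | false = refl
      ... | true = ⊥-elim (ℕ.0≢1+n (trans (sym l-even) (trans (cong (ℕ._% 2) (sym (≡ᵇ⇒≡ {z %ℕ 32} {l} e′)))
        (trans (%ℕ-% 32 2 (+ 16) z refl) z-odd))))
    cases (suc (suc _)) e (s≤s (s≤s ()))

  discriminant-spec : ∀ l F → l ℕ.% 2 ≡ 0 → discriminant l (octal F) ≡ bit (P F %ℕ 32 ℕ.≡ᵇ l)
  discriminant-spec l F l-even = cong bit (begin
    square-plus l (evalMod 8 U (octal F)) (evalMod 8 W (octal F))
      ≡⟨ cong₂ (square-plus l) (eval-mod U (coefficients F)) (eval-mod W (coefficients F)) ⟨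
    square-plus l (eval U (coefficients F) %ℕ 8) (eval W (coefficients F) %ℕ 8)
      ≡⟨ square-plus-spec l (eval U (coefficients F)) (eval W (coefficients F)) l-even ⟩
    ((eval U (coefficients F) * eval U (coefficients F) + + 4 * eval W (coefficients F)) %ℕ 32 ℕ.≡ᵇ l)
      ≡⟨ cong (λ x → x %ℕ 32 ℕ.≡ᵇ l) (P-square-plus F) ⟨
    (P F %ℕ 32 ℕ.≡ᵇ l) ∎)
    where open ≡-Reasoning

  -- The relations

  sh-multiple : ∀ d .{{_ : ℕ.NonZero d}} g E → sh d g (E * + d) ≡ g E
  sh-multiple d g E = begin
    sh d g (E * + d)             ≡⟨ cong (λ r → if r ℕ.≡ᵇ 0 then g ((E * + d) /ℕ d) else 0ℚ) r≡0 ⟩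
    g ((E * + d) /ℕ d)           ≡⟨ cong g (ℤ.*-cancelʳ-≡ _ _ (+ d) (begin
      (E * + d) /ℕ d * + d                             ≡⟨ ℤ.+-identityˡ _ ⟨
      + 0 ℤ.+ (E * + d) /ℕ d * + d                     ≡⟨ cong (λ r → + r ℤ.+ (E * + d) /ℕ d * + d) r≡0 ⟨
      + ((E * + d) %ℕ d) ℤ.+ (E * + d) /ℕ d * + d      ≡⟨ a≡a%ℕn+[a/ℕn]*n (E * + d) d ⟨
      E * + d                                          ∎)) ⟩
    g E                          ∎
    where
    open ≡-Reasoning
    r≡0 : (E * + d) %ℕ d ≡ 0
    r≡0 = %ℕ-unique {d} {x = E * + d} E (ℕ.>-nonZero⁻¹ d) (sym (ℤ.+-identityˡ _))

  residue-0 : ∀ d .{{_ : ℕ.NonZero d}} D → D %ℕ d ≡ 0 → D ≡ D /ℕ d * + d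
  residue-0 d D e = trans (a≡a%ℕn+[a/ℕn]*n D d) (trans (cong (λ r → + r ℤ.+ D /ℕ d * + d) e) (ℤ.+-identityˡ _))

  sh-other : ∀ d .{{_ : ℕ.NonZero d}} g {D} → (∀ E → D ≢ E * + d) → sh d g D ≡ 0ℚ
  sh-other d g {D} D≢ with D %ℕ d ℕ.≡ᵇ 0 in e
  ... | false = refl
  ... | true  = ⊥-elim (D≢ (D /ℕ d) (residue-0 d D (≡ᵇ⇒≡ {D %ℕ d} e)))

  multiple? : ∀ d .{{_ : ℕ.NonZero d}} D → (∃ λ E → D ≡ E * + d) ⊎ (∀ E → D ≢ E * + d)
  multiple? d D with D %ℕ d ℕ.≟ 0
  ... | yes e = inj₁ (D /ℕ d , residue-0 d D e)
  ... | no ¬e = inj₂ λ E e → ¬e (%ℕ-unique {d} {x = D} E (ℕ.>-nonZero⁻¹ d) (trans e (sym (ℤ.+-identityˡ _))))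

  -- Totals of weights over orbit representatives.

  module _ {S D m} (M : Mass S D m) where
    open Mass M

    total-cong : ∀ w w′ → (∀ F → S F → P F ≡ D → w F ≡ w′ F) → total M w ≡ total M w′
    total-cong w w′ e = sumFin-cong (length reps) λ i → cong (λ n → ι n ℚ.* weight (stab i))
      (e (lookup reps i) (All.lookup repsIn (∈-lookup i)) (All.lookup repsDisc (∈-lookup i)))

    total-+ : ∀ w w′ → total M (λ F → w F ℕ.+ w′ F) ≡ total M w ℚ.+ total M w′
    total-+ w w′ = trans
      (sumFin-cong (length reps) λ i → trans (cong (ℚ._* weight (stab i)) (ι-+ (w (lookup reps i)) (w′ (lookup reps i))))
        (ℚ.*-distribʳ-+ (weight (stab i)) (ι (w (lookup reps i))) (ι (w′ (lookup reps i)))))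
      (sumFin-+ (length reps) _ _)

    total-0 : ∀ w → (∀ F → S F → P F ≡ D → w F ≡ 0) → total M w ≡ 0ℚ
    total-0 w e = trans (total-cong w (λ _ → 0) e)
      (trans (sumFin-cong (length reps) (λ i → ℚ.*-zeroˡ (weight (stab i)))) (sumFin-0 (length reps)))

    total-1 : total M (count (λ _ _ → true) (one ∷ [])) ≡ m
    total-1 = trans (sumFin-cong (length reps) (λ i → ℚ.*-identityˡ (weight (stab i)))) (sym massEq)

    totals : List Weight → ℚ
    totals []       = 0ℚ
    totals (w ∷ ws) = total M (w ∘ octal) ℚ.+ totals ws

    total-sumOf : ∀ ws → total M (sumOf ws ∘ octal) ≡ totals ws
    total-sumOf []       = total-0 (λ _ → 0) (λ _ _ _ → refl)
    total-sumOf (w ∷ ws) = trans (total-+ (w ∘ octal) (sumOf ws ∘ octal)) (cong (total M (w ∘ octal) ℚ.+_) (total-sumOf ws))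

    balance : ∀ {ws vs} → Balanced ws vs → totals ws ≡ totals vs
    balance {ws} {vs} (by-residues e) = trans (sym (total-sumOf ws)) (trans
      (total-cong (sumOf ws ∘ octal) (sumOf vs ∘ octal) (λ F _ _ → ≡ᵇ⇒≡ {sumOf ws (octal F)} (balanced-at F))) (total-sumOf vs))
      where
      balanced-at : ∀ F → (sumOf ws (octal F) ℕ.≡ᵇ sumOf vs (octal F)) ≡ true
      balanced-at F = allVec-sound (λ ρ → sumOf ws ρ ℕ.≡ᵇ sumOf vs ρ) e (coefficients F)

  -- `S₄` and `S₂₀` are named after the residue of the actual discriminant K D modulo 32. For K = 27
  -- they are the classes of -20 and -4 of `P` / 27.
  record Family (S : Idx → Form → Set) (S₄ S₂₀ : Form → Set) (K : ℤ) : Set where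
    field
      isLattice : Lattice (S i1) K
      S-member  : ∀ i F → S i F ⇔ (S i1 F × member i (parity F) ≡ true)
      S₄-spec   : ∀ D F → P F ≡ K * D → S₄ F ⇔ (S i1 F × ((K * D) %ℕ 32 ℕ.≡ᵇ 4) ≡ true)
      S₂₀-spec  : ∀ D F → P F ≡ K * D → S₂₀ F ⇔ (S i1 F × ((K * D) %ℕ 32 ℕ.≡ᵇ 20) ≡ true)

  module Relations {S S₄ S₂₀ K} (family : Family S S₄ S₂₀ K) (f : Idx → ℤ → ℚ) (e₄ e₂₀ : ℤ → ℚ)
                   (mass : ∀ i D → D ≢ + 0 → Mass (S i) (K * D) (f i D))
                   (mass₄ : ∀ D → D ≢ + 0 → Mass S₄ (K * D) (e₄ D))
                   (mass₂₀ : ∀ D → D ≢ + 0 → Mass S₂₀ (K * D) (e₂₀ D)) where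
    open Family family

    I : ∀ {D} → D ≢ + 0 → Weight → ℚ
    I D≢0 w = total (mass i1 _ D≢0) (w ∘ octal)

    factor≢0 : ∀ {D E d} → D ≡ E * d → D ≢ + 0 → E ≢ + 0
    factor≢0 {d = d} D≡ D≢0 refl = D≢0 (trans D≡ (ℤ.*-zeroˡ d))

    lattice-total : ∀ {D} (D≢0 : D ≢ + 0) i → f i D ≡ I D≢0 (lattice i)
    lattice-total {D} D≢0 i = begin
      f i D
        ≡⟨ total-1 N ⟨
      total N (count (λ _ _ → true) (one ∷ []))
        ≡⟨ inclusion {ℓ = member i ∘ parity} (member-invariant i) (λ F _ → S-member i F) N M ⟩
      total M (count (λ _ → member i ∘ parity) (one ∷ []))
        ≡⟨ total-cong M (count (λ _ → member i ∘ parity) (one ∷ [])) (lattice i ∘ octal) (λ F _ _ → trans (ℕ.+-identityʳ _) (cong (bit ∘ member i) (sym (reduce-octal F)))) ⟩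
      I D≢0 (lattice i) ∎
      where
      open ≡-Reasoning
      N = mass i D D≢0
      M = mass i1 D D≢0

    -- All forms in the total share the discriminant K D, so the congruence is a constant condition
    -- and trivially invariant. Only afterwards is it rewritten as a weight on coefficients modulo
    -- 8, where it can be balanced.
    congruence-total : ∀ {D T m} (D≢0 : D ≢ + 0) l → l ℕ.% 2 ≡ 0 → Mass T (K * D) m →
      (∀ F → P F ≡ K * D → T F ⇔ (S i1 F × ((K * D) %ℕ 32 ℕ.≡ᵇ l) ≡ true)) → m ≡ I D≢0 (discriminant l)
    congruence-total {D} {m = m} D≢0 l l-even N spec = begin
      m
        ≡⟨ total-1 N ⟨
      total N (count (λ _ _ → true) (one ∷ []))
        ≡⟨ inclusion {ℓ = λ _ → (K * D) %ℕ 32 ℕ.≡ᵇ l} (λ _ _ _ → refl) spec N M ⟩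
      total M (count (λ _ _ → (K * D) %ℕ 32 ℕ.≡ᵇ l) (one ∷ []))
        ≡⟨ total-cong M (count (λ _ _ → (K * D) %ℕ 32 ℕ.≡ᵇ l) (one ∷ [])) (discriminant l ∘ octal) (λ F _ PF → trans (ℕ.+-identityʳ _)
             (sym (trans (discriminant-spec l F l-even) (cong (λ x → bit (x %ℕ 32 ℕ.≡ᵇ l)) PF)))) ⟩
      I D≢0 (discriminant l) ∎
      where
      open ≡-Reasoning
      M = mass i1 D D≢0

    doubled-multiple : ∀ {E} (D≢0 : E * + 16 ≢ + 0) → f i1 E ≡ I D≢0 doubled
    doubled-multiple {E} D≢0 = begin
      f i1 E
        ≡⟨ total-1 N ⟨
      total N (count (λ _ _ → true) (one ∷ []))
        ≡⟨ scaling-correspondence {E = E} isLattice M N ⟨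
      total M (count (λ _ → even?) (one ∷ []))
        ≡⟨ total-cong M (count (λ _ → even?) (one ∷ [])) (doubled ∘ octal) (λ F _ _ → ℕ.+-identityʳ _) ⟩
      I D≢0 doubled ∎
      where
      open ≡-Reasoning
      N = mass i1 E (factor≢0 refl D≢0)
      M = mass i1 (E * + 16) D≢0

    doubled-total : ∀ {D} (D≢0 : D ≢ + 0) → sh 16 (f i1) D ≡ I D≢0 doubled
    doubled-total {D} D≢0 with multiple? 16 D
    ... | inj₁ (E , refl) = trans (sh-multiple 16 (f i1) E) (doubled-multiple D≢0)
    ... | inj₂ D≢ = trans (sh-other 16 (f i1) D≢)
      (sym (total-0 (mass i1 D D≢0) (doubled ∘ octal) (λ F _ PF → cong bit (scaling-vanishing isLattice D≢ F PF))))

    cutting-multiple : ∀ {E u v} → Invariant (u ∘ parity) → Invariant (v ∘ parity) →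
      (E≢0 : E ≢ + 0) (D≢0 : E * + 4 ≢ + 0) → I E≢0 (cutting u v 2) ≡ I D≢0 (cutting v u 4)
    cutting-multiple {E} {u} {v} u-inv v-inv E≢0 D≢0 = begin
      I E≢0 (cutting u v 2)             ≡⟨ total-cong N (count (cut u v 2) hecke) (cutting u v 2 ∘ octal) (λ F _ _ → count-cutting u v 2 F) ⟨
      total N (count (cut u v 2) hecke) ≡⟨ hecke-correspondence {E = E} {u = u} {v} isLattice u-inv v-inv N M ⟩
      total M (count (cut v u 4) hecke) ≡⟨ total-cong M (count (cut v u 4) hecke) (cutting v u 4 ∘ octal) (λ F _ _ → count-cutting v u 4 F) ⟩
      I D≢0 (cutting v u 4)             ∎
      where
      open ≡-Reasoning
      N = mass i1 E E≢0
      M = mass i1 (E * + 4) D≢0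

    cutting-other : ∀ {D} u v (D≢0 : D ≢ + 0) → (∀ E → D ≢ E * + 4) → I D≢0 (cutting v u 4) ≡ 0ℚ
    cutting-other {D} u v D≢0 D≢ = total-0 (mass i1 D D≢0) (cutting v u 4 ∘ octal) λ F F∈ PF →
      trans (sym (count-cutting v u 4 F)) (hecke-vanishing {u = u} {v} isLattice D≢ F F∈ PF)

    congruence-4 : ∀ {D} (D≢0 : D ≢ + 0) → e₄ D ≡ I D≢0 (cutting anything split 4)
    congruence-4 {D} D≢0 = begin
      e₄ D                                      ≡⟨ congruence-total D≢0 4 refl (mass₄ D D≢0) (S₄-spec D) ⟩
      I D≢0 (discriminant 4)                    ≡⟨ ℚ.+-identityʳ _ ⟨
      I D≢0 (discriminant 4) ℚ.+ 0ℚ             ≡⟨ balance (mass i1 D D≢0) balance-4 ⟩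
      I D≢0 (cutting anything split 4) ℚ.+ 0ℚ   ≡⟨ ℚ.+-identityʳ _ ⟩
      I D≢0 (cutting anything split 4)          ∎
      where open ≡-Reasoning

    relation-4 : ∀ D → D ≢ + 0 → e₄ D ≡ (+ 3 ℚ./ 1) ℚ.* sh 4 (λ E → f i5 E ℚ.- sh 16 (f i1) E) D
    relation-4 D D≢0 = by-cases (multiple? 4 D)
      where
      open ≡-Reasoning
      g : ℤ → ℚ
      g E = f i5 E ℚ.- sh 16 (f i1) E
      by-cases : (∃ λ E → D ≡ E * + 4) ⊎ (∀ E → D ≢ E * + 4) → e₄ D ≡ (+ 3 ℚ./ 1) ℚ.* sh 4 g D
      by-cases (inj₂ D≢) = begin
        e₄ D                                ≡⟨ congruence-4 D≢0 ⟩
        I D≢0 (cutting anything split 4)    ≡⟨ cutting-other split anything D≢0 D≢ ⟩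
        (+ 3 ℚ./ 1) ℚ.* 0ℚ                  ≡⟨ cong ((+ 3 ℚ./ 1) ℚ.*_) (sh-other 4 g D≢) ⟨
        (+ 3 ℚ./ 1) ℚ.* sh 4 g D            ∎
      by-cases (inj₁ (E , refl)) = begin
        e₄ D                                                 ≡⟨ congruence-4 D≢0 ⟩
        I D≢0 (cutting anything split 4)                     ≡⟨ cutting-multiple {u = split} {anything} split-invariant anything-invariant E≢0 D≢0 ⟨
        s                                                    ≡⟨ isolate s x l (balance (mass i1 E E≢0) balance-4′) ⟩
        (+ 3 ℚ./ 1) ℚ.* (l ℚ.- x)                            ≡⟨ cong₂ (λ l x → (+ 3 ℚ./ 1) ℚ.* (l ℚ.- x)) (lattice-total E≢0 i5) (doubled-total E≢0) ⟨
        (+ 3 ℚ./ 1) ℚ.* g E                                  ≡⟨ cong ((+ 3 ℚ./ 1) ℚ.*_) (sh-multiple 4 g E) ⟨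
        (+ 3 ℚ./ 1) ℚ.* sh 4 g D                             ∎
        where
        E≢0 : E ≢ + 0
        E≢0 = factor≢0 refl D≢0
        s x l : ℚ
        s = I E≢0 (cutting split anything 2)
        x = I E≢0 doubled
        l = I E≢0 (lattice i5)
        isolate : ∀ s x l → s ℚ.+ (x ℚ.+ (x ℚ.+ (x ℚ.+ 0ℚ))) ≡ l ℚ.+ (l ℚ.+ (l ℚ.+ 0ℚ)) →
          s ≡ (+ 3 ℚ./ 1) ℚ.* (l ℚ.- x)
        isolate s x l e = begin
          s
            ≡⟨ solve 2 (λ s x → s := s :+ (x :+ (x :+ (x :+ con 0ℚ))) :- con (+ 3 ℚ./ 1) :* x) refl s x ⟩
          s ℚ.+ (x ℚ.+ (x ℚ.+ (x ℚ.+ 0ℚ))) ℚ.- (+ 3 ℚ./ 1) ℚ.* x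
            ≡⟨ cong (ℚ._- (+ 3 ℚ./ 1) ℚ.* x) e ⟩
          l ℚ.+ (l ℚ.+ (l ℚ.+ 0ℚ)) ℚ.- (+ 3 ℚ./ 1) ℚ.* x
            ≡⟨ solve 2 (λ x l → l :+ (l :+ (l :+ con 0ℚ)) :- con (+ 3 ℚ./ 1) :* x := con (+ 3 ℚ./ 1) :* (l :- x)) refl x l ⟩
          (+ 3 ℚ./ 1) ℚ.* (l ℚ.- x) ∎

    -- The bracket of lattice masses counts the cubes modulo 2. The two cuts add the mixed quotients
    -- and remove the cubes whose triple root lifts modulo 4.
    congruence-20 : ∀ {D} (D≢0 : D ≢ + 0) → e₂₀ D ≡
      (f i4 D ℚ.- f i2 D ℚ.- f i5 D ℚ.+ sh 16 (f i1) D) ℚ.+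
      (I D≢0 (cutting anything mixed 4) ℚ.- I D≢0 (cutting cube anything 4))
    congruence-20 {D} D≢0 = trans
      (isolate (e₂₀ D) k (f i2 D) (f i5 D) (f i4 D) (sh 16 (f i1) D) m (begin
        e₂₀ D ℚ.+ (k ℚ.+ (f i2 D ℚ.+ (f i5 D ℚ.+ 0ℚ)))
          ≡⟨ cong₂ (λ e r → e ℚ.+ (k ℚ.+ r)) (congruence-total D≢0 20 refl (mass₂₀ D D≢0) (S₂₀-spec D))
               (cong₂ (λ p q → p ℚ.+ (q ℚ.+ 0ℚ)) (lattice-total D≢0 i2) (lattice-total D≢0 i5)) ⟩
        I D≢0 (discriminant 20) ℚ.+ (k ℚ.+ (I D≢0 (lattice i2) ℚ.+ (I D≢0 (lattice i5) ℚ.+ 0ℚ)))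
          ≡⟨ balance (mass i1 D D≢0) balance-20 ⟩
        I D≢0 (lattice i4) ℚ.+ (I D≢0 doubled ℚ.+ (m ℚ.+ 0ℚ))
          ≡⟨ cong₂ (λ p q → p ℚ.+ (q ℚ.+ (m ℚ.+ 0ℚ))) (lattice-total D≢0 i4) (doubled-total D≢0) ⟨
        f i4 D ℚ.+ (sh 16 (f i1) D ℚ.+ (m ℚ.+ 0ℚ)) ∎)) refl
      where
      open ≡-Reasoning
      k m : ℚ
      k = I D≢0 (cutting cube anything 4)
      m = I D≢0 (cutting anything mixed 4)
      isolate : ∀ e k f₂ f₅ f₄ x m → e ℚ.+ (k ℚ.+ (f₂ ℚ.+ (f₅ ℚ.+ 0ℚ))) ≡ f₄ ℚ.+ (x ℚ.+ (m ℚ.+ 0ℚ)) →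
        e ≡ (f₄ ℚ.- f₂ ℚ.- f₅ ℚ.+ x) ℚ.+ (m ℚ.- k)
      isolate e k f₂ f₅ f₄ x m h = begin
        e
          ≡⟨ solve 4 (λ e k f₂ f₅ → e := e :+ (k :+ (f₂ :+ (f₅ :+ con 0ℚ))) :- (k :+ (f₂ :+ f₅))) refl e k f₂ f₅ ⟩
        e ℚ.+ (k ℚ.+ (f₂ ℚ.+ (f₅ ℚ.+ 0ℚ))) ℚ.- (k ℚ.+ (f₂ ℚ.+ f₅))
          ≡⟨ cong (ℚ._- (k ℚ.+ (f₂ ℚ.+ f₅))) h ⟩
        f₄ ℚ.+ (x ℚ.+ (m ℚ.+ 0ℚ)) ℚ.- (k ℚ.+ (f₂ ℚ.+ f₅))
          ≡⟨ solve 6 (λ k f₂ f₅ f₄ x m → f₄ :+ (x :+ (m :+ con 0ℚ)) :- (k :+ (f₂ :+ f₅)) :=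
               (f₄ :- f₂ :- f₅ :+ x) :+ (m :- k)) refl k f₂ f₅ f₄ x m ⟩
        (f₄ ℚ.- f₂ ℚ.- f₅ ℚ.+ x) ℚ.+ (m ℚ.- k) ∎

    at-quarter : ℤ → ℚ
    at-quarter E = f i1 E ℚ.- f i3 E ℚ.- (+ 2 ℚ./ 1) ℚ.* f i2 E ℚ.+ (+ 5 ℚ./ 1) ℚ.* sh 16 (f i1) E

    at-sixteenth : ℤ → ℚ
    at-sixteenth E = f i1 E ℚ.- f i4 E ℚ.- (+ 2 ℚ./ 1) ℚ.* f i3 E ℚ.+ (+ 4 ℚ./ 1) ℚ.* f i5 E

    -- The roots modulo 2 amount to 2 f₁ - f₄ - 2 f₃ + 4 f₅. One f₁ is split off because in the
    -- final formula it joins the other multiple of `sh 16 (f i1)`.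
    roots-total : ∀ {E} (E≢0 : E ≢ + 0) → I E≢0 (cutting anything anything 2) ≡ f i1 E ℚ.+ at-sixteenth E
    roots-total {E} E≢0 = isolate _ (f i4 E) (f i3 E) (f i1 E) (f i5 E) (begin
      r ℚ.+ (f i4 E ℚ.+ (f i3 E ℚ.+ (f i3 E ℚ.+ 0ℚ)))
        ≡⟨ cong₂ (λ p q → r ℚ.+ (p ℚ.+ (q ℚ.+ (q ℚ.+ 0ℚ)))) (lattice-total E≢0 i4) (lattice-total E≢0 i3) ⟩
      r ℚ.+ (I E≢0 (lattice i4) ℚ.+ (I E≢0 (lattice i3) ℚ.+ (I E≢0 (lattice i3) ℚ.+ 0ℚ)))
        ≡⟨ balance (mass i1 E E≢0) balance-20″ ⟩
      right (I E≢0 (lattice i1)) (I E≢0 (lattice i5))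
        ≡⟨ cong₂ right (lattice-total E≢0 i1) (lattice-total E≢0 i5) ⟨
      right (f i1 E) (f i5 E) ∎)
      where
      open ≡-Reasoning
      r : ℚ
      r = I E≢0 (cutting anything anything 2)
      right : ℚ → ℚ → ℚ
      right f₁ f₅ = f₁ ℚ.+ (f₁ ℚ.+ (f₅ ℚ.+ (f₅ ℚ.+ (f₅ ℚ.+ (f₅ ℚ.+ 0ℚ)))))
      isolate : ∀ r f₄ f₃ f₁ f₅ → r ℚ.+ (f₄ ℚ.+ (f₃ ℚ.+ (f₃ ℚ.+ 0ℚ))) ≡ right f₁ f₅ →
        r ≡ f₁ ℚ.+ (f₁ ℚ.- f₄ ℚ.- (+ 2 ℚ./ 1) ℚ.* f₃ ℚ.+ (+ 4 ℚ./ 1) ℚ.* f₅)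
      isolate r f₄ f₃ f₁ f₅ h = begin
        r
          ≡⟨ solve 3 (λ r f₄ f₃ → r := r :+ (f₄ :+ (f₃ :+ (f₃ :+ con 0ℚ))) :- (f₄ :+ con (+ 2 ℚ./ 1) :* f₃)) refl r f₄ f₃ ⟩
        r ℚ.+ (f₄ ℚ.+ (f₃ ℚ.+ (f₃ ℚ.+ 0ℚ))) ℚ.- (f₄ ℚ.+ (+ 2 ℚ./ 1) ℚ.* f₃)
          ≡⟨ cong (ℚ._- (f₄ ℚ.+ (+ 2 ℚ./ 1) ℚ.* f₃)) h ⟩
        right f₁ f₅ ℚ.- (f₄ ℚ.+ (+ 2 ℚ./ 1) ℚ.* f₃)
          ≡⟨ solve 4 (λ f₄ f₃ f₁ f₅ →
               f₁ :+ (f₁ :+ (f₅ :+ (f₅ :+ (f₅ :+ (f₅ :+ con 0ℚ))))) :- (f₄ :+ con (+ 2 ℚ./ 1) :* f₃) :=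
               f₁ :+ (f₁ :- f₄ :- con (+ 2 ℚ./ 1) :* f₃ :+ con (+ 4 ℚ./ 1) :* f₅)) refl f₄ f₃ f₁ f₅ ⟩
        f₁ ℚ.+ (f₁ ℚ.- f₄ ℚ.- (+ 2 ℚ./ 1) ℚ.* f₃ ℚ.+ (+ 4 ℚ./ 1) ℚ.* f₅) ∎

    -- The cut with cube quotient is traded for the cut by 4: together they exhaust the double
    -- roots, and the cut by 4 can be carried one Hecke step further down.
    quarter-total : ∀ {E} (E≢0 : E ≢ + 0) →
      I E≢0 (cutting mixed anything 2) ℚ.- I E≢0 (cutting anything cube 2) ≡
      I E≢0 (cutting anything anything 4) ℚ.- at-quarter E
    quarter-total {E} E≢0 = isolate h k m (f i3 E) (f i2 E) (f i1 E) (sh 16 (f i1) E) (begin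
      left (f i3 E) (f i2 E)
        ≡⟨ cong₂ left (lattice-total E≢0 i3) (lattice-total E≢0 i2) ⟩
      left (I E≢0 (lattice i3)) (I E≢0 (lattice i2))
        ≡⟨ balance (mass i1 E E≢0) balance-20′ ⟩
      right (I E≢0 (lattice i1)) (I E≢0 doubled)
        ≡⟨ cong₂ right (lattice-total E≢0 i1) (doubled-total E≢0) ⟨
      right (f i1 E) (sh 16 (f i1) E) ∎)
      where
      open ≡-Reasoning
      h k m : ℚ
      h = I E≢0 (cutting anything anything 4)
      k = I E≢0 (cutting anything cube 2)
      m = I E≢0 (cutting mixed anything 2)
      left right : ℚ → ℚ → ℚ
      left f₃ f₂ = h ℚ.+ (k ℚ.+ (f₃ ℚ.+ (f₂ ℚ.+ (f₂ ℚ.+ 0ℚ))))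
      right f₁ x = f₁ ℚ.+ (x ℚ.+ (x ℚ.+ (x ℚ.+ (x ℚ.+ (x ℚ.+ (m ℚ.+ 0ℚ))))))
      isolate : ∀ h k m f₃ f₂ f₁ x → h ℚ.+ (k ℚ.+ (f₃ ℚ.+ (f₂ ℚ.+ (f₂ ℚ.+ 0ℚ)))) ≡
          f₁ ℚ.+ (x ℚ.+ (x ℚ.+ (x ℚ.+ (x ℚ.+ (x ℚ.+ (m ℚ.+ 0ℚ)))))) →
        m ℚ.- k ≡ h ℚ.- (f₁ ℚ.- f₃ ℚ.- (+ 2 ℚ./ 1) ℚ.* f₂ ℚ.+ (+ 5 ℚ./ 1) ℚ.* x)
      isolate h k m f₃ f₂ f₁ x e = begin
        m ℚ.- k
          ≡⟨ solve 4 (λ k m f₁ x → m :- k :=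
               f₁ :+ (x :+ (x :+ (x :+ (x :+ (x :+ (m :+ con 0ℚ)))))) :- (f₁ :+ con (+ 5 ℚ./ 1) :* x :+ k)) refl k m f₁ x ⟩
        f₁ ℚ.+ (x ℚ.+ (x ℚ.+ (x ℚ.+ (x ℚ.+ (x ℚ.+ (m ℚ.+ 0ℚ)))))) ℚ.- (f₁ ℚ.+ (+ 5 ℚ./ 1) ℚ.* x ℚ.+ k)
          ≡⟨ cong (ℚ._- (f₁ ℚ.+ (+ 5 ℚ./ 1) ℚ.* x ℚ.+ k)) e ⟨
        h ℚ.+ (k ℚ.+ (f₃ ℚ.+ (f₂ ℚ.+ (f₂ ℚ.+ 0ℚ)))) ℚ.- (f₁ ℚ.+ (+ 5 ℚ./ 1) ℚ.* x ℚ.+ k)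
          ≡⟨ solve 6 (λ h k f₃ f₂ f₁ x →
               h :+ (k :+ (f₃ :+ (f₂ :+ (f₂ :+ con 0ℚ)))) :- (f₁ :+ con (+ 5 ℚ./ 1) :* x :+ k) :=
               h :- (f₁ :- f₃ :- con (+ 2 ℚ./ 1) :* f₂ :+ con (+ 5 ℚ./ 1) :* x)) refl h k f₃ f₂ f₁ x ⟩
        h ℚ.- (f₁ ℚ.- f₃ ℚ.- (+ 2 ℚ./ 1) ℚ.* f₂ ℚ.+ (+ 5 ℚ./ 1) ℚ.* x) ∎

    -- This is the second Hecke step, from E to E / 4. The right side is evaluated at E * 4 because
    -- that is the original D, of which E / 4 is the sixteenth part.
    roots-shift : ∀ {E} (E≢0 : E ≢ + 0) →
      I E≢0 (cutting anything anything 4) ≡ sh 16 (f i1) (E * + 4) ℚ.+ sh 16 at-sixteenth (E * + 4)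
    roots-shift {E} E≢0 = by-cases (multiple? 4 E)
      where
      open ≡-Reasoning
      by-cases : (∃ λ E′ → E ≡ E′ * + 4) ⊎ (∀ E′ → E ≢ E′ * + 4) →
        I E≢0 (cutting anything anything 4) ≡ sh 16 (f i1) (E * + 4) ℚ.+ sh 16 at-sixteenth (E * + 4)
      by-cases (inj₂ E≢) = begin
        I E≢0 (cutting anything anything 4)
          ≡⟨ cutting-other anything anything E≢0 E≢ ⟩
        0ℚ ℚ.+ 0ℚ
          ≡⟨ cong₂ ℚ._+_ (sh-other 16 (f i1) not-16) (sh-other 16 at-sixteenth not-16) ⟨
        sh 16 (f i1) (E * + 4) ℚ.+ sh 16 at-sixteenth (E * + 4) ∎
        where
        not-16 : ∀ E′ → E * + 4 ≢ E′ * + 16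
        not-16 E′ e = E≢ E′ (ℤ.*-cancelʳ-≡ E (E′ * + 4) (+ 4) (trans e (sym (ℤ.*-assoc E′ (+ 4) (+ 4)))))
      by-cases (inj₁ (E′ , refl)) = begin
        I E≢0 (cutting anything anything 4)
          ≡⟨ cutting-multiple {u = anything} {anything} anything-invariant anything-invariant E′≢0 E≢0 ⟨
        I E′≢0 (cutting anything anything 2)
          ≡⟨ roots-total E′≢0 ⟩
        f i1 E′ ℚ.+ at-sixteenth E′
          ≡⟨ cong₂ ℚ._+_ (sh-multiple 16 (f i1) E′) (sh-multiple 16 at-sixteenth E′) ⟨
        sh 16 (f i1) (E′ * + 16) ℚ.+ sh 16 at-sixteenth (E′ * + 16)
          ≡⟨ cong (λ D → sh 16 (f i1) D ℚ.+ sh 16 at-sixteenth D) (ℤ.*-assoc E′ (+ 4) (+ 4)) ⟨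
        sh 16 (f i1) (E * + 4) ℚ.+ sh 16 at-sixteenth (E * + 4) ∎
        where
        E′≢0 : E′ ≢ + 0
        E′≢0 = factor≢0 refl E≢0

    cutting-shift : ∀ {D} (D≢0 : D ≢ + 0) → I D≢0 (cutting anything mixed 4) ℚ.- I D≢0 (cutting cube anything 4) ≡
      (sh 16 (f i1) D ℚ.+ sh 16 at-sixteenth D) ℚ.- sh 4 at-quarter D
    cutting-shift {D} D≢0 = by-cases (multiple? 4 D)
      where
      open ≡-Reasoning
      by-cases : (∃ λ E → D ≡ E * + 4) ⊎ (∀ E → D ≢ E * + 4) →
        I D≢0 (cutting anything mixed 4) ℚ.- I D≢0 (cutting cube anything 4) ≡
        (sh 16 (f i1) D ℚ.+ sh 16 at-sixteenth D) ℚ.- sh 4 at-quarter D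
      by-cases (inj₂ D≢) = begin
        I D≢0 (cutting anything mixed 4) ℚ.- I D≢0 (cutting cube anything 4)
          ≡⟨ cong₂ ℚ._-_ (cutting-other mixed anything D≢0 D≢) (cutting-other anything cube D≢0 D≢) ⟩
        (0ℚ ℚ.+ 0ℚ) ℚ.- 0ℚ
          ≡⟨ cong₂ ℚ._-_ (cong₂ ℚ._+_ (sh-other 16 (f i1) not-16) (sh-other 16 at-sixteenth not-16)) (sh-other 4 at-quarter D≢) ⟨
        (sh 16 (f i1) D ℚ.+ sh 16 at-sixteenth D) ℚ.- sh 4 at-quarter D ∎
        where
        not-16 : ∀ E → D ≢ E * + 16
        not-16 E e = D≢ (E * + 4) (trans e (sym (ℤ.*-assoc E (+ 4) (+ 4))))
      by-cases (inj₁ (E , refl)) = begin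
        I D≢0 (cutting anything mixed 4) ℚ.- I D≢0 (cutting cube anything 4)
          ≡⟨ cong₂ ℚ._-_ (cutting-multiple {u = mixed} {anything} mixed-invariant anything-invariant E≢0 D≢0)
               (cutting-multiple {u = anything} {cube} anything-invariant cube-invariant E≢0 D≢0) ⟨
        I E≢0 (cutting mixed anything 2) ℚ.- I E≢0 (cutting anything cube 2)
          ≡⟨ quarter-total E≢0 ⟩
        I E≢0 (cutting anything anything 4) ℚ.- at-quarter E
          ≡⟨ cong₂ ℚ._-_ (roots-shift E≢0) (sym (sh-multiple 4 at-quarter E)) ⟩
        (sh 16 (f i1) D ℚ.+ sh 16 at-sixteenth D) ℚ.- sh 4 at-quarter D ∎
        where
        E≢0 : E ≢ + 0
        E≢0 = factor≢0 refl D≢0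

    relation-20 : ∀ D → D ≢ + 0 → e₂₀ D ≡
      ((f i4 D ℚ.- f i2 D ℚ.- f i5 D ℚ.+ (+ 2 ℚ./ 1) ℚ.* sh 16 (f i1) D) ℚ.+ sh 16 at-sixteenth D) ℚ.- sh 4 at-quarter D
    relation-20 D D≢0 = begin
      e₂₀ D
        ≡⟨ congruence-20 D≢0 ⟩
      (f i4 D ℚ.- f i2 D ℚ.- f i5 D ℚ.+ x) ℚ.+ (I D≢0 (cutting anything mixed 4) ℚ.- I D≢0 (cutting cube anything 4))
        ≡⟨ cong (λ t → (f i4 D ℚ.- f i2 D ℚ.- f i5 D ℚ.+ x) ℚ.+ t) (cutting-shift D≢0) ⟩
      (f i4 D ℚ.- f i2 D ℚ.- f i5 D ℚ.+ x) ℚ.+ ((x ℚ.+ s) ℚ.- q)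
        -- One `x` counts the zero forms modulo 2 in the bracket for the cubes; the other comes from
        -- the roots at level D/16.
        ≡⟨ solve 4 (λ p x s q → (p :+ x) :+ ((x :+ s) :- q) := (p :+ con (+ 2 ℚ./ 1) :* x) :+ s :- q) refl
             (f i4 D ℚ.- f i2 D ℚ.- f i5 D) x s q ⟩
      ((f i4 D ℚ.- f i2 D ℚ.- f i5 D ℚ.+ (+ 2 ℚ./ 1) ℚ.* x) ℚ.+ s) ℚ.- q ∎
      where
      open ≡-Reasoning
      x s q : ℚ
      x = sh 16 (f i1) D
      s = sh 16 at-sixteenth D
      q = sh 4 at-quarter D

  -- The integral family and the dual family.

  congruence-spec : ∀ N .{{_ : ℕ.NonZero N}} {l} x → l ℕ.< N → (+ N ℤ∣.∣ (x - + l)) ⇔ ((x %ℕ N ℕ.≡ᵇ l) ≡ true)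
  congruence-spec N {l} x l<N = mk⇔ to from
    where
    add : ∀ x l → x ≡ l + (x - l)
    add = solve-∀
    cancel : ∀ l y → (l + y) - l ≡ y
    cancel = solve-∀
    to : + N ℤ∣.∣ (x - + l) → (x %ℕ N ℕ.≡ᵇ l) ≡ true
    to N∣ with ℤ∣ˢ.divides q e ← ℤ∣ˢ.∣ᵤ⇒∣ {+ N} {x - + l} N∣ =
      ≡⇒≡ᵇ (%ℕ-unique {N} {x = x} q l<N (trans (add x (+ l)) (cong (λ t → + l + t) e)))
    from : (x %ℕ N ℕ.≡ᵇ l) ≡ true → + N ℤ∣.∣ (x - + l)
    from e = ℤ∣ˢ.∣⇒∣ᵤ (ℤ∣ˢ.divides (x /ℕ N) (trans
      (cong (_- + l) (trans (a≡a%ℕn+[a/ℕn]*n x N) (cong (λ r → + r + x /ℕ N * + N) (≡ᵇ⇒≡ {x %ℕ N} e))))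
      (cancel (+ l) (x /ℕ N * + N))))

  integral-lattice : Lattice (L i1) (+ 1)
  integral-lattice = record
    { ▹-closed = λ _ _ _ → tt
    ; double   = λ _ _ → tt
    ; halve    = λ _ _ → tt
    ; α        = + 1
    ; β        = + 0
    ; coprime  = refl
    }

  integral-family : Family L (Lcong (+ 4) 32) (Lcong (+ 20) 32) (+ 1)
  integral-family = record
    { isLattice = integral-lattice
    ; S-member  = λ i F → mk⇔ (λ F∈ → tt , Equivalence.to (L-member i F) F∈) (Equivalence.from (L-member i F) ∘ proj₂)
    ; S₄-spec   = λ D F PF → spec 4 (ℕ.m≤m+n 5 27) D F PF
    ; S₂₀-spec  = λ D F PF → spec 20 (ℕ.m≤m+n 21 11) D F PF
    }
    where
    spec : ∀ l → l ℕ.< 32 → ∀ D F → P F ≡ + 1 * D →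
      Lcong (+ l) 32 F ⇔ (⊤ × ((+ 1 * D) %ℕ 32 ℕ.≡ᵇ l) ≡ true)
    spec l l<32 D F PF = mk⇔
      (λ h → tt , subst (λ x → (x %ℕ 32 ℕ.≡ᵇ l) ≡ true) PF (Equivalence.to (congruence-spec 32 (P F) l<32) h))
      (λ (_ , h) → Equivalence.from (congruence-spec 32 (P F) l<32) (subst (λ x → (x %ℕ 32 ℕ.≡ᵇ l) ≡ true) (sym PF) h))

  opaque
    unfolding _▹_

    L1∨-▹ : ∀ h F → L1∨ F → L1∨ (F ▹ h)
    L1∨-▹ (mat p q r s) (form a b c d) (3∣b , 3∣c)
      with ℤ∣ˢ.divides b₁ refl ← ℤ∣ˢ.∣ᵤ⇒∣ {+ 3} {b} 3∣b | ℤ∣ˢ.divides c₁ refl ← ℤ∣ˢ.∣ᵤ⇒∣ {+ 3} {c} 3∣c =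
      ℤ∣ˢ.∣⇒∣ᵤ (ℤ∣ˢ.divides (a * p * p * q + b₁ * (p * p * s + + 2 * p * q * r) + c₁ * (q * r * r + + 2 * p * r * s) + d * r * r * s)
        (eq a p p q b₁ (p * p * s + + 2 * p * q * r) c₁ (q * r * r + + 2 * p * r * s) d r r s)) ,
      ℤ∣ˢ.∣⇒∣ᵤ (ℤ∣ˢ.divides (a * p * q * q + b₁ * (+ 2 * p * q * s + q * q * r) + c₁ * (p * s * s + + 2 * q * r * s) + d * r * s * s)
        (eq a p q q b₁ (+ 2 * p * q * s + q * q * r) c₁ (p * s * s + + 2 * q * r * s) d r s s))
      where
      eq : ∀ a x y z b X c Y d x′ y′ z′ →
        + 3 * a * x * y * z + b * + 3 * X + c * + 3 * Y + + 3 * d * x′ * y′ * z′ ≡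
        (a * x * y * z + b * X + c * Y + d * x′ * y′ * z′) * + 3
      eq = solve-∀

  dual-lattice : Lattice L1∨ (+ 27)
  dual-lattice = record
    { ▹-closed = L1∨-▹
    ; double   = λ F (3∣b , 3∣c) → twice (b F) 3∣b , twice (c F) 3∣c
    ; halve    = λ F (3∣b , 3∣c) → once (b F) 3∣b , once (c F) 3∣c
    -- 19 · 27 = 513 = 1 + 16 · 32.
    ; α        = + 19
    ; β        = - + 16
    ; coprime  = refl
    }
    where
    twice : ∀ x → + 3 ℤ∣.∣ x → + 3 ℤ∣.∣ (+ 2 * x)
    twice x 3∣x = ℤ∣ˢ.∣⇒∣ᵤ {+ 3} {+ 2 * x} (ℤ∣ˢ.∣n⇒∣m*n (+ 2) {x} (ℤ∣ˢ.∣ᵤ⇒∣ {+ 3} {x} 3∣x))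
    once : ∀ x → + 3 ℤ∣.∣ (+ 2 * x) → + 3 ℤ∣.∣ x
    once x 3∣2x with ℤ∣ˢ.divides q e ← ℤ∣ˢ.∣ᵤ⇒∣ {+ 3} {+ 2 * x} 3∣2x =
      ℤ∣ˢ.∣⇒∣ᵤ (ℤ∣ˢ.divides (x - q) (trans (eq x) (trans (cong (λ t → x * + 3 - t) e) (eq′ x q))))
      where
      eq : ∀ x → x ≡ x * + 3 - + 2 * x
      eq = solve-∀
      eq′ : ∀ x q → x * + 3 - q * + 3 ≡ (x - q) * + 3
      eq′ = solve-∀

  -- Chosen so that `L∨ (dual i)` carries the parity conditions of `L i`, which lets the dual masses
  -- obey the same relations.
  dual : Idx → Idx
  dual i1 = i1
  dual i2 = i3
  dual i3 = i2
  dual i4 = i5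
  dual i5 = i4

  ×-⇔ : ∀ {X Y Z : Set} → Y ⇔ Z → (X × Y) ⇔ (X × Z)
  ×-⇔ f = mk⇔ (λ (x , y) → x , Equivalence.to f y) (λ (x , z) → x , Equivalence.from f z)

  dual-member : ∀ i F → L∨ (dual i) F ⇔ (L1∨ F × member i (parity F) ≡ true)
  dual-member i1 F = mk⇔ (λ F∈ → F∈ , refl) proj₁
  dual-member i2 F = ×-⇔ (L-member i2 F)
  dual-member i3 F = ×-⇔ (L-member i3 F)
  dual-member i4 F = ×-⇔ (L-member i4 F)
  dual-member i5 F = ×-⇔ (L-member i5 F)

  -- Multiplication by 27 turns the class of -m modulo 32 into that of l; its inverse is 19.
  dual-congruence : ∀ {l} m s t → l ℕ.< 32 → + 27 * (- + m) ≡ + l - s * + 32 → + 19 * + l + + m ≡ t * + 32 →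
    ∀ D F → P F ≡ + 27 * D → L∨cong (- + m) 32 F ⇔ (L1∨ F × ((+ 27 * D) %ℕ 32 ℕ.≡ᵇ l) ≡ true)
  dual-congruence {l} m s t l<32 hs ht D F PF = ×-⇔ (mk⇔ to from)
    where
    open ≡-Reasoning
    to : (Σ ℤ λ k → P F ≡ + 27 * k × + 32 ℤ∣.∣ (k - - + m)) → ((+ 27 * D) %ℕ 32 ℕ.≡ᵇ l) ≡ true
    to (k , PF′ , 32∣) with ℤ∣ˢ.divides q e ← ℤ∣ˢ.∣ᵤ⇒∣ {+ 32} {k - - + m} 32∣ =
      ≡⇒≡ᵇ (%ℕ-unique {32} {x = + 27 * D} (+ 27 * q - s) l<32 (begin
        + 27 * D                                    ≡⟨ PF ⟨
        P F                                         ≡⟨ PF′ ⟩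
        + 27 * k                                    ≡⟨ eq₁ k (- + m) ⟩
        + 27 * (k - - + m) + + 27 * (- + m)         ≡⟨ cong₂ (λ x y → + 27 * x + y) e hs ⟩
        + 27 * (q * + 32) + (+ l - s * + 32)        ≡⟨ eq₂ q (+ l) s ⟩
        + l + (+ 27 * q - s) * + 32                 ∎))
      where
      eq₁ : ∀ k m → + 27 * k ≡ + 27 * (k - m) + + 27 * m
      eq₁ = solve-∀
      eq₂ : ∀ q l s → + 27 * (q * + 32) + (l - s * + 32) ≡ l + (+ 27 * q - s) * + 32
      eq₂ = solve-∀
    from : ((+ 27 * D) %ℕ 32 ℕ.≡ᵇ l) ≡ true → Σ ℤ λ k → P F ≡ + 27 * k × + 32 ℤ∣.∣ (k - - + m)
    from h = D , PF , ℤ∣ˢ.∣⇒∣ᵤ (ℤ∣ˢ.divides (t + + 19 * q - + 16 * D) (begin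
      D - - + m                                           ≡⟨ eq₁ D (+ m) ⟩
      + 19 * (+ 27 * D) + + m - + 16 * D * + 32           ≡⟨ cong (λ x → + 19 * x + + m - + 16 * D * + 32) 27D≡ ⟩
      + 19 * (+ l + q * + 32) + + m - + 16 * D * + 32     ≡⟨ eq₂ (+ l) q (+ m) D ⟩
      (+ 19 * + l + + m) + (+ 19 * q - + 16 * D) * + 32   ≡⟨ cong (_+ (+ 19 * q - + 16 * D) * + 32) ht ⟩
      t * + 32 + (+ 19 * q - + 16 * D) * + 32             ≡⟨ eq₃ t q D ⟩
      (t + + 19 * q - + 16 * D) * + 32                    ∎))
      where
      q : ℤ
      q = (+ 27 * D) /ℕ 32
      27D≡ : + 27 * D ≡ + l + q * + 32
      27D≡ = trans (a≡a%ℕn+[a/ℕn]*n (+ 27 * D) 32) (cong (λ r → + r + q * + 32) (≡ᵇ⇒≡ {(+ 27 * D) %ℕ 32} h))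
      eq₁ : ∀ D m → D - - m ≡ + 19 * (+ 27 * D) + m - + 16 * D * + 32
      eq₁ = solve-∀
      eq₂ : ∀ l q m D → + 19 * (l + q * + 32) + m - + 16 * D * + 32 ≡ (+ 19 * l + m) + (+ 19 * q - + 16 * D) * + 32
      eq₂ = solve-∀
      eq₃ : ∀ t q D → t * + 32 + (+ 19 * q - + 16 * D) * + 32 ≡ (t + + 19 * q - + 16 * D) * + 32
      eq₃ = solve-∀

  dual-family : Family (L∨ ∘ dual) (L∨cong (- + 20) 32) (L∨cong (- + 4) 32) (+ 27)
  dual-family = record
    { isLattice = dual-lattice
    ; S-member  = dual-member
    -- 27 · (-20) = 4 - 17 · 32, and 19 · 4 + 20 = 3 · 32.
    ; S₄-spec   = dual-congruence 20 (+ 17) (+ 3) (ℕ.m≤m+n 5 27) refl refl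
    -- 27 · (-4) = 20 - 4 · 32, and 19 · 20 + 4 = 12 · 32.
    ; S₂₀-spec  = dual-congruence 4 (+ 4) (+ 12) (ℕ.m≤m+n 21 11) refl refl
    }


open import Data.Integer using (+_; -_)
open import Data.Rational using (_+_; _-_; _*_; _/_)

theorem3p8 : (f g : Idx → ℤ → ℚ) (e4 e20 e∨m20 e∨m4 : ℤ → ℚ) →
    (∀ i D → D ≢ + 0 → Mass (L i) D (f i D)) →
    (∀ i D → D ≢ + 0 → Mass (L∨ i) (+ 27 Data.Integer.* D) (g i D)) →
    (∀ D → D ≢ + 0 → Mass (Lcong (+ 4) 32) D (e4 D)) →
    (∀ D → D ≢ + 0 → Mass (Lcong (+ 20) 32) D (e20 D)) →
    (∀ D → D ≢ + 0 → Mass (L∨cong (- + 20) 32) (+ 27 Data.Integer.* D) (e∨m20 D)) →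
    (∀ D → D ≢ + 0 → Mass (L∨cong (- + 4) 32) (+ 27 Data.Integer.* D) (e∨m4 D)) →
    ∀ D → D ≢ + 0 →
    (e4 D ≡ (+ 3 / 1) * sh 4 (λ E → f i5 E - sh 16 (f i1) E) D)
    × (e∨m20 D ≡ (+ 3 / 1) * sh 4 (λ E → g i4 E - sh 16 (g i1) E) D)
    × (e20 D ≡
    ((f i4 D - f i2 D - f i5 D + (+ 2 / 1) * sh 16 (f i1) D)
    + sh 16 (λ E → f i1 E - f i4 E - (+ 2 / 1) * f i3 E + (+ 4 / 1) * f i5 E) D)
    - sh 4 (λ E → f i1 E - f i3 E - (+ 2 / 1) * f i2 E + (+ 5 / 1) * sh 16 (f i1) E) D)
    × (e∨m4 D ≡
    ((g i5 D - g i3 D - g i4 D + (+ 2 / 1) * sh 16 (g i1) D)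
    + sh 16 (λ E → g i1 E - g i5 E - (+ 2 / 1) * g i2 E + (+ 4 / 1) * g i4 E) D)
    - sh 4 (λ E → g i1 E - g i2 E - (+ 2 / 1) * g i3 E + (+ 5 / 1) * sh 16 (g i1) E) D)
theorem3p8 f g e4 e20 e∨m20 e∨m4 mass-L mass-L∨ mass-4 mass-20 mass-m20 mass-m4 D D≢0 =
  Integral.relation-4 D D≢0 , Dual.relation-4 D D≢0 , Integral.relation-20 D D≢0 , Dual.relation-20 D D≢0
  where
  rescale : ∀ {S D m} → Mass S D m → Mass S (+ 1 Data.Integer.* D) m
  rescale {S} {D} {m} = subst (λ x → Mass S x m) (sym (ℤ.*-identityˡ D))
  module Integral = Relations integral-family f e4 e20
    (λ i D D≢0 → rescale (mass-L i D D≢0)) (λ D D≢0 → rescale (mass-4 D D≢0)) (λ D D≢0 → rescale (mass-20 D D≢0))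
  -- Composing with `dual` exchanges the indices 2 and 3, and 4 and 5, so the same two relations
  -- come out in their dual form.
  module Dual = Relations dual-family (g ∘ dual) e∨m20 e∨m4 (mass-L∨ ∘ dual) mass-m20 mass-m4
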